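{- Every $\alpha$-galaxy satisfies the Erdős–Hajnal Conjecture: for every $\alpha$-galaxy $H$ there exists $\epsilon(H)>0$ such that every tournament $T$ not containing $H$ as a subtournament contains a transitive subtournament on at least $|T|^{\epsilon(H)}$ vertices.
   Context: Tournaments are finite; subtournament = induced subtournament; transitive = no directed cycle. Given an ordering of the vertex set, an edge $(x,y)$ is backward if $y$ precedes $x$; a tournament on an ordered vertex set is determined by its backward edges. For an ordering $\theta=(v_1,\dots,v_n)$ of $V(T)$, $B(T,\theta)$ is the undirected graph on $V(T)$ whose edges are the pairs joined by backward edges. A right (resp. left) star is an induced subgraph of $B(T,\theta)$ that is a star $K_{1,t}$ whose center is the last (resp. first) of its vertices in $\theta$ (for $t=1$ either vertex may be the center). $T$ is a galaxy if for some ordering $\theta$ (a galaxy ordering) every component of $B(T,\theta)$ is a left star, a right star or a singleton, and no center of a star lies between two leaves of another star; non-singleton components are the stars. Product: for tournaments $H_1,H_2$ with disjoint vertex sets and injective $f_1,f_2$ into $\mathbb{N}$ with disjoint images, with $\theta_i$ ordering $V(H_i)$ by increasing $f_i$ and $\theta$ ordering $V(H_1)\cup V(H_2)$ by the combined values, $H_1^{f_1}\oplus H_2^{f_2}$ is the tournament on $V(H_1)\cup V(H_2)$ whose backward edges under $\theta$ are exactly those of $H_1$ under $\theta_1$ and of $H_2$ under $\theta_2$. $\alpha$-galaxy: let $H_s$ have vertices $h_1,\dots,h_7$ with backward edges under $(h_1,\dots,h_7)$ exactly $(h_4,h_1),(h_6,h_4),(h_6,h_3),(h_7,h_5)$. Let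 $G$ be a galaxy with galaxy ordering $(g_1,\dots,g_r)$, let $0\le r_1\le r$ be such that no star of $G$ has one leaf in $\{g_1,\dots,g_{r_1}\}$ and another leaf in $\{g_{r_1+1},\dots,g_r\}$, and let $r_2,r_3\ge0$ with $r=r_1+r_2+r_3$. Set $\rho_2(g_i)=5+i$ for $i\le r_1$, $\rho_2(g_i)=6+i$ for $r_1<i\le r_1+r_2$, $\rho_2(g_i)=7+i$ for $r_1+r_2<i\le r$; $\rho_1(h_i)=i$ for $i\le5$, $\rho_1(h_6)=6+r_1$, $\rho_1(h_7)=7+r_1+r_2$. Then $H_s^{\rho_1}\oplus G^{\rho_2}$ is an $\alpha$-galaxy. -}

module Defs where

open import Data.Nat using (ℕ; zero; suc; _+_; _^_; _≤_; _<_; _<ᵇ_)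
open import Data.Fin using (Fin; toℕ; inject₁; fromℕ) renaming (zero to fzero; suc to fsuc)
open import Data.Bool using (Bool; true; false; not; _∧_; _∨_; if_then_else_)
open import Data.Sum using (_⊎_; inj₁; inj₂; [_,_])
open import Data.Product using (Σ; ∃; _×_; _,_)
open import Relation.Binary.PropositionalEquality using (_≡_; _≢_)
open import Relation.Nullary using (¬_)
open import Function.Definitions using (Injective)

-- Tournaments.  A (finite) tournament on a vertex type V is given by its
-- edge relation  E x y ≡ true  iff  (x , y) is an edge x → y.

Rel : Set → Set
Rel V = V → V → Bool

record IsTournament {V : Set} (E : Rel V) : Set where
  field
    irrefl : ∀ x → E x x ≡ false
    tourn  : ∀ x y → x ≢ y → E x y ≡ not (E y x)

Contains : {V : Set} → Rel V → {n : ℕ} → Rel (Fin n) → Set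
Contains {V} EH {n} ET =
  Σ (V → Fin n) λ f → Injective _≡_ _≡_ f × (∀ x y → EH x y ≡ ET (f x) (f y))

HasCycle : {m : ℕ} → Rel (Fin m) → Set
HasCycle {m} E =
  Σ ℕ λ k → Σ (Fin (suc k) → Fin m) λ c →
    Injective _≡_ _≡_ c ×
    (∀ (i : Fin k) → E (c (inject₁ i)) (c (fsuc i)) ≡ true) ×
    E (c (fromℕ k)) (c fzero) ≡ true

Transitive : {m : ℕ} → Rel (Fin m) → Set
Transitive E = ¬ HasCycle E

HasTransitiveSub : {n : ℕ} → Rel (Fin n) → ℕ → Set
HasTransitiveSub {n} ET m =
  Σ (Fin m → Fin n) λ f → Injective _≡_ _≡_ f × Transitive (λ x y → ET (f x) (f y))

-- Tournaments on an ordered vertex set, determined by backward edges.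
-- Given an injective value function v (the ordering is by increasing v)
-- and a symmetric relation Bk of "pairs joined by a backward edge",
-- the edge x → y is present iff it goes forward and the pair is not
-- backward, or goes backward and the pair is backward.
fromBackward : {V : Set} → (V → ℕ) → Rel V → Rel V
fromBackward v Bk x y = if Bk x y then v y <ᵇ v x else v x <ᵇ v y

backwardPair : {V : Set} → (V → ℕ) → Rel V → Rel V
backwardPair v E x y = ((v y <ᵇ v x) ∧ E x y) ∨ ((v x <ᵇ v y) ∧ E y x)

product : {V₁ V₂ : Set} → Rel V₁ → (V₁ → ℕ) → Rel V₂ → (V₂ → ℕ) → Rel (V₁ ⊎ V₂)
product {V₁} {V₂} E₁ f₁ E₂ f₂ = fromBackward val Bk
  where
  val : V₁ ⊎ V₂ → ℕ
  val = [ f₁ , f₂ ]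
  Bk : Rel (V₁ ⊎ V₂)
  Bk (inj₁ x) (inj₁ y) = backwardPair f₁ E₁ x y
  Bk (inj₂ x) (inj₂ y) = backwardPair f₂ E₂ x y
  Bk (inj₁ _) (inj₂ _) = false
  Bk (inj₂ _) (inj₁ _) = false

-- Galaxies.  For a tournament E on Fin r we take the ordering
-- (0, 1, …, r-1) and work with the backward graph B = B(E, id).

module _ {r : ℕ} (E : Rel (Fin r)) where

  adjB : Fin r → Fin r → Set
  adjB x y = backwardPair toℕ E x y ≡ true

  data Reach (x : Fin r) : Fin r → Set where
    here : Reach x x
    step : ∀ {y z} → Reach x y → adjB y z → Reach x z

  -- c is the center of a star component of B: c has a neighbour, its
  -- component is {c} ∪ N(c), N(c) is independent (so the component induces
  -- K_{1,t}, t ≥ 1), and c is the last (right star) or first (left star)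
  -- of its vertices in the ordering.
  StarCenter : Fin r → Set
  StarCenter c =
    (Σ (Fin r) λ x → adjB c x) ×
    (∀ u → Reach c u → u ≡ c ⊎ adjB c u) ×
    (∀ x y → adjB c x → adjB c y → ¬ adjB x y) ×
    ((∀ x → adjB c x → toℕ x < toℕ c) ⊎ (∀ x → adjB c x → toℕ c < toℕ x))

  -- The natural order of Fin r is a galaxy ordering of E.  The predicate
  -- `center` selects the designated centers of the stars (for a star K_{1,1}
  -- either vertex may serve as center).
  record IsGalaxyOrdering : Set where
    field
      center        : Fin r → Bool
      center-star   : ∀ c → center c ≡ true → StarCenter c
      components    : ∀ v → (∀ u → Reach v u → u ≡ v)
                            ⊎ (Σ (Fin r) λ c → center c ≡ true × Reach v c)
      no-between    : ∀ c c' → center c ≡ true → center c' ≡ true →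
                      ¬ Reach c' c →
                      ∀ x y → adjB c' x → adjB c' y →
                      ¬ (toℕ x < toℕ c × toℕ c < toℕ y)

  NoStarSplitAt : ℕ → Set
  NoStarSplitAt r₁ = ∀ c → StarCenter c → ∀ x y → adjB c x → adjB c y →
                     ¬ (toℕ x < r₁ × r₁ ≤ toℕ y)

-- The tournament H_s on h₁, …, h₇ (here Fin 7, hᵢ = vertex i-1), with
-- backward edges under (h₁,…,h₇) exactly (h₄,h₁),(h₆,h₄),(h₆,h₃),(h₇,h₅).

BkHs : Rel ℕ
BkHs 3 0 = true
BkHs 0 3 = true
BkHs 5 3 = true
BkHs 3 5 = true
BkHs 5 2 = true
BkHs 2 5 = true
BkHs 6 4 = true
BkHs 4 6 = true
BkHs _ _ = false

Hs : Rel (Fin 7)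
Hs = fromBackward toℕ (λ x y → BkHs (toℕ x) (toℕ y))

-- ρ₁ (h_i = vertex i-1 of Fin 7)
ρ₁ : ℕ → ℕ → Fin 7 → ℕ
ρ₁ r₁ r₂ i with toℕ i
... | 5 = 6 + r₁
... | 6 = 7 + r₁ + r₂
... | k = suc k

-- ρ₂ (g_i = vertex i-1 of Fin r)
ρ₂ : ℕ → ℕ → {r : ℕ} → Fin r → ℕ
ρ₂ r₁ r₂ g with suc (toℕ g)
... | i = if i Data.Nat.≤ᵇ r₁ then 5 + i
          else if i Data.Nat.≤ᵇ (r₁ + r₂) then 6 + i
          else 7 + i

alphaGalaxy : (r₁ r₂ r₃ : ℕ) → Rel (Fin (r₁ + r₂ + r₃)) → Rel (Fin 7 ⊎ Fin (r₁ + r₂ + r₃))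
alphaGalaxy r₁ r₂ r₃ G = product Hs (ρ₁ r₁ r₂) G (ρ₂ r₁ r₂)

{-# OPTIONS --safe #-}
-- Take a tournament T without the α-galaxy H in which all chains (transitive subtournaments, listed
-- in order) have at most t < |T|^(1/K) vertices, while every smaller tournament satisfies the claim.
-- For large K a set of linear size contains a chain of almost t vertices, so neither a set of linear
-- size nor a chain of order t can be complete to, or from, a set of linear size.
-- The greedy embedding argument of Erdős and Hajnal, applied to H and iterated, gives many disjoint
-- linear sets in order with few backward edges; some are replaced by chains, and discarding atypical
-- vertices makes the system of cells smooth in both directions.  There the stars of G, the star h₅h₇
-- and an extra star h₁h₂ are found one at a time, the leaves of a star inside a single chain.
-- For the rest, take y and z in two linear cells with a backward edge zy, and backward neighbours
-- x₁ of y and x₃ of z in a chain in front of them, x₁ before x₃.  If x₁yzx₃ is induced in the backward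
-- graph, it is the path h₁h₄h₆h₃ of the ordering h₁, …, h₇.  Otherwise x₁yz or x₃yz is a backward
-- triangle, and together with the star h₁h₂ it gives H_s in the ordering h₂, h₄, h₁, h₃, h₅, h₆, h₇.

module Submission where

open import Data.Nat
open import Data.Nat.Properties
open import Algebra.Properties.CommutativeSemigroup +-commutativeSemigroup using (x∙yz≈y∙xz)
open import Data.Nat.Tactic.RingSolver using (solve-∀)
open import Data.Bool using (Bool; true; false; not; _∧_; _∨_; if_then_else_)
import Data.Bool.Properties as Bool
open import Data.List using (List; []; _∷_; _++_; length; filter; take; drop; map; lookup; upTo; allFin)
open import Data.List.Properties using (length-++; length-take; length-drop; take++drop≡id; length-upTo; length-filter; length-map; length-tabulate)
open import Data.List.Membership.Propositional using (_∈_; _∉_; find; lose)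
open import Data.List.Membership.Propositional.Properties using (∈-filter⁺; ∈-filter⁻; ∈-++⁺ˡ; ∈-++⁺ʳ; ∈-++⁻; ∈-map⁺; ∈-map⁻; ∈-allFin; ∈-upTo⁺; ∈-upTo⁻; ∈-lookup)
open import Data.List.Relation.Unary.Any as Any using (Any; here; there; any?)
open import Data.List.Relation.Unary.All as All using (All; []; _∷_; all?)
open import Data.List.Relation.Unary.AllPairs using (AllPairs; []; _∷_)
open import Data.List.Relation.Binary.Sublist.Propositional using (_⊆_; []; _∷_; _∷ʳ_; ⊆-refl; ⊆-trans)
open import Data.List.Relation.Binary.Sublist.Propositional.Properties using (filter-⊆; length-mono-≤; take-⊆; drop-⊆; All-resp-⊆; Any-resp-⊆)
import Data.List.Relation.Unary.AllPairs.Properties as AllPairsₚ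
open import Data.Product using (Σ; ∃; _×_; _,_; proj₁; proj₂)
open import Data.Sum using (_⊎_; inj₁; inj₂; [_,_]′)
open import Data.Empty using (⊥; ⊥-elim)
open import Function using (_∘_; flip; id; it)
open import Relation.Binary.PropositionalEquality
open import Relation.Nullary using (¬_; Dec; yes; no; does; contradiction)
open import Relation.Nullary.Decidable using (¬?; dec-true; dec-false; _×-dec_; _⊎-dec_; from-yes)
open import Relation.Unary using (Decidable)
open import Data.List.Relation.Unary.Unique.Propositional using (Unique)
open import Defs
import Data.List.Relation.Unary.All.Properties as Allₚ
open import Data.Nat.DivMod using (_/_; _%_; m/n*n≤m; m≡m%n+[m/n]*n; m%n<n; m≥n⇒m/n>0)
open import Relation.Binary.Definitions using (DecidableEquality; Tri; tri<; tri≈; tri>)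
open import Data.Fin using (Fin; toℕ; inject₁; fromℕ) renaming (zero to fzero; suc to fsuc)
open import Data.Fin.Properties using (toℕ-injective; toℕ<n)
import Data.Fin.Properties as Fin
import Data.Sum.Properties as Sum
import Data.List.Relation.Unary.Unique.Propositional.Properties as Uniqueₚ
open import Data.Fin.Patterns

-- Counting and double counting

-- The backward edges of `H_s` form the path `h₁h₄h₆h₃` besides the edge `h₅h₇`, and this path is
-- the obstacle. Smooth cells yield stars: a center with a backward neighbour in a given half of
-- each leaf cell exists, since otherwise a linear set would be complete to such a half. For the
-- path, the edges `x₁z` and `x₃y` would have to be right as well, but `x₁` is found for `y` alone
-- and `x₃` for `z` alone. So one fixed set of nine cells must contain `H_s` for all four outcomes.
-- The leaves of a star must be pairwise forward, which a common chain guarantees; hence no linear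
-- cell may lie between two of them. For the centers of `G` this is the galaxy condition, for `h₆`
-- it is the condition on `r₁`, and `h₇`, being a leaf, gets a cell that is not linear. Criticality
-- is used additively: a chain of at least `d t / (d + 1)` vertices in a linear set, joined to any
-- chain of more than `t / (d + 1)` vertices, would exceed `t`. The second chain may thus be a small
-- piece of a chain block. All other constants are fixed before the exponent `K`.

module _ {A : Set} where

  private variable
    P Q : A → Set
    xs ys : List A

  count : Decidable P → List A → ℕ
  count P? xs = length (filter P? xs)

  count-⊆ : (P? : Decidable P) → xs ⊆ ys → count P? xs ≤ count P? ys
  count-⊆ P? [] = z≤n
  count-⊆ P? (y ∷ʳ s) with does (P? y)
  ... | true  = m≤n⇒m≤1+n (count-⊆ P? s)
  ... | false = count-⊆ P? s
  count-⊆ P? (_∷_ {x} refl s) with does (P? x)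
  ... | true  = s≤s (count-⊆ P? s)
  ... | false = count-⊆ P? s

  count-mono : (P? : Decidable P) (Q? : Decidable Q) → (∀ {x} → x ∈ xs → P x → Q x) → count P? xs ≤ count Q? xs
  count-mono {xs = []} P? Q? h = z≤n
  count-mono {xs = x ∷ xs} P? Q? h with P? x | Q? x
  ... | yes p | yes _ = s≤s (count-mono P? Q? (h ∘ there))
  ... | yes p | no ¬q = contradiction (h (here refl) p) ¬q
  ... | no _  | yes _ = m≤n⇒m≤1+n (count-mono P? Q? (h ∘ there))
  ... | no _  | no _  = count-mono P? Q? (h ∘ there)

  count-mono-< : (P? : Decidable P) (Q? : Decidable Q) → (∀ {x} → P x → Q x) →
                 ∀ {x xs} → x ∈ xs → Q x → ¬ P x → count P? xs < count Q? xs
  count-mono-< P? Q? h {x} {xs = _ ∷ xs} (here refl) q ¬p with P? x | Q? x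
  ... | yes p | _ = contradiction p ¬p
  ... | no _ | yes _ = s≤s (count-mono {xs = xs} P? Q? λ _ → h)
  ... | no _ | no ¬q = contradiction q ¬q
  count-mono-< P? Q? h {xs = y ∷ _} (there i) q ¬p with P? y | Q? y
  ... | yes p | yes _ = s≤s (count-mono-< P? Q? h i q ¬p)
  ... | yes p | no ¬q = contradiction (h p) ¬q
  ... | no _  | yes _ = m≤n⇒m≤1+n (count-mono-< P? Q? h i q ¬p)
  ... | no _  | no _  = count-mono-< P? Q? h i q ¬p

  count-split : (P? : Decidable P) → ∀ xs → length xs ≡ count P? xs + count (¬? ∘ P?) xs
  count-split P? [] = refl
  count-split P? (x ∷ xs) with P? x
  ... | yes _ = cong suc (count-split P? xs)
  ... | no _  = trans (cong suc (count-split P? xs)) (sym (+-suc _ _))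

  count-⊎ : {Q′ : A → Set} (P? : Decidable P) (Q? : Decidable Q) (Q′? : Decidable Q′) →
            (∀ {x} → P x → Q x ⊎ Q′ x) → ∀ xs → count P? xs ≤ count Q? xs + count Q′? xs
  count-⊎ P? Q? Q′? h [] = z≤n
  count-⊎ P? Q? Q′? h (x ∷ xs) with P? x | Q? x | Q′? x | count-⊎ P? Q? Q′? h xs
  ... | yes p | yes _ | yes _ | ih = s≤s (≤-trans ih (+-monoʳ-≤ _ (n≤1+n _)))
  ... | yes p | yes _ | no _  | ih = s≤s ih
  ... | yes p | no _  | yes _ | ih = ≤-trans (s≤s ih) (≤-reflexive (sym (+-suc _ _)))
  ... | yes p | no a  | no b  | ih = [ (λ q → contradiction q a) , (λ q → contradiction q b) ]′ (h p)
  ... | no _  | yes _ | yes _ | ih = m≤n⇒m≤1+n (≤-trans ih (+-monoʳ-≤ _ (n≤1+n _)))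
  ... | no _  | yes _ | no _  | ih = m≤n⇒m≤1+n ih
  ... | no _  | no _  | yes _ | ih = ≤-trans ih (+-monoʳ-≤ _ (n≤1+n _))
  ... | no _  | no _  | no _  | ih = ih

  count-none : (P? : Decidable P) → (∀ {x} → x ∈ xs → ¬ P x) → count P? xs ≡ 0
  count-none {xs = []} P? h = refl
  count-none {xs = x ∷ xs} P? h with P? x
  ... | yes p = contradiction p (h (here refl))
  ... | no _  = count-none P? (h ∘ there)

  nonempty : {xs : List A} → 0 < length xs → Σ A (_∈ xs)
  nonempty {xs = x ∷ _} _ = x , here refl

private variable
  A B : Set

-- Densities are kept free of division: a density of at most `1/g` reads
-- `tot R? xs ys * g ≤ length xs * length ys`, so `g` is an inverse density throughout.
tot : {R : A → B → Set} → (∀ x y → Dec (R x y)) → List A → List B → ℕ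
tot R? []       ys = 0
tot R? (x ∷ xs) ys = count (R? x) ys + tot R? xs ys

tot-[] : {R : A → B → Set} (R? : ∀ x y → Dec (R x y)) → ∀ xs → tot R? xs [] ≡ 0
tot-[] R? []       = refl
tot-[] R? (_ ∷ xs) = tot-[] R? xs

tot-∷ : {R : A → B → Set} (R? : ∀ x y → Dec (R x y)) → ∀ xs y ys →
        tot R? xs (y ∷ ys) ≡ count (flip R? y) xs + tot R? xs ys
tot-∷ R? []       y ys = refl
tot-∷ R? (x ∷ xs) y ys with R? x y
... | yes _ = cong suc (trans (cong (count (R? x) ys +_) (tot-∷ R? xs y ys)) (x∙yz≈y∙xz (count (R? x) ys) (count (flip R? y) xs) (tot R? xs ys)))
... | no _  = trans (cong (count (R? x) ys +_) (tot-∷ R? xs y ys)) (x∙yz≈y∙xz (count (R? x) ys) (count (flip R? y) xs) (tot R? xs ys))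

tot-flip : {R : A → B → Set} (R? : ∀ x y → Dec (R x y)) → ∀ xs ys → tot R? xs ys ≡ tot (flip R?) ys xs
tot-flip R? xs []       = tot-[] R? xs
tot-flip R? xs (y ∷ ys) = trans (tot-∷ R? xs y ys) (cong (count (flip R? y) xs +_) (tot-flip R? xs ys))

tot-⊆ : {R : A → B → Set} (R? : ∀ x y → Dec (R x y)) → ∀ {xs xs′ ys ys′} →
        xs ⊆ xs′ → ys ⊆ ys′ → tot R? xs ys ≤ tot R? xs′ ys′
tot-⊆ R? []         t = z≤n
tot-⊆ R? (y ∷ʳ s)   t = ≤-trans (tot-⊆ R? s t) (m≤n+m _ _)
tot-⊆ R? (refl ∷ s) t = +-mono-≤ (count-⊆ (R? _) t) (tot-⊆ R? s t)

tot-mono : {R S : A → B → Set} (R? : ∀ x y → Dec (R x y)) (S? : ∀ x y → Dec (S x y)) →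
           (∀ {x y} → R x y → S x y) → ∀ xs ys → tot R? xs ys ≤ tot S? xs ys
tot-mono R? S? h []       ys = z≤n
tot-mono R? S? h (x ∷ xs) ys = +-mono-≤ (count-mono {xs = ys} (R? x) (S? x) λ _ → h) (tot-mono R? S? h xs ys)

tot-upper : {R : A → B → Set} (R? : ∀ x y → Dec (R x y)) → ∀ g xs ys →
            (∀ {x} → x ∈ xs → count (R? x) ys * g ≤ length ys) →
            tot R? xs ys * g ≤ length xs * length ys
tot-upper R? g []       ys h = z≤n
tot-upper R? g (x ∷ xs) ys h = begin
  (count (R? x) ys + tot R? xs ys) * g      ≡⟨ *-distribʳ-+ g (count (R? x) ys) _ ⟩
  count (R? x) ys * g + tot R? xs ys * g    ≤⟨ +-mono-≤ (h (here refl)) (tot-upper R? g xs ys (h ∘ there)) ⟩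
  length ys + length xs * length ys         ∎
  where open ≤-Reasoning

tot-lower : {R : A → B → Set} (R? : ∀ x y → Dec (R x y)) → ∀ g {b} {P : A → Set} (P? : Decidable P) xs ys →
            (∀ {x} → P x → b ≤ count (R? x) ys * g) →
            count P? xs * b ≤ tot R? xs ys * g
tot-lower R? g P? []       ys h = z≤n
tot-lower R? g {b} P? (x ∷ xs) ys h rewrite *-distribʳ-+ g (count (R? x) ys) (tot R? xs ys) with P? x
... | yes p = +-mono-≤ (h p) (tot-lower R? g P? xs ys h)
... | no _  = ≤-trans (tot-lower R? g P? xs ys h) (m≤n+m _ _)

-- Each row above density `1/g` contributes more than `length ys / g` pairs, while the total is at
-- most `length xs * length ys / (a * g)`.
markov : {R : A → B → Set} (R? : ∀ x y → Dec (R x y)) → ∀ a g xs ys → 0 < length ys →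
         tot R? xs ys * (a * g) ≤ length xs * length ys →
         count (λ x → length ys <? count (R? x) ys * g) xs * a ≤ length xs
markov R? a g xs ys@(_ ∷ _) _ h = *-cancelʳ-≤ _ _ (length ys) (begin
  c * a * length ys             ≡⟨ shuffle c a (length ys) ⟩
  c * length ys * a             ≤⟨ *-monoˡ-≤ a (tot-lower R? g (λ x → length ys <? count (R? x) ys * g) xs ys <⇒≤) ⟩
  tot R? xs ys * g * a          ≡⟨ shuffle′ (tot R? xs ys) a g ⟩
  tot R? xs ys * (a * g)        ≤⟨ h ⟩
  length xs * length ys         ∎)
  where
  open ≤-Reasoning
  c = count (λ x → length ys <? count (R? x) ys * g) xs
  shuffle : ∀ x y z → x * y * z ≡ x * z * y
  shuffle = solve-∀
  shuffle′ : ∀ x y z → x * z * y ≡ x * (y * z)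
  shuffle′ = solve-∀

count-union : ∀ {J : Set} {P : J → A → Set} (P? : ∀ j → Decidable (P j)) a xs (js : List J) →
              (∀ {j} → j ∈ js → count (P? j) xs * a ≤ length xs) →
              count (λ x → any? (λ j → P? j x) js) xs * a ≤ length js * length xs
count-union P? a xs [] h =
  ≤-reflexive (cong (_* a) (count-none {xs = xs} (λ x → any? (λ j → P? j x) []) λ _ ()))
count-union {P = P} P? a xs (j ∷ js) h = begin
  count (λ x → any? (λ j → P? j x) (j ∷ js)) xs * a
    ≤⟨ *-monoˡ-≤ a (count-⊎ _ (P? j) (λ x → any? (λ j → P? j x) js) (λ { (here p) → inj₁ p ; (there q) → inj₂ q }) xs) ⟩
  (count (P? j) xs + count (λ x → any? (λ j → P? j x) js) xs) * a
    ≡⟨ *-distribʳ-+ a (count (P? j) xs) _ ⟩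
  count (P? j) xs * a + count (λ x → any? (λ j → P? j x) js) xs * a
    ≤⟨ +-mono-≤ (h (here refl)) (count-union P? a xs js (h ∘ there)) ⟩
  length xs + length js * length xs ∎
  where open ≤-Reasoning

count-complement : {P : A → Set} (P? : Decidable P) → ∀ xs → count P? xs * 2 ≤ length xs → length xs ≤ 2 * count (¬? ∘ P?) xs
count-complement P? xs h = +-cancelˡ-≤ (length xs) _ _ (begin
  length xs + length xs                                    ≡⟨ cong (λ n → n + n) (count-split P? xs) ⟩
  (count P? xs + c) + (count P? xs + c)                    ≡⟨ shuffle (count P? xs) c ⟩
  count P? xs * 2 + 2 * c                                  ≤⟨ +-monoˡ-≤ (2 * c) h ⟩
  length xs + 2 * c                                        ∎)
  where
  open ≤-Reasoning
  c = count (¬? ∘ P?) xs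
  shuffle : ∀ a b → (a + b) + (a + b) ≡ a * 2 + 2 * b
  shuffle = solve-∀

module _ {J : Set} {R : J → A → B → Set} (R? : ∀ j x y → Dec (R j x y)) (ys : J → List B) (g : ℕ) where

  Poor : List J → A → Set
  Poor js x = Any (λ j → length (ys j) < count (R? j x) (ys j) * g) js

  poor? : ∀ js → Decidable (Poor js)
  poor? js x = any? (λ j → length (ys j) <? count (R? j x) (ys j) * g) js

  typical : List J → List A → List A
  typical js = filter (¬? ∘ poor? js)

  typical-sparse : ∀ {js xs x j} → x ∈ typical js xs → j ∈ js → count (R? j x) (ys j) * g ≤ length (ys j)
  typical-sparse {js} {xs} x∈ j∈ = ≮⇒≥ λ lt → proj₂ (∈-filter⁻ (¬? ∘ poor? js) {xs = xs} x∈) (lose j∈ lt)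

  -- By Markov each `j` spoils at most the fraction `1 / (2 * length js)` of `xs`, so all of them
  -- together spoil at most half.
  typical-half : ∀ js xs → (∀ {j} → j ∈ js → 0 < length (ys j)) →
                 (∀ {j} → j ∈ js → tot (R? j) xs (ys j) * (2 * length js * g) ≤ length xs * length (ys j)) →
                 length xs ≤ 2 * length (typical js xs)
  -- With no `j` the factor `length js` is zero and could not be cancelled, hence the separate case.
  typical-half [] xs pos h = ≤-trans (≤-reflexive (trans (count-split (poor? []) xs)
    (cong (_+ count (¬? ∘ poor? []) xs) (count-none {xs = xs} (poor? []) λ _ ())))) (m≤m+n _ _)
  typical-half js@(_ ∷ js′) xs pos h = count-complement (poor? js) xs (*-cancelˡ-≤ (length js) (begin
    length js * (count (poor? js) xs * 2)     ≡⟨ shuffle (length js) (count (poor? js) xs) ⟩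
    count (poor? js) xs * (2 * length js)     ≤⟨ count-union (λ j x → length (ys j) <? count (R? j x) (ys j) * g) (2 * length js) xs js
                                                   (λ {j} j∈ → markov (R? j) (2 * length js) g xs (ys j) (pos j∈) (h j∈)) ⟩
    length js * length xs                     ∎))
    where
    open ≤-Reasoning
    shuffle : ∀ a b → a * (b * 2) ≡ b * (2 * a)
    shuffle = solve-∀

-- Either the first property holds for half of the list, or half of the list is left to the
-- remaining ones. Halving once per property gives `2 ^ length js` instead of the sharper
-- `length js`; any constant will do.
pigeonhole : ∀ {J : Set} {P : J → A → Set} (P? : ∀ j → Decidable (P j)) (js : List J) xs → 0 < length xs →
             (∀ {x} → x ∈ xs → Any (λ j → P j x) js) →
             Σ J λ j → j ∈ js × length xs ≤ 2 ^ length js * count (P? j) xs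
pigeonhole P? [] (x ∷ xs) _ h with () ← h (here refl)
pigeonhole P? (j ∷ js) xs pos h with length xs ≤? 2 * count (P? j) xs
... | yes le = j , here refl , ≤-trans le (*-monoˡ-≤ _ (*-monoʳ-≤ 2 (m^n>0 2 (length js))))
... | no ¬le = let j′ , j′∈ , le = pigeonhole P? js ys pos′ h′ in j′ , there j′∈ , (begin
    length xs                                   ≤⟨ half ⟩
    2 * length ys                               ≤⟨ *-monoʳ-≤ 2 le ⟩
    2 * (2 ^ length js * count (P? j′) ys)      ≤⟨ *-monoʳ-≤ 2 (*-monoʳ-≤ (2 ^ length js) (count-⊆ (P? j′) (filter-⊆ _ xs))) ⟩
    2 * (2 ^ length js * count (P? j′) xs)      ≡⟨ *-assoc 2 (2 ^ length js) _ ⟨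
    2 ^ suc (length js) * count (P? j′) xs      ∎)
  where
  open ≤-Reasoning
  ys = filter (¬? ∘ P? j) xs
  half : length xs ≤ 2 * length ys
  half = count-complement (P? j) xs (≤-trans (≤-reflexive (*-comm (count (P? j) xs) 2)) (≰⇒≥ ¬le))
  pos′ : 0 < length ys
  pos′ = *-cancelˡ-< 2 0 _ (<-≤-trans pos half)
  h′ : ∀ {x} → x ∈ ys → Any (λ j → _) js
  h′ x∈ with x∈xs , ¬p ← ∈-filter⁻ (¬? ∘ P? j) {xs = xs} x∈ | h x∈xs
  ... | here p  = contradiction p ¬p
  ... | there a = a

-- Shrinking both sides to a fraction of at least `1/c` raises the density by a factor of at most
-- `c * c`, which is paid in advance.
sparse-⊆ : {R : A → B → Set} (R? : ∀ x y → Dec (R x y)) → ∀ g c .{{_ : NonZero c}} {xs xs′ ys ys′} →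
           xs′ ⊆ xs → ys′ ⊆ ys → length xs ≤ c * length xs′ → length ys ≤ c * length ys′ →
           tot R? xs ys * (g * (c * c)) ≤ length xs * length ys →
           tot R? xs′ ys′ * g ≤ length xs′ * length ys′
sparse-⊆ R? g c {xs} {xs′} {ys} {ys′} s t hx hy h = *-cancelʳ-≤ _ _ (c * c) {{m*n≢0 c c}} (begin
  tot R? xs′ ys′ * g * (c * c)                   ≡⟨ *-assoc (tot R? xs′ ys′) g (c * c) ⟩
  tot R? xs′ ys′ * (g * (c * c))                 ≤⟨ *-monoˡ-≤ (g * (c * c)) (tot-⊆ R? s t) ⟩
  tot R? xs ys * (g * (c * c))                   ≤⟨ h ⟩
  length xs * length ys                          ≤⟨ *-mono-≤ hx hy ⟩
  (c * length xs′) * (c * length ys′)            ≡⟨ shuffle c (length xs′) (length ys′) ⟩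
  length xs′ * length ys′ * (c * c)              ∎)
  where
  open ≤-Reasoning
  shuffle : ∀ c x y → (c * x) * (c * y) ≡ x * y * (c * c)
  shuffle = solve-∀

-- Sublists and consecutive segments of ordered lists

AllPairs-⊆ : ∀ {A : Set} {R : A → A → Set} {xs ys} → xs ⊆ ys → AllPairs R ys → AllPairs R xs
AllPairs-⊆ []         []       = []
AllPairs-⊆ (y ∷ʳ s)   (_ ∷ rs) = AllPairs-⊆ s rs
AllPairs-⊆ (refl ∷ s) (r ∷ rs) = All-resp-⊆ s r ∷ AllPairs-⊆ s rs

AllPairs-++⁻ : ∀ {A : Set} {R : A → A → Set} xs {ys x y} → AllPairs R (xs ++ ys) → x ∈ xs → y ∈ ys → R x y
AllPairs-++⁻ (_ ∷ xs) (r ∷ _)  (here refl) y∈ = All.lookup r (∈-++⁺ʳ xs y∈)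
AllPairs-++⁻ (_ ∷ xs) (_ ∷ rs) (there x∈)  y∈ = AllPairs-++⁻ xs rs x∈ y∈

seg : ∀ {A : Set} → ℕ → ℕ → List A → List A
seg m zero    xs = take m xs
seg m (suc i) xs = seg m i (drop m xs)

seg-⊆ : ∀ {A : Set} m i (xs : List A) → seg m i xs ⊆ xs
seg-⊆ m zero    xs = take-⊆ m xs
seg-⊆ m (suc i) xs = ⊆-trans (seg-⊆ m i (drop m xs)) (drop-⊆ m xs)

length-seg : ∀ {A : Set} m i (xs : List A) → suc i * m ≤ length xs → length (seg m i xs) ≡ m
length-seg m zero    xs h = trans (length-take m xs) (m≤n⇒m⊓n≡m (≤-trans (≤-reflexive (sym (+-identityʳ m))) h))
length-seg m (suc i) xs h = length-seg m i (drop m xs) (begin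
  suc i * m              ≡⟨ m+n∸m≡n m (suc i * m) ⟨
  m + suc i * m ∸ m      ≤⟨ ∸-monoˡ-≤ m h ⟩
  length xs ∸ m          ≡⟨ length-drop m xs ⟨
  length (drop m xs)     ∎)
  where open ≤-Reasoning

seg-pairs : ∀ {A : Set} {R : A → A → Set} m {i j xs x y} → AllPairs R xs → i < j →
            x ∈ seg m i xs → y ∈ seg m j xs → R x y
seg-pairs {R = R} m {zero} {suc j} {xs} rs _ x∈ y∈ =
  AllPairs-++⁻ (take m xs) (subst (AllPairs R) (sym (take++drop≡id m xs)) rs) x∈ (Any-resp-⊆ (seg-⊆ m j _) y∈)
seg-pairs m {suc i} {suc j} {xs} rs (s≤s i<j) x∈ y∈ = seg-pairs m (AllPairs-⊆ (drop-⊆ m xs) rs) i<j x∈ y∈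

-- Exponential growth against constant factors

-- Bernoulli's inequality `1 + n/d ≤ (1 + 1/d)^n`, multiplied by `d^(n+1)`.
bernoulli : ∀ d n → d ^ n * (d + n) ≤ suc d ^ n * d
bernoulli d zero    = ≤-reflexive (cong (_+ 0) (+-identityʳ d))
bernoulli d (suc n) = begin
  d * d ^ n * (d + suc n)             ≡⟨ shuffle d (d ^ n) n ⟩
  d ^ n * (d * (d + n) + d)           ≤⟨ *-monoʳ-≤ (d ^ n) (+-monoʳ-≤ _ (m≤m+n d n)) ⟩
  d ^ n * (d * (d + n) + (d + n))     ≡⟨ shuffle′ d (d ^ n) (d + n) ⟩
  suc d * (d ^ n * (d + n))           ≤⟨ *-monoʳ-≤ (suc d) (bernoulli d n) ⟩
  suc d * (suc d ^ n * d)             ≡⟨ *-assoc (suc d) (suc d ^ n) d ⟨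
  suc d * suc d ^ n * d               ∎
  where
  open ≤-Reasoning
  shuffle : ∀ d p n → d * p * (d + suc n) ≡ p * (d * (d + n) + d)
  shuffle = solve-∀
  shuffle′ : ∀ d p e → p * (d * e + e) ≡ suc d * (p * e)
  shuffle′ = solve-∀

-- (1 + 1/d)^n exceeds any constant c once n is large.
exponent-beats : ∀ d c e → .{{_ : NonZero d}} → c * d ^ (d * c + e) ≤ suc d ^ (d * c + e)
exponent-beats d c e = begin
  c * d ^ (d * c + e)             ≡⟨ cong (c *_) (^-distribˡ-+-* d (d * c) e) ⟩
  c * (d ^ (d * c) * d ^ e)       ≡⟨ *-assoc c _ _ ⟨
  c * d ^ (d * c) * d ^ e         ≤⟨ *-mono-≤ base (^-monoˡ-≤ e (n≤1+n d)) ⟩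
  suc d ^ (d * c) * suc d ^ e     ≡⟨ ^-distribˡ-+-* (suc d) (d * c) e ⟨
  suc d ^ (d * c + e)             ∎
  where
  open ≤-Reasoning
  shuffle : ∀ c p d → c * p * d ≡ p * (d * c)
  shuffle = solve-∀
  base : c * d ^ (d * c) ≤ suc d ^ (d * c)
  base = *-cancelʳ-≤ _ _ d (begin
    c * d ^ (d * c) * d          ≡⟨ shuffle c (d ^ (d * c)) d ⟩
    d ^ (d * c) * (d * c)        ≤⟨ *-monoʳ-≤ (d ^ (d * c)) (m≤n+m (d * c) d) ⟩
    d ^ (d * c) * (d + d * c)    ≤⟨ bernoulli d (d * c) ⟩
    suc d ^ (d * c) * d          ∎)

^-distribʳ-* : ∀ m n k → (m * n) ^ k ≡ m ^ k * n ^ k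
^-distribʳ-* m n zero    = refl
^-distribʳ-* m n (suc k) = trans (cong (m * n *_) (^-distribʳ-* m n k)) (shuffle m n (m ^ k) (n ^ k))
  where
  shuffle : ∀ m n p q → m * n * (p * q) ≡ m * p * (n * q)
  shuffle = solve-∀

-- A set of linear size in a critical tournament has an almost maximum chain.
long-chain : ∀ d c k {t m x y} → .{{_ : NonZero d}} → c * d ^ k ≤ suc d ^ k →
             t ^ k < x → x ≤ c * y → y ≤ m ^ k → d * t ≤ suc d * m
long-chain d c k {t} {m} {x} {y} beats t^k<x x≤cy y≤m^k = ≮⇒≥ λ lt → <-irrefl refl (begin-strict
  d ^ k * t ^ k            <⟨ *-monoʳ-< (d ^ k) {{m^n≢0 d k}} t^k<x ⟩
  d ^ k * x                ≤⟨ *-monoʳ-≤ (d ^ k) (≤-trans x≤cy (*-monoʳ-≤ c y≤m^k)) ⟩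
  d ^ k * (c * m ^ k)      ≡⟨ shuffle (d ^ k) c (m ^ k) ⟩
  c * d ^ k * m ^ k        ≤⟨ *-monoˡ-≤ (m ^ k) beats ⟩
  suc d ^ k * m ^ k        ≡⟨ ^-distribʳ-* (suc d) m k ⟨
  (suc d * m) ^ k          ≤⟨ ^-monoˡ-≤ k (<⇒≤ lt) ⟩
  (d * t) ^ k              ≡⟨ ^-distribʳ-* d t k ⟩
  d ^ k * t ^ k            ∎)
  where
  open ≤-Reasoning
  shuffle : ∀ p c q → p * (c * q) ≡ c * p * q
  shuffle = solve-∀

-- Chains in a tournament

module Tournament {V : Set} (E : Rel V) (isT : IsTournament E) where

  open IsTournament isT

  _⟶_ : V → V → Set
  x ⟶ y = E x y ≡ true

  _⟶?_ : ∀ x y → Dec (x ⟶ y)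
  x ⟶? y = E x y Bool.≟ true

  ⟶⇒≢ : ∀ {x y} → x ⟶ y → x ≢ y
  ⟶⇒≢ {x} xy refl with () ← trans (sym xy) (irrefl x)

  ⟶-asym : ∀ {x y} → x ⟶ y → E y x ≡ false
  ⟶-asym {x} {y} xy = trans (tourn y x (⟶⇒≢ xy ∘ sym)) (cong not xy)

  false⇒⟶ : ∀ {x y} → x ≢ y → E x y ≡ false → y ⟶ x
  false⇒⟶ {x} {y} x≢y xy = trans (tourn y x (x≢y ∘ sym)) (cong not xy)

  ¬⟶⇒⟵ : ∀ {x y} → x ≢ y → ¬ (x ⟶ y) → y ⟶ x
  ¬⟶⇒⟵ x≢y ¬xy = false⇒⟶ x≢y (Bool.¬-not ¬xy)

  IsChain : List V → Set
  IsChain = AllPairs _⟶_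

  Chain : ℕ → List V → Set
  Chain m xs = Σ (List V) λ c → length c ≡ m × IsChain c × All (_∈ xs) c

  Chain-resp : ∀ {m xs ys} → (∀ {x} → x ∈ xs → x ∈ ys) → Chain m xs → Chain m ys
  Chain-resp h (c , len , ch , c∈) = c , len , ch , All.map h c∈

  chain? : ∀ m xs → Dec (Chain m xs)
  chain? zero    xs = yes ([] , refl , [] , [])
  chain? (suc m) xs with any? (λ x → chain? m (filter (x ⟶?_) xs)) xs
  ... | yes a with find a
  ...   | x , x∈ , c , len , ch , c∈ = yes (x ∷ c , cong suc len
            , All.map (λ y∈ → proj₂ (∈-filter⁻ (x ⟶?_) {xs = xs} y∈)) c∈ ∷ ch
            , x∈ ∷ All.map (λ y∈ → proj₁ (∈-filter⁻ (x ⟶?_) {xs = xs} y∈)) c∈)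
  chain? (suc m) xs | no ¬a = no λ { (x ∷ c , len , x⟶ ∷ ch , x∈ ∷ c∈) →
    ¬a (lose x∈ (c , suc-injective len , ch , All.zipWith (λ (y∈ , xy) → ∈-filter⁺ (x ⟶?_) y∈ xy) (c∈ , x⟶))) }

  -- Applied with `n = length xs`: the second alternative then says that the whole list is
  -- transitive, and the polynomial bound is immediate.
  max-chain : ∀ xs n → (Σ ℕ λ t → Chain t xs × ¬ Chain (suc t) xs) ⊎ Chain n xs
  max-chain xs zero    = inj₂ ([] , refl , [] , [])
  max-chain xs (suc n) with max-chain xs n
  ... | inj₁ found = inj₁ found
  ... | inj₂ ch with chain? (suc n) xs
  ...   | yes ch′ = inj₂ ch′
  ...   | no ¬ch  = inj₁ (n , ch , ¬ch)

  Chain-≤ : ∀ {m n xs} → m ≤ n → Chain n xs → Chain m xs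
  Chain-≤ {m} m≤n (c , refl , ch , c∈) =
    take m c , trans (length-take m c) (m≤n⇒m⊓n≡m m≤n) , AllPairs-⊆ (take-⊆ m c) ch , All-resp-⊆ (take-⊆ m c) c∈

  -- The larger of the two neighbourhoods of the first vertex keeps half of the list, and the vertex
  -- is put in front of or behind the chain found there. This weak bound serves to make `t` exceed
  -- the constants.
  log-chain : ∀ m xs → Unique xs → 2 ^ m ≤ length xs → Chain (suc m) xs
  log-chain zero    (x ∷ xs) u h = x ∷ [] , refl , [] ∷ [] , here refl ∷ []
  log-chain (suc m) []       u h = contradiction (≤-trans (^-monoʳ-≤ 2 {0} {suc m} z≤n) h) λ ()
  log-chain (suc m) (x ∷ xs) (x≢ ∷ u) h with 2 ^ m ≤? count (x ⟶?_) xs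
  ... | yes h₁ with log-chain m _ (AllPairsₚ.filter⁺ (x ⟶?_) u) h₁
  ...   | c , len , ch , c∈ = x ∷ c , cong suc len
            , All.map (λ y∈ → proj₂ (∈-filter⁻ (x ⟶?_) {xs = xs} y∈)) c∈ ∷ ch
            , here refl ∷ All.map (λ y∈ → there (proj₁ (∈-filter⁻ (x ⟶?_) {xs = xs} y∈))) c∈
  log-chain (suc m) (x ∷ xs) (x≢ ∷ u) h | no ¬h₁ with log-chain m _ (AllPairsₚ.filter⁺ (¬? ∘ (x ⟶?_)) u) h₂
    where
    open ≤-Reasoning
    h₂ : 2 ^ m ≤ count (¬? ∘ (x ⟶?_)) xs
    h₂ = +-cancelˡ-≤ (2 ^ m) _ _ (begin
      2 ^ m + 2 ^ m                                         ≡⟨ cong (2 ^ m +_) (+-identityʳ (2 ^ m)) ⟨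
      2 ^ suc m                                             ≤⟨ h ⟩
      suc (length xs)                                       ≡⟨ cong suc (count-split (x ⟶?_) xs) ⟩
      suc (count (x ⟶?_) xs) + count (¬? ∘ (x ⟶?_)) xs      ≤⟨ +-monoˡ-≤ _ (≰⇒> ¬h₁) ⟩
      2 ^ m + count (¬? ∘ (x ⟶?_)) xs                       ∎)
  ... | c , len , ch , c∈ = c ++ x ∷ []
            , trans (length-++ c) (trans (+-comm (length c) 1) (cong suc len))
            , AllPairsₚ.++⁺ ch ([] ∷ []) (All.map (λ y∈ → let y∈xs , ¬xy = ∈-filter⁻ (¬? ∘ (x ⟶?_)) {xs = xs} y∈
                 in ¬⟶⇒⟵ (All.lookup x≢ y∈xs) ¬xy ∷ []) c∈)
            , Allₚ.++⁺ (All.map (λ y∈ → there (proj₁ (∈-filter⁻ (¬? ∘ (x ⟶?_)) {xs = xs} y∈))) c∈) (here refl ∷ [])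

-- Greedy embedding and sparse families of linear sets

-- `k * g ^ k` comes from `k` segments, each of which may shrink up to `k` times by the factor `g`;
-- the first `2` comes from rounding a division, and `2 ^ k` from `pigeonhole`.
pairBound : ℕ → ℕ → ℕ
pairBound k g = 2 * (k * g ^ k) * 2 ^ k

-- The first split must survive the passage to subsets of relative size `1/c` on both sides, hence
-- the density parameter `g * (c * c)`; the relative sizes of the two stages multiply.
spreadBound : ℕ → ℕ → ℕ → ℕ
spreadBound k zero    g = 1
spreadBound k (suc d) g = pairBound k (g * (c * c)) * c
  where c = spreadBound k d g

pairBound≢0 : ∀ k g .{{_ : NonZero k}} .{{_ : NonZero g}} → NonZero (pairBound k g)
pairBound≢0 k g = m*n≢0 _ _ {{m*n≢0 2 _ {{_}} {{m*n≢0 k _ {{it}} {{m^n≢0 g k}}}}}} {{m^n≢0 2 k}}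

spreadBound≢0 : ∀ k d g .{{_ : NonZero k}} .{{_ : NonZero g}} → NonZero (spreadBound k d g)
spreadBound≢0 k zero    g = _
spreadBound≢0 k (suc d) g = m*n≢0 _ _ {{pairBound≢0 k _ {{it}} {{m*n≢0 g _ {{it}} {{m*n≢0 c c}}}}}}
  where
  c = spreadBound k d g
  instance
    c≢0 : NonZero c
    c≢0 = spreadBound≢0 k d g

module Spread {V : Set} (E : Rel V) (isT : IsTournament E) where

  open Tournament E isT

  _↛?_ : ∀ x y → Dec (E x y ≡ false)
  x ↛? y = E x y Bool.≟ false

  Sparse : ℕ → List V → List V → Set
  Sparse g xs ys = tot _↛?_ xs ys * g ≤ length xs * length ys

  Disjoint : List V → List V → Set
  Disjoint xs ys = ∀ {x y} → x ∈ xs → y ∈ ys → x ≢ y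

  -- The rare value `b` decides which set goes first. If edges from `xs` to `ys` are rare, `ys` goes
  -- in front, and disjointness turns its non-edges into those rare edges.
  one-sided-sparse : ∀ b g xs ys → Disjoint xs ys →
                     (∀ {x} → x ∈ xs → count (λ y → E x y Bool.≟ b) ys * g ≤ length ys) →
                     Sparse g xs ys ⊎ Sparse g ys xs
  one-sided-sparse false g xs ys dis h = inj₁ (tot-upper _↛?_ g xs ys h)
  one-sided-sparse true  g xs ys dis h = inj₂ (begin
    tot _↛?_ ys xs * g                ≡⟨ cong (_* g) (tot-flip _↛?_ ys xs) ⟩
    tot (flip _↛?_) xs ys * g         ≤⟨ tot-upper (flip _↛?_) g xs ys (λ {x} x∈ → ≤-trans
                                           (*-monoˡ-≤ g (count-mono (_↛? x) (x ⟶?_) (λ y∈ → false⇒⟶ (dis x∈ y∈ ∘ sym)))) (h x∈)) ⟩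
    length xs * length ys             ≡⟨ *-comm (length xs) (length ys) ⟩
    length ys * length xs             ∎)
    where open ≤-Reasoning

  record SparsePair (X : List V) (g b n : ℕ) : Set where
    field
      {xs ys} : List V
      xs⊆     : xs ⊆ X
      ys⊆     : ys ⊆ X
      xs-big  : n ≤ b * length xs
      ys-big  : n ≤ b * length ys
      sparse  : Sparse g xs ys
      disjoint : Disjoint xs ys

  module _ {H : Set} (_≟_ : DecidableEquality H) (EH : H → H → Bool) where

    CopyOf : List H → (H → V) → Set
    CopyOf hs f = AllPairs (λ h h′ → f h ≢ f h′ × E (f h) (f h′) ≡ EH h h′) hs

    -- Greedy embedding: a vertex typical for all later candidate sets extends the copy;
    -- if there is none, the pigeonhole principle gives a sparse pair.
    copy-or-sparse : ∀ g .{{_ : NonZero g}} (X : List V) (x₀ : V) s → 0 < s →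
      ∀ hs → Unique hs → (C : H → List V) →
      (∀ {h} → h ∈ hs → C h ⊆ X) →
      (∀ {h} → h ∈ hs → s * g ^ length hs ≤ length (C h)) →
      (∀ {h h′} → h ∈ hs → h′ ∈ hs → h ≢ h′ → Disjoint (C h) (C h′)) →
      (Σ (H → V) λ f → (∀ {h} → h ∈ hs → f h ∈ C h) × CopyOf hs f) ⊎ SparsePair X g (2 ^ length hs) s
    copy-or-sparse g X x₀ s s>0 [] u C C⊆ big dis = inj₁ ((λ _ → x₀) , (λ ()) , [])
    copy-or-sparse g X x₀ s s>0 (h ∷ hs) (h≢ ∷ u) C C⊆ big dis
      with any? (λ v → all? (λ h′ → length (C h′) ≤? g * count (λ y → E v y Bool.≟ EH h h′) (C h′)) hs) (C h)
    ... | yes good with v , v∈ , dense ← find good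
        with copy-or-sparse g X x₀ s s>0 hs u (λ h′ → filter (λ y → E v y Bool.≟ EH h h′) (C h′))
               (λ h∈ → ⊆-trans (filter-⊆ _ _) (C⊆ (there h∈)))
               (λ {h′} h∈ → *-cancelˡ-≤ g (≤-trans (≤-reflexive (shuffle g s (g ^ length hs)))
                                          (≤-trans (big (there h∈)) (All.lookup dense h∈))))
               (λ h∈ h′∈ h≢h′ x∈ y∈ → dis (there h∈) (there h′∈) h≢h′ (proj₁ (∈-filter⁻ _ x∈)) (proj₁ (∈-filter⁻ _ y∈)))
      where
      shuffle : ∀ g s p → g * (s * p) ≡ s * (g * p)
      shuffle = solve-∀
    ...   | inj₁ (f , f∈ , copy) = inj₁ (f′ , f′∈ , All.tabulate new ∷ AllPairs-∈ old copy)
      where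
      f′ : H → V
      f′ h′ with h′ ≟ h
      ... | yes _ = v
      ... | no _  = f h′
      f′-here : f′ h ≡ v
      f′-here with h ≟ h
      ... | yes _   = refl
      ... | no h≢h  = contradiction refl h≢h
      f′-there : ∀ {h′} → h′ ∈ hs → f′ h′ ≡ f h′
      f′-there {h′} h′∈ with h′ ≟ h
      ... | yes refl = contradiction refl (All.lookup h≢ h′∈)
      ... | no _     = refl
      f′∈ : ∀ {h′} → h′ ∈ h ∷ hs → f′ h′ ∈ C h′
      f′∈ (here refl) = subst (_∈ C h) (sym f′-here) v∈
      f′∈ {h′} (there h∈) = subst (_∈ C h′) (sym (f′-there h∈)) (proj₁ (∈-filter⁻ _ (f∈ h∈)))
      new : ∀ {h′} → h′ ∈ hs → f′ h ≢ f′ h′ × E (f′ h) (f′ h′) ≡ EH h h′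
      new h′∈ = dis (here refl) (there h′∈) (All.lookup h≢ h′∈) (f′∈ (here refl)) (f′∈ (there h′∈)) , trans (cong₂ E f′-here (f′-there h′∈)) (proj₂ (∈-filter⁻ (λ y → E v y Bool.≟ EH h _) {xs = C _} (f∈ h′∈)))
      old : ∀ {h₁ h₂} → h₁ ∈ hs → h₂ ∈ hs → f h₁ ≢ f h₂ × E (f h₁) (f h₂) ≡ EH h₁ h₂ →
            f′ h₁ ≢ f′ h₂ × E (f′ h₁) (f′ h₂) ≡ EH h₁ h₂
      old h₁∈ h₂∈ (ne , eq) = subst₂ _≢_ (sym (f′-there h₁∈)) (sym (f′-there h₂∈)) ne , trans (cong₂ E (f′-there h₁∈) (f′-there h₂∈)) eq
      AllPairs-∈ : ∀ {A : Set} {R S : A → A → Set} {xs} → (∀ {x y} → x ∈ xs → y ∈ xs → R x y → S x y) →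
                   AllPairs R xs → AllPairs S xs
      AllPairs-∈ f []       = []
      AllPairs-∈ f (r ∷ rs) = All.tabulate (λ y∈ → f (here refl) (there y∈) (All.lookup r y∈))
                            ∷ AllPairs-∈ (λ x∈ y∈ → f (there x∈) (there y∈)) rs
    ...   | inj₂ p = inj₂ record { SparsePair p ; xs-big = weaken (SparsePair.xs-big p) ; ys-big = weaken (SparsePair.ys-big p) }
      where
      weaken : ∀ {n} → s ≤ 2 ^ length hs * n → s ≤ 2 ^ suc (length hs) * n
      weaken {n} le = ≤-trans le (*-monoˡ-≤ n (m≤m+n (2 ^ length hs) _))
    copy-or-sparse g X x₀ s s>0 (h ∷ hs) (h≢ ∷ u) C C⊆ big dis | no ¬good = inj₂ result
      where
      big₀ : ∀ {h′} → h′ ∈ h ∷ hs → s ≤ length (C h′)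
      big₀ h∈ = ≤-trans (m≤m*n s (g ^ suc (length hs)) {{m^n≢0 g (suc (length hs))}}) (big h∈)
      few? : ∀ h′ v → Dec (g * count (λ y → E v y Bool.≟ EH h h′) (C h′) < length (C h′))
      few? h′ v = _ <? _
      few : ∀ {v} → v ∈ C h → Any (λ h′ → g * count (λ y → E v y Bool.≟ EH h h′) (C h′) < length (C h′)) hs
      few {v} v∈ with all? (λ h′ → length (C h′) ≤? g * count (λ y → E v y Bool.≟ EH h h′) (C h′)) hs
      ... | yes a = contradiction (lose v∈ a) ¬good
      ... | no ¬a = Any.map ≰⇒> (Allₚ.¬All⇒Any¬ (λ h′ → _ ≤? _) hs ¬a)
      result : SparsePair X g (2 ^ suc (length hs)) s
      result with j , j∈ , le ← pigeonhole few? hs (C h) (<-≤-trans s>0 (big₀ (here refl))) few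
             with dis′ ← (λ {x} {y} x∈ → dis (here refl) (there j∈) (All.lookup h≢ j∈) {x} {y} (proj₁ (∈-filter⁻ (few? j) {xs = C h} x∈)))
             with one-sided-sparse (EH h j) g (filter (few? j) (C h)) (C j) dis′
                    (λ {x} x∈ → ≤-trans (≤-reflexive (*-comm _ g)) (<⇒≤ (proj₂ (∈-filter⁻ (few? j) {xs = C h} x∈))))
      ... | inj₁ sp = record { xs⊆ = ⊆-trans (filter-⊆ _ _) (C⊆ (here refl)) ; ys⊆ = C⊆ (there j∈)
                             ; xs-big = xb ; ys-big = yb ; sparse = sp ; disjoint = dis′ }
        where
        xb = ≤-trans (big₀ (here refl)) (≤-trans le (*-monoˡ-≤ _ (m≤m+n (2 ^ length hs) _)))
        yb = ≤-trans (big₀ (there j∈)) (m≤n*m _ (2 ^ suc (length hs)) {{m^n≢0 2 (suc (length hs))}})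
      ... | inj₂ sp = record { ys⊆ = ⊆-trans (filter-⊆ _ _) (C⊆ (here refl)) ; xs⊆ = C⊆ (there j∈)
                             ; ys-big = xb ; xs-big = yb ; sparse = sp ; disjoint = λ x∈ y∈ → dis′ y∈ x∈ ∘ sym }
        where
        xb = ≤-trans (big₀ (here refl)) (≤-trans le (*-monoˡ-≤ _ (m≤m+n (2 ^ length hs) _)))
        yb = ≤-trans (big₀ (there j∈)) (m≤n*m _ (2 ^ suc (length hs)) {{m^n≢0 2 (suc (length hs))}})

    module _ (hs : List H) (hs-unique : Unique hs) .{{_ : NonZero (length hs)}}
             (index : H → ℕ) (index< : ∀ {h} → h ∈ hs → index h < length hs)
             (index-injective : ∀ {h h′} → index h ≡ index h′ → h ≡ h′)
             (no-copy : ∀ f → ¬ CopyOf hs f) where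

      private k = length hs

      -- Disjoint segments of `X` serve as candidate sets for the vertices in `hs`; as there is no
      -- copy, the greedy embedding must get stuck, and it does so at a sparse pair.
      sparse-pair : ∀ g .{{_ : NonZero g}} X → Unique X → pairBound k g ≤ length X →
                    SparsePair X g (pairBound k g) (length X)
      sparse-pair g X u big = result
        where
        instance
          gᵏ≢0 : NonZero (g ^ k)
          gᵏ≢0 = m^n≢0 g k
          kgᵏ≢0 : NonZero (k * g ^ k)
          kgᵏ≢0 = m*n≢0 k (g ^ k)
          bound≢0 : NonZero (pairBound k g)
          bound≢0 = pairBound≢0 k g
          2ᵏ≢0 : NonZero (2 ^ k)
          2ᵏ≢0 = m^n≢0 2 k
        s m : ℕ
        s = length X / (k * g ^ k)
        m = s * g ^ k
        s>0 : 0 < s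
        s>0 = m≥n⇒m/n>0 (≤-trans (≤-trans (m≤n*m (k * g ^ k) 2) (m≤m*n (2 * (k * g ^ k)) (2 ^ k))) big)
        fits : ∀ {i} → i < k → suc i * m ≤ length X
        fits {i} i<k = begin
          suc i * m              ≤⟨ *-monoˡ-≤ m i<k ⟩
          k * (s * g ^ k)        ≡⟨ shuffle k s (g ^ k) ⟩
          s * (k * g ^ k)        ≤⟨ m/n*n≤m (length X) (k * g ^ k) ⟩
          length X               ∎
          where
          open ≤-Reasoning
          shuffle : ∀ k s p → k * (s * p) ≡ s * (k * p)
          shuffle = solve-∀
        C : H → List V
        C h = seg m (index h) X
        dis : ∀ {h h′} → h ∈ hs → h′ ∈ hs → h ≢ h′ → Disjoint (C h) (C h′)
        dis {h} {h′} _ _ h≢h′ x∈ y∈ with <-cmp (index h) (index h′)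
        ... | tri< lt _ _ = seg-pairs m u lt x∈ y∈
        ... | tri≈ _ eq _ = contradiction (index-injective eq) h≢h′
        ... | tri> _ _ gt = seg-pairs m u gt y∈ x∈ ∘ sym
        -- Since `s > 0`, the remainder of the division is absorbed by doubling `s`.
        scale : ∀ {n} → s ≤ 2 ^ k * n → length X ≤ pairBound k g * n
        scale {n} le = begin
          length X                          ≡⟨ m≡m%n+[m/n]*n (length X) (k * g ^ k) ⟩
          length X % (k * g ^ k) + s * (k * g ^ k)   ≤⟨ +-monoˡ-≤ _ (<⇒≤ (m%n<n (length X) (k * g ^ k))) ⟩
          suc s * (k * g ^ k)               ≤⟨ *-monoˡ-≤ (k * g ^ k) (+-monoˡ-≤ s s>0) ⟩
          (s + s) * (k * g ^ k)             ≡⟨ shuffle s (k * g ^ k) ⟩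
          2 * (k * g ^ k) * s               ≤⟨ *-monoʳ-≤ (2 * (k * g ^ k)) le ⟩
          2 * (k * g ^ k) * (2 ^ k * n)     ≡⟨ *-assoc (2 * (k * g ^ k)) (2 ^ k) n ⟨
          pairBound k g * n                 ∎
          where
          open ≤-Reasoning
          shuffle : ∀ s p → (s + s) * p ≡ 2 * p * s
          shuffle = solve-∀
        result : SparsePair X g (pairBound k g) (length X)
        result with copy-or-sparse g X (proj₁ (nonempty {xs = X} (<-≤-trans (>-nonZero⁻¹ (pairBound k g)) big))) s s>0 hs hs-unique C
                      (λ {h} _ → seg-⊆ m (index h) X)
                      (λ {h} h∈ → ≤-reflexive (sym (length-seg m (index h) X (fits (index< h∈))))) dis
        ... | inj₁ (f , _ , copy) = contradiction copy (no-copy f)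
        ... | inj₂ p = record { SparsePair p ; xs-big = scale (SparsePair.xs-big p) ; ys-big = scale (SparsePair.ys-big p) }

      -- Both sides of a sparse pair are split again. Every set obtained from the first side stays
      -- sparse towards every set obtained from the second, so concatenating the two lists keeps the
      -- order.
      spread : ∀ d g .{{_ : NonZero g}} X → Unique X → spreadBound k d g ≤ length X →
               Σ (List (List V)) λ Zs → length Zs ≡ 2 ^ d ×
                 All (λ Z → Z ⊆ X × length X ≤ spreadBound k d g * length Z) Zs × AllPairs (λ Z Z′ → Sparse g Z Z′ × Disjoint Z Z′) Zs
      spread zero    g X u big = X ∷ [] , refl , (⊆-refl , m≤n*m (length X) 1) ∷ [] , [] ∷ []
      spread (suc d) g X u big = result
        where
        c = spreadBound k d g
        instance
          c≢0 : NonZero c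
          c≢0 = spreadBound≢0 k d g
          cc≢0 : NonZero (c * c)
          cc≢0 = m*n≢0 c c
          gcc≢0 : NonZero (g * (c * c))
          gcc≢0 = m*n≢0 g (c * c)
        b = pairBound k (g * (c * c))
        instance
          b≢0 : NonZero b
          b≢0 = pairBound≢0 k (g * (c * c))
        deep : ∀ {Y} → Y ⊆ X → length X ≤ b * length Y → Σ (List (List V)) λ Zs → length Zs ≡ 2 ^ d ×
                 All (λ Z → Z ⊆ Y × length Y ≤ c * length Z) Zs × AllPairs (λ Z Z′ → Sparse g Z Z′ × Disjoint Z Z′) Zs
        deep {Y} Y⊆ le = spread d g Y (AllPairs-⊆ Y⊆ u) (*-cancelˡ-≤ b (≤-trans big le))
        widen : ∀ {Y Z} → Y ⊆ X → length X ≤ b * length Y → Z ⊆ Y × length Y ≤ c * length Z →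
                Z ⊆ X × length X ≤ b * c * length Z
        widen {Y} {Z} Y⊆ le (Z⊆ , le′) = ⊆-trans Z⊆ Y⊆ ,
          ≤-trans le (≤-trans (*-monoʳ-≤ b le′) (≤-reflexive (sym (*-assoc b c (length Z)))))
        result : Σ (List (List V)) λ Zs → length Zs ≡ 2 ^ suc d ×
                 All (λ Z → Z ⊆ X × length X ≤ b * c * length Z) Zs × AllPairs (λ Z Z′ → Sparse g Z Z′ × Disjoint Z Z′) Zs
        result with record { xs = A ; ys = B ; xs⊆ = A⊆ ; ys⊆ = B⊆ ; xs-big = A-big ; ys-big = B-big ; sparse = sp ; disjoint = dis } ←
                      sparse-pair (g * (c * c)) X u (≤-trans (m≤m*n b c) big)
               with As , lenA , A∈ , spA ← deep A⊆ A-big | Bs , lenB , B∈ , spB ← deep B⊆ B-big =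
          As ++ Bs
          , trans (length-++ As) (trans (cong₂ _+_ lenA lenB) (cong (2 ^ d +_) (sym (+-identityʳ (2 ^ d)))))
          , Allₚ.++⁺ (All.map (widen A⊆ A-big) A∈) (All.map (widen B⊆ B-big) B∈)
          , AllPairsₚ.++⁺ spA spB (All.map (λ a → All.map (cross a) B∈) A∈)
          where
          cross : ∀ {Z Z′} → Z ⊆ A × length A ≤ c * length Z → Z′ ⊆ B × length B ≤ c * length Z′ → Sparse g Z Z′ × Disjoint Z Z′
          cross (a⊆ , a) (b⊆ , b) = sparse-⊆ _↛?_ g c a⊆ b⊆ a b sp , λ x∈ y∈ → dis (Any-resp-⊆ a⊆ x∈) (Any-resp-⊆ b⊆ y∈)

-- Blocks and cells in a critical tournament

-- `2 * cells * (2 * Λ)` lets Markov and the union bound over all cells keep half of every segment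
-- typical with density `1/(2Λ)`, which is at most `1/Λ` after that halving; `(2M)^2` pays for the
-- passage from blocks to segments.
cellBound : (cells Λ M : ℕ) → ℕ
cellBound cells Λ M = 2 * cells * (2 * Λ) * (2 * M * (2 * M))

module Arcs {V : Set} (E : Rel V) where

  -- The edge between x and y, true when it agrees with the order of their ranks i and j.
  arc : ℕ → ℕ → V → V → Bool
  arc i j x y = if does (i <? j) then E x y else E y x

  arc-< : ∀ {i j x y} → i < j → arc i j x y ≡ E x y
  arc-< {i} {j} lt rewrite dec-true (i <? j) lt = refl

  arc-> : ∀ {i j x y} → j < i → arc i j x y ≡ E y x
  arc-> {i} {j} gt rewrite dec-false (i <? j) (<-asym gt) = refl

  arc-sym : ∀ {i j x y} → i ≢ j → arc i j x y ≡ arc j i y x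
  arc-sym {i} {j} i≢j with <-cmp i j
  ... | tri< lt _ _ = trans (arc-< lt) (sym (arc-> lt))
  ... | tri≈ _ eq _ = contradiction eq i≢j
  ... | tri> _ _ gt = trans (arc-> gt) (sym (arc-< gt))

  arc-mono : ∀ {i j i′ j′ x y} → i ≢ j → (i < j → i′ < j′) → (j < i → j′ < i′) → arc i j x y ≡ arc i′ j′ x y
  arc-mono {i} {j} i≢j f g with <-cmp i j
  ... | tri< lt _ _ = trans (arc-< lt) (sym (arc-< (f lt)))
  ... | tri≈ _ eq _ = contradiction eq i≢j
  ... | tri> _ _ gt = trans (arc-> gt) (sym (arc-> (g gt)))

  nonarc? : ∀ i j x y → Dec (arc i j x y ≡ false)
  nonarc? i j x y = arc i j x y Bool.≟ false

-- Criticality enters through `max` and `linear-chain` only: `t` bounds all chains, and every set of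
-- at least `n/c` vertices has a chain within the factor `d / (d + 1)` of `t`.
module Host {V : Set} (E : Rel V) (isT : IsTournament E)
            (X : List V) (n t c d : ℕ) (t>0 : 0 < t) .{{_ : NonZero d}}
            (max : ∀ {m} → Tournament.Chain E isT m X → m ≤ t)
            (linear-chain : ∀ {Y} → Y ⊆ X → n ≤ c * length Y →
                            Σ ℕ λ m → Tournament.Chain E isT m Y × d * t ≤ suc d * m) where

  open Tournament E isT
  open Arcs E

  -- `arc` orients a pair by its indices, so one condition covers `i < j` and `j < i` alike. This
  -- allows Markov from either side of a pair and makes smoothness two-sided.
  SparseFamily : (N g : ℕ) → (ℕ → List V) → Set
  SparseFamily N g Z = ∀ {i j} → i < N → j < N → i ≢ j →
    tot (nonarc? i j) (Z i) (Z j) * g ≤ length (Z i) * length (Z j)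

  record ChainBlock (Y : List V) : Set where
    field
      chain : IsChain Y
      ∈X    : All (_∈ X) Y
      large : t ≤ 2 * length Y

  record LinearBlock (b : ℕ) (Y : List V) : Set where
    field
      ⊆X    : Y ⊆ X
      large : n ≤ b * length Y

  -- Blocks are replaced by chains one after the other; each chain is taken among the vertices
  -- that are typical for all other blocks.
  module _ (N M b : ℕ) .{{_ : NonZero N}} .{{_ : NonZero M}} (2b≤c : b * 2 ≤ c) (2M≤t : 2 * M ≤ t) (isChain : ℕ → Bool)
           (Z₀ : ℕ → List V) (Z₀-linear : ∀ {i} → i < N → LinearBlock b (Z₀ i)) (Z₀-big : ∀ {i} → i < N → M ≤ length (Z₀ i)) where

    -- The state after the blocks below `k` have been treated. `inside` preserves disjointness, and
    -- `lines` covers the blocks still ahead as well as those that stay linear.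
    record Blocks (k g : ℕ) : Set where
      field
        Z      : ℕ → List V
        chains : ∀ {i} → i < k → isChain i ≡ true → ChainBlock (Z i)
        lines  : ∀ {i} → i < N → k ≤ i ⊎ isChain i ≡ false → LinearBlock b (Z i)
        big    : ∀ {i} → i < N → M ≤ length (Z i)
        inside : ∀ {i x} → i < N → x ∈ Z i → x ∈ Z₀ i
        sparse : SparseFamily N g Z

    private instance
      2N≢0 : NonZero (2 * N)
      2N≢0 = m*n≢0 2 N

    module Step (k g : ℕ) (k<N : k < N) (prev : Blocks k (2 * N * g)) where

      open Blocks prev

      sparse′ : SparseFamily N g Z
      sparse′ {i} {j} i< j< i≢j = ≤-trans (*-monoʳ-≤ (tot (nonarc? i j) (Z i) (Z j)) (m≤n*m g (2 * N))) (sparse i< j< i≢j)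
      js : List ℕ
      js = filter (λ j → ¬? (j ≟ k)) (upTo N)
      ∈js : ∀ {j} → j < N → j ≢ k → j ∈ js
      ∈js j< j≢k = ∈-filter⁺ (λ j → ¬? (j ≟ k)) (∈-upTo⁺ j<) j≢k
      js∈ : ∀ {j} → j ∈ js → j < N × j ≢ k
      js∈ j∈ with j∈′ , j≢k ← ∈-filter⁻ (λ j → ¬? (j ≟ k)) {xs = upTo N} j∈ = ∈-upTo⁻ j∈′ , j≢k
      good : List V
      good = typical (λ j → nonarc? k j) Z g js (Z k)
      -- The factor `2 * N` in the density of `prev` is spent here, as `length js ≤ N`.
      half : length (Z k) ≤ 2 * length good
      half = typical-half (λ j → nonarc? k j) Z g js (Z k)
        (λ j∈ → <-≤-trans (>-nonZero⁻¹ M) (big (proj₁ (js∈ j∈))))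
        (λ {j} j∈ → ≤-trans (*-monoʳ-≤ (tot (nonarc? k j) (Z k) (Z j)) (*-monoˡ-≤ g (*-monoʳ-≤ 2
                       (≤-trans (length-filter (λ j → ¬? (j ≟ k)) (upTo N)) (≤-reflexive (length-upTo N))))))
                     (sparse k<N (proj₁ (js∈ j∈)) (proj₂ (js∈ j∈) ∘ sym)))
      next-blocks : Blocks (suc k) g
      next-blocks with isChain k in kind
      ... | false = record
        { Z = Z ; big = big ; inside = inside ; sparse = sparse′
        ; chains = λ { {i} (s≤s i≤k) ch → [ (λ lt → chains lt ch) , (λ { refl → contradiction (trans (sym ch) kind) λ () }) ]′ (m≤n⇒m<n∨m≡n i≤k) }
        ; lines = λ i< → λ { (inj₁ k<i) → lines i< (inj₁ (<⇒≤ k<i)) ; (inj₂ e) → lines i< (inj₂ e) } }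
      ... | true with linear-chain {good} (⊆-trans (filter-⊆ _ (Z k)) (LinearBlock.⊆X (lines k<N (inj₁ ≤-refl))))
                        (≤-trans (LinearBlock.large (lines k<N (inj₁ ≤-refl)))
                        (≤-trans (*-monoʳ-≤ b half)
                        (≤-trans (≤-reflexive (sym (*-assoc b 2 (length good)))) (*-monoˡ-≤ (length good) 2b≤c))))
      ...   | m , (S , refl , S-chain , S∈) , dt≤ = record
        { Z = Z′ ; chains = chains′ ; lines = lines′ ; big = big′ ; inside = inside′ ; sparse = sparse″ }
        where
        S-large : t ≤ 2 * length S
        S-large = *-cancelˡ-≤ d (≤-trans dt≤ (≤-trans (*-monoˡ-≤ (length S) (+-monoˡ-≤ d (>-nonZero⁻¹ d)))
                                             (≤-reflexive (shuffle d (length S)))))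
          where
          shuffle : ∀ d s → (d + d) * s ≡ d * (2 * s)
          shuffle = solve-∀
        Z′ : ℕ → List V
        Z′ i with i ≟ k
        ... | yes _ = S
        ... | no _  = Z i
        chains′ : ∀ {i} → i < suc k → isChain i ≡ true → ChainBlock (Z′ i)
        chains′ {i} (s≤s i≤k) ch with i ≟ k
        ... | yes _  = record { chain = S-chain ; large = S-large
                              ; ∈X = All.map (λ s∈ → Any-resp-⊆ (LinearBlock.⊆X (lines k<N (inj₁ ≤-refl))) (Any-resp-⊆ (filter-⊆ _ (Z k)) s∈)) S∈ }
        ... | no i≢k = chains (≤∧≢⇒< i≤k i≢k) ch
        lines′ : ∀ {i} → i < N → suc k ≤ i ⊎ isChain i ≡ false → LinearBlock b (Z′ i)
        lines′ {i} i< h with i ≟ k | h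
        ... | yes refl | inj₁ k<k = contradiction k<k (<-irrefl refl)
        ... | yes refl | inj₂ e   = contradiction (trans (sym e) kind) λ ()
        ... | no _     | inj₁ k<i = lines i< (inj₁ (<⇒≤ k<i))
        ... | no _     | inj₂ e   = lines i< (inj₂ e)
        big′ : ∀ {i} → i < N → M ≤ length (Z′ i)
        big′ {i} i< with i ≟ k
        ... | yes _ = *-cancelˡ-≤ 2 (≤-trans 2M≤t S-large)
        ... | no _  = big i<
        inside′ : ∀ {i x} → i < N → x ∈ Z′ i → x ∈ Z₀ i
        inside′ {i} i< x∈ with i ≟ k
        ... | yes refl = inside i< (Any-resp-⊆ (filter-⊆ _ (Z k)) (All.lookup S∈ x∈))
        ... | no _     = inside i< x∈
        -- The chain may be a negligible part of the block, so its density cannot be inherited from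
        -- the block; it holds because every single vertex of the chain is typical.
        from-S : ∀ {j} → j < N → j ≢ k → tot (nonarc? k j) S (Z j) * g ≤ length S * length (Z j)
        from-S {j} j< j≢k = tot-upper (nonarc? k j) g S (Z j)
          (λ s∈ → typical-sparse (λ j → nonarc? k j) Z g {js} {Z k} (All.lookup S∈ s∈) (∈js j< j≢k))
        sparse″ : SparseFamily N g Z′
        sparse″ {i} {j} i< j< i≢j with i ≟ k | j ≟ k
        ... | yes refl | yes refl = contradiction refl i≢j
        ... | yes refl | no j≢k   = from-S j< j≢k
        ... | no i≢k   | no j≢k   = sparse′ i< j< i≢j
        ... | no i≢k   | yes refl = begin
          tot (nonarc? i k) (Z i) S * g           ≡⟨ cong (_* g) (tot-flip (nonarc? i k) (Z i) S) ⟩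
          tot (flip (nonarc? i k)) S (Z i) * g    ≤⟨ *-monoˡ-≤ g (tot-mono (flip (nonarc? i k)) (nonarc? k i) (trans (arc-sym (i≢k ∘ sym))) S (Z i)) ⟩
          tot (nonarc? k i) S (Z i) * g           ≤⟨ from-S i< i≢k ⟩
          length S * length (Z i)                 ≡⟨ *-comm (length S) (length (Z i)) ⟩
          length (Z i) * length S                 ∎
          where open ≤-Reasoning

    -- The exponent of `2 * N` counts the steps, each of which spends one factor.
    blocks : ∀ k g → k ≤ N → SparseFamily N (g * (2 * N) ^ k) Z₀ → Blocks k g
    blocks zero g k≤N sp = record
      { Z = Z₀ ; chains = λ () ; lines = λ i< _ → Z₀-linear i< ; big = Z₀-big ; inside = λ _ x∈ → x∈
      ; sparse = λ {i} {j} i< j< i≢j → subst (λ g → tot (nonarc? i j) (Z₀ i) (Z₀ j) * g ≤ length (Z₀ i) * length (Z₀ j)) (*-identityʳ g) (sp i< j< i≢j) }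
    blocks (suc k) g k<N sp = Step.next-blocks k g k<N (blocks k (2 * N * g) (<⇒≤ k<N)
      λ {i} {j} i< j< i≢j → subst (λ g → tot (nonarc? i j) (Z₀ i) (Z₀ j) * g ≤ length (Z₀ i) * length (Z₀ j)) (shuffle g (2 * N) ((2 * N) ^ k)) (sp i< j< i≢j))
      where
      shuffle : ∀ g a p → g * (a * p) ≡ a * g * p
      shuffle = solve-∀

  -- Every block is split into M segments, and cell i consists of the typical vertices of segment
  -- rank i of block blk i.
  module _ {I : Set} (_≟ᴵ_ : DecidableEquality I) (allI : List I) (∈allI : ∀ i → i ∈ allI)
           (rank blk : I → ℕ) (rank-injective : ∀ {i j} → rank i ≡ rank j → i ≡ j)
           (isChain : ℕ → Bool) (N M b Λ : ℕ) .{{_ : NonZero M}} (2≤Λ : 2 ≤ Λ)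
           (rank<M : ∀ i → rank i < M) (blk<N : ∀ i → blk i < N)
           (blk-mono : ∀ {i j} → rank i < rank j → blk i ≤ blk j)
           (blk-equal : ∀ {i j} → rank i < rank j → blk i ≡ blk j → isChain (blk i) ≡ true)
           (c≥ : b * (4 * M * Λ) ≤ c) (d≥ : 16 * M ≤ d) where

    -- `no-cut` sets the fraction `1/Λ` of a linear cell against half of any cell, chain cells
    -- included. Smoothness has the same threshold `1/Λ`, so that both can enter one union bound.
    record Cells (lin : I → Set) : Set where
      field
        W        : I → List V
        W-pos    : ∀ i → 0 < length (W i)
        smooth   : ∀ {i j v} → i ≢ j → v ∈ W i → count (nonarc? (rank i) (rank j) v) (W j) * Λ ≤ length (W j)
        run      : ∀ {i j x y} → rank i < rank j → blk i ≡ blk j → x ∈ W i → y ∈ W j → x ⟶ y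
        disjoint : ∀ {i j x y} → i ≢ j → x ∈ W i → y ∈ W j → x ≢ y
        no-cut   : ∀ {i p U Y} → lin i → i ≢ p → U ⊆ W i → Y ⊆ W p →
                   length (W i) ≤ Λ * length U → length (W p) ≤ 2 * length Y →
                   ¬ (∀ {u y} → u ∈ U → y ∈ Y → arc (rank i) (rank p) u y ≡ true)

    module _ (Z : ℕ → List V)
             (chains : ∀ {i} → i < N → isChain i ≡ true → ChainBlock (Z i))
             (lines  : ∀ {i} → i < N → isChain i ≡ false → LinearBlock b (Z i))
             (big    : ∀ {i} → i < N → M ≤ length (Z i))
             (apart  : ∀ {i j x y} → i < N → j < N → i ≢ j → x ∈ Z i → y ∈ Z j → x ≢ y)
             (sparse : SparseFamily N (cellBound (length allI) Λ M) Z) where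

      private
        g : ℕ
        g = 2 * length allI * (2 * Λ)

        m : I → ℕ
        m i = length (Z (blk i)) / M

        -- The rank serves as segment index: ranks are distinct and below `M`, and in a chain block
        -- they list the cells in the order of the chain.
        W₀ : I → List V
        W₀ i = seg (m i) (rank i) (Z (blk i))

        W₀⊆ : ∀ i → W₀ i ⊆ Z (blk i)
        W₀⊆ i = seg-⊆ (m i) (rank i) (Z (blk i))

        m>0 : ∀ i → 0 < m i
        m>0 i = m≥n⇒m/n>0 (big (blk<N i))

        len-W₀ : ∀ i → length (W₀ i) ≡ m i
        len-W₀ i = length-seg (m i) (rank i) (Z (blk i)) (≤-trans (*-monoˡ-≤ (m i) (rank<M i))
          (≤-trans (≤-reflexive (*-comm M (m i))) (m/n*n≤m (length (Z (blk i))) M)))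

        W₀-pos : ∀ i → 0 < length (W₀ i)
        W₀-pos i = subst (0 <_) (sym (len-W₀ i)) (m>0 i)

        Z≤W₀ : ∀ i → length (Z (blk i)) ≤ 2 * M * length (W₀ i)
        Z≤W₀ i = begin
          l                          ≡⟨ m≡m%n+[m/n]*n l M ⟩
          l % M + m i * M            ≤⟨ +-monoˡ-≤ (m i * M) (≤-trans (<⇒≤ (m%n<n l M)) (m≤n*m M (m i) {{>-nonZero (m>0 i)}})) ⟩
          m i * M + m i * M          ≡⟨ shuffle (m i) M ⟩
          2 * M * m i                ≡⟨ cong (2 * M *_) (len-W₀ i) ⟨
          2 * M * length (W₀ i)      ∎
          where
          open ≤-Reasoning
          l = length (Z (blk i))
          shuffle : ∀ k M → k * M + k * M ≡ 2 * M * k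
          shuffle = solve-∀

        run₀ : ∀ {i j x y} → rank i < rank j → blk i ≡ blk j → x ∈ W₀ i → y ∈ W₀ j → x ⟶ y
        run₀ {i} {j} lt eq x∈ y∈ = seg-pairs (m i) (ChainBlock.chain (chains (blk<N i) (blk-equal lt eq))) lt x∈
          (subst (λ b → _ ∈ seg (length (Z b) / M) (rank j) (Z b)) (sym eq) y∈)

        disjoint₀ : ∀ {i j x y} → i ≢ j → x ∈ W₀ i → y ∈ W₀ j → x ≢ y
        disjoint₀ {i} {j} i≢j x∈ y∈ with blk i ≟ blk j | <-cmp (rank i) (rank j)
        ... | no b≢  | _ = apart (blk<N i) (blk<N j) b≢ (Any-resp-⊆ (W₀⊆ i) x∈) (Any-resp-⊆ (W₀⊆ j) y∈)
        ... | yes b≡ | tri< lt _ _ = ⟶⇒≢ (run₀ lt b≡ x∈ y∈)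
        ... | yes b≡ | tri≈ _ eq _ = contradiction (rank-injective eq) i≢j
        ... | yes b≡ | tri> _ _ gt = ⟶⇒≢ (run₀ gt (sym b≡) y∈ x∈) ∘ sym

        cells? : ∀ i j x y → Dec (arc (rank i) (rank j) x y ≡ false)
        cells? i j = nonarc? (rank i) (rank j)

        -- Cells of different blocks inherit the sparsity of their blocks. Cells of one block are
        -- segments of a chain and have no backward edge at all.
        sparse₀ : ∀ {i j} → i ≢ j → tot (cells? i j) (W₀ i) (W₀ j) * g ≤ length (W₀ i) * length (W₀ j)
        sparse₀ {i} {j} i≢j with blk i ≟ blk j
        ... | no b≢ = sparse-⊆ (cells? i j) g (2 * M) {{m*n≢0 2 M}} (W₀⊆ i) (W₀⊆ j) (Z≤W₀ i) (Z≤W₀ j)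
          (≤-trans (*-monoˡ-≤ (cellBound (length allI) Λ M) (tot-mono (cells? i j) (nonarc? (blk i) (blk j)) (trans (sym same)) (Z (blk i)) (Z (blk j))))
                   (sparse (blk<N i) (blk<N j) b≢))
          where
          same : ∀ {x y} → arc (rank i) (rank j) x y ≡ arc (blk i) (blk j) x y
          same = arc-mono (i≢j ∘ rank-injective) (λ lt → ≤∧≢⇒< (blk-mono lt) b≢) (λ gt → ≤∧≢⇒< (blk-mono gt) (b≢ ∘ sym))
        ... | yes b≡ = tot-upper (cells? i j) g (W₀ i) (W₀ j) λ {x} x∈ →
          subst (λ k → k * g ≤ length (W₀ j)) (sym (count-none {xs = W₀ j} (cells? i j x) (none x∈))) z≤n
          where
          none : ∀ {x y} → x ∈ W₀ i → y ∈ W₀ j → ¬ arc (rank i) (rank j) x y ≡ false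
          none x∈ y∈ f with <-cmp (rank i) (rank j)
          ... | tri< lt _ _ with () ← trans (sym f) (trans (arc-< lt) (run₀ lt b≡ x∈ y∈))
          ... | tri≈ _ eq _ = i≢j (rank-injective eq)
          ... | tri> _ _ gt with () ← trans (sym f) (trans (arc-> gt) (run₀ gt (sym b≡) y∈ x∈))

        js : I → List I
        js i = filter (λ j → ¬? (j ≟ᴵ i)) allI

        js∈ : ∀ {i j} → j ∈ js i → i ≢ j
        js∈ {i} j∈ = proj₂ (∈-filter⁻ (λ j → ¬? (j ≟ᴵ i)) {xs = allI} j∈) ∘ sym

        W : I → List V
        W i = typical (cells? i) W₀ (2 * Λ) (js i) (W₀ i)

        W⊆W₀ : ∀ i → W i ⊆ W₀ i
        W⊆W₀ i = filter-⊆ _ (W₀ i)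

        W⊆ : ∀ i → W i ⊆ Z (blk i)
        W⊆ i = ⊆-trans (W⊆W₀ i) (W₀⊆ i)

        W₀≤W : ∀ i → length (W₀ i) ≤ 2 * length (W i)
        W₀≤W i = typical-half (cells? i) W₀ (2 * Λ) (js i) (W₀ i) (λ {j} _ → W₀-pos j)
          λ {j} j∈ → ≤-trans (*-monoʳ-≤ (tot (cells? i j) (W₀ i) (W₀ j))
                               (*-monoˡ-≤ (2 * Λ) (*-monoʳ-≤ 2 (length-filter (λ j → ¬? (j ≟ᴵ i)) allI))))
                             (sparse₀ (js∈ j∈))

        Z≤W : ∀ i → length (Z (blk i)) ≤ 4 * M * length (W i)
        Z≤W i = ≤-trans (Z≤W₀ i) (≤-trans (*-monoʳ-≤ (2 * M) (W₀≤W i)) (≤-reflexive (shuffle M (length (W i)))))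
          where
          shuffle : ∀ M w → 2 * M * (2 * w) ≡ 4 * M * w
          shuffle = solve-∀

        smooth : ∀ {i j v} → i ≢ j → v ∈ W i → count (cells? i j v) (W j) * Λ ≤ length (W j)
        smooth {i} {j} {v} i≢j v∈ = *-cancelˡ-≤ 2 (begin
          2 * (count (cells? i j v) (W j) * Λ)      ≡⟨ shuffle (count (cells? i j v) (W j)) Λ ⟩
          count (cells? i j v) (W j) * (2 * Λ)      ≤⟨ *-monoˡ-≤ (2 * Λ) (count-⊆ (cells? i j v) (W⊆W₀ j)) ⟩
          count (cells? i j v) (W₀ j) * (2 * Λ)     ≤⟨ typical-sparse (cells? i) W₀ (2 * Λ) {js i} {W₀ i} v∈
                                                        (∈-filter⁺ (λ j → ¬? (j ≟ᴵ i)) (∈allI j) (i≢j ∘ sym)) ⟩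
          length (W₀ j)                             ≤⟨ W₀≤W j ⟩
          2 * length (W j)                          ∎)
          where
          open ≤-Reasoning
          shuffle : ∀ a l → 2 * (a * l) ≡ a * (2 * l)
          shuffle = solve-∀

        linear : ∀ {i Y} → isChain (blk i) ≡ false → Y ⊆ W i → length (W i) ≤ Λ * length Y →
                 Σ ℕ λ k → Chain k Y × d * t ≤ suc d * k
        linear {i} {Y} kind Y⊆ le = linear-chain (⊆-trans Y⊆ (⊆-trans (W⊆ i) (LinearBlock.⊆X line))) (begin
          n                                  ≤⟨ LinearBlock.large line ⟩
          b * length (Z (blk i))             ≤⟨ *-monoʳ-≤ b (≤-trans (Z≤W i) (*-monoʳ-≤ (4 * M) le)) ⟩
          b * (4 * M * (Λ * length Y))       ≡⟨ shuffle b (4 * M) Λ (length Y) ⟩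
          b * (4 * M * Λ) * length Y         ≤⟨ *-monoˡ-≤ (length Y) c≥ ⟩
          c * length Y                       ∎)
          where
          open ≤-Reasoning
          line = lines (blk<N i) kind
          shuffle : ∀ b m l y → b * (m * (l * y)) ≡ b * (m * l) * y
          shuffle = solve-∀

        2≤d : 2 ≤ d
        2≤d = ≤-trans (≤-trans (s≤s (s≤s z≤n)) (m≤m*n 16 M)) d≥

        -- In a linear block this is the long chain of a linear set. In a chain block `Y` is a chain
        -- itself, and `t ≤ 2 * (4M * (2 * length Y))`; this is the origin of `16 * M ≤ d`.
        rich : ∀ {p Y} → Y ⊆ W p → length (W p) ≤ 2 * length Y → Σ ℕ λ k → Chain k Y × t < suc d * k
        rich {p} {Y} Y⊆ le = by-kind (isChain (blk p)) refl
          where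
          open ≤-Reasoning
          shuffle : ∀ M y → 2 * (4 * M * (2 * y)) ≡ 16 * M * y
          shuffle = solve-∀
          Y>0 : 0 < length Y
          Y>0 = *-cancelˡ-< 2 0 _ (<-≤-trans (*-cancelˡ-< 2 0 _ (<-≤-trans (W₀-pos p) (W₀≤W p))) le)
          by-kind : ∀ k → isChain (blk p) ≡ k → Σ ℕ λ k → Chain k Y × t < suc d * k
          by-kind false kind = let k , ch , dt≤ = linear {p} {Y} kind Y⊆ (≤-trans le (*-monoˡ-≤ (length Y) 2≤Λ)) in
            k , ch , <-≤-trans (<-≤-trans (m<m*n t 2 {{>-nonZero t>0}} (s≤s (s≤s z≤n))) (≤-trans (≤-reflexive (*-comm t 2)) (*-monoˡ-≤ t 2≤d))) dt≤
          by-kind true kind = length Y , (Y , refl , AllPairs-⊆ (⊆-trans Y⊆ (W⊆ p)) (ChainBlock.chain block) , All.tabulate id) , (begin-strict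
            t                                     ≤⟨ ChainBlock.large block ⟩
            2 * length (Z (blk p))                ≤⟨ *-monoʳ-≤ 2 (≤-trans (Z≤W p) (*-monoʳ-≤ (4 * M) le)) ⟩
            2 * (4 * M * (2 * length Y))          ≡⟨ shuffle M (length Y) ⟩
            16 * M * length Y                     ≤⟨ *-monoˡ-≤ (length Y) d≥ ⟩
            d * length Y                          <⟨ m<n+m (d * length Y) Y>0 ⟩
            suc d * length Y                      ∎)
            where block = chains (blk<N p) kind

        -- Placed one after the other, the two chains have more than
        -- `d t / (d + 1) + t / (d + 1) = t` vertices.
        too-long : ∀ {S S′ xs ys} → IsChain S → IsChain S′ → All (_∈ xs) S → All (_∈ ys) S′ → All (_∈ X) S → All (_∈ X) S′ →
                   d * t ≤ suc d * length S × t < suc d * length S′ ⊎ d * t ≤ suc d * length S′ × t < suc d * length S →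
                   ¬ (∀ {x y} → x ∈ xs → y ∈ ys → x ⟶ y)
        too-long {S} {S′} ch ch′ S∈ S′∈ S∈X S′∈X sizes complete = <-irrefl refl (begin-strict
          suc d * t                                       <⟨ sum> sizes ⟩
          suc d * length S + suc d * length S′            ≡⟨ *-distribˡ-+ (suc d) (length S) (length S′) ⟨
          suc d * (length S + length S′)                  ≡⟨ cong (suc d *_) (length-++ S) ⟨
          suc d * length (S ++ S′)                        ≤⟨ *-monoʳ-≤ (suc d) (max (S ++ S′ , refl ,
                                                              AllPairsₚ.++⁺ ch ch′ (All.map (λ x∈ → All.map (complete x∈) S′∈) S∈) , Allₚ.++⁺ S∈X S′∈X)) ⟩
          suc d * t                                       ∎)
          where
          open ≤-Reasoning
          sum> : d * t ≤ suc d * length S × t < suc d * length S′ ⊎ d * t ≤ suc d * length S′ × t < suc d * length S →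
                 suc d * t < suc d * length S + suc d * length S′
          sum> (inj₁ (a , b)) = subst (_< suc d * length S + suc d * length S′) (+-comm (d * t) t) (+-mono-≤-< a b)
          sum> (inj₂ (a , b)) = +-mono-<-≤ b a

        ∈X : ∀ i → All (_∈ X) (W i)
        ∈X i with isChain (blk i) in kind
        ... | true  = All-resp-⊆ (W⊆ i) (ChainBlock.∈X (chains (blk<N i) kind))
        ... | false = All.tabulate (Any-resp-⊆ (⊆-trans (W⊆ i) (LinearBlock.⊆X (lines (blk<N i) kind))))

        in-X : ∀ {j Y S} → Y ⊆ W j → All (_∈ Y) S → All (_∈ X) S
        in-X {j} Y⊆ = All.map λ y∈ → All.lookup (∈X j) (Any-resp-⊆ Y⊆ y∈)

        no-cut : ∀ {i p U Y} → isChain (blk i) ≡ false → i ≢ p → U ⊆ W i → Y ⊆ W p →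
                 length (W i) ≤ Λ * length U → length (W p) ≤ 2 * length Y →
                 ¬ (∀ {u y} → u ∈ U → y ∈ Y → arc (rank i) (rank p) u y ≡ true)
        no-cut {i} {p} {U} {Y} kind i≢p U⊆ Y⊆ U-big Y-big complete =
          contradiction-from (linear {i} {U} kind U⊆ U-big) (rich {p} {Y} Y⊆ Y-big) (<-cmp (rank i) (rank p))
          where
          contradiction-from : (Σ ℕ λ k → Chain k U × d * t ≤ suc d * k) → (Σ ℕ λ k → Chain k Y × t < suc d * k) →
                               Tri (rank i < rank p) (rank i ≡ rank p) (rank p < rank i) → ⊥
          contradiction-from (_ , (S , refl , S-ch , S∈) , S≥) (_ , (S′ , refl , S′-ch , S′∈) , S′≥) (tri< lt _ _) =
            too-long S-ch S′-ch S∈ S′∈ (in-X {i} U⊆ S∈) (in-X {p} Y⊆ S′∈) (inj₁ (S≥ , S′≥))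
              λ u∈ y∈ → trans (sym (arc-< lt)) (complete u∈ y∈)
          contradiction-from _ _ (tri≈ _ eq _) = i≢p (rank-injective eq)
          contradiction-from (_ , (S , refl , S-ch , S∈) , S≥) (_ , (S′ , refl , S′-ch , S′∈) , S′≥) (tri> _ _ gt) =
            too-long S′-ch S-ch S′∈ S∈ (in-X {p} Y⊆ S′∈) (in-X {i} U⊆ S∈) (inj₂ (S≥ , S′≥))
              λ y∈ u∈ → trans (sym (arc-> gt)) (complete u∈ y∈)

      cells : Cells (λ i → isChain (blk i) ≡ false)
      cells = record
        { W = W
        ; W-pos = λ i → *-cancelˡ-< 2 0 _ (<-≤-trans (W₀-pos i) (W₀≤W i))
        ; smooth = smooth
        ; run = λ {i} {j} lt eq x∈ y∈ → run₀ lt eq (Any-resp-⊆ (W⊆W₀ i) x∈) (Any-resp-⊆ (W⊆W₀ j) y∈)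
        ; disjoint = λ {i} {j} i≢j x∈ y∈ → disjoint₀ {i} {j} i≢j (Any-resp-⊆ (W⊆W₀ i) x∈) (Any-resp-⊆ (W⊆W₀ j) y∈)
        ; no-cut = no-cut }

-- Embedding stars and the backward path into smooth cells

-- Choosing vertices in cells one star at a time.  A selection is a list of pairs (cell, vertex).
module Selection {V : Set} (E : Rel V) {I : Set} (rank : I → ℕ) (rank-injective : ∀ {i j} → rank i ≡ rank j → i ≡ j)
                 (W : I → List V) (W-pos : ∀ i → 0 < length (W i)) (Λ : ℕ) .{{_ : NonZero Λ}} (Lin : I → Set) where

  open Arcs E

  arcᴵ : I → I → V → V → Bool
  arcᴵ i j = arc (rank i) (rank j)

  nonarcᴵ? : ∀ i j x y → Dec (arcᴵ i j x y ≡ false)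
  nonarcᴵ? i j = nonarc? (rank i) (rank j)

  Fresh : I → I × V → Set
  Fresh i (p , v) = p ≢ i × v ∈ W p

  -- A cell `p` in which the vertex chosen in cell `i` shall have a backward neighbour, to be found
  -- within `Y`.
  Target : I → I × List V → Set
  Target i (p , Y) = Lin i × i ≢ p × Y ⊆ W p × length (W p) ≤ 2 * length Y

  module _ (smooth : ∀ {i j v} → i ≢ j → v ∈ W i → count (nonarcᴵ? i j v) (W j) * Λ ≤ length (W j))
           (no-cut : ∀ {i p U Y} → Lin i → i ≢ p → U ⊆ W i → Y ⊆ W p →
                     length (W i) ≤ Λ * length U → length (W p) ≤ 2 * length Y →
                     ¬ (∀ {u y} → u ∈ U → y ∈ Y → arcᴵ i p u y ≡ true)) where

    Rejects : I → (I × V) ⊎ (I × List V) → V → Set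
    Rejects i (inj₁ (p , w)) v = arcᴵ p i w v ≡ false
    Rejects i (inj₂ (p , Y)) v = All (λ y → arcᴵ i p v y ≡ true) Y

    rejects? : ∀ i j → Decidable (Rejects i j)
    rejects? i (inj₁ (p , w)) v = nonarcᴵ? p i w v
    rejects? i (inj₂ (p , Y)) v = all? (λ y → arcᴵ i p v y Bool.≟ true) Y

    conditions : List (I × V) → List (I × List V) → List ((I × V) ⊎ (I × List V))
    conditions σ τ = map inj₁ σ ++ map inj₂ τ

    rejected? : ∀ i σ τ → Decidable (λ v → Any (λ j → Rejects i j v) (conditions σ τ))
    rejected? i σ τ v = any? (λ j → rejects? i j v) (conditions σ τ)

    accepted : I → List (I × V) → List (I × List V) → List V
    accepted i σ τ = filter (¬? ∘ rejected? i σ τ) (W i)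

    accepted-arc : ∀ {i σ τ v} → v ∈ accepted i σ τ → ∀ {p w} → (p , w) ∈ σ → arcᴵ p i w v ≡ true
    accepted-arc {i} {σ} {τ} {v} v∈ {p} {w} pw∈ = Bool.¬-not λ f →
      proj₂ (∈-filter⁻ (¬? ∘ rejected? i σ τ) {xs = W i} v∈) (lose (∈-++⁺ˡ (∈-map⁺ inj₁ pw∈)) f)

    accepted-nonarc : ∀ {i σ τ v} → v ∈ accepted i σ τ → ∀ {p Y} → (p , Y) ∈ τ → Any (λ y → arcᴵ i p v y ≡ false) Y
    accepted-nonarc {i} {σ} {τ} {v} v∈ {p} {Y} pY∈ =
      Any.map Bool.¬-not (Allₚ.¬All⇒Any¬ (λ y → arcᴵ i p v y Bool.≟ true) Y λ a →
        proj₂ (∈-filter⁻ (¬? ∘ rejected? i σ τ) {xs = W i} v∈) (lose (∈-++⁺ʳ (map inj₁ σ) (∈-map⁺ inj₂ pY∈)) a))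

    -- A vertex chosen before rejects few by smoothness. The vertices rejected by a target are
    -- complete, in forward direction, to its set `Y`, so `no-cut` bounds them by the fraction
    -- `1/Λ`.
    rejects-few : ∀ {i σ τ} → All (Fresh i) σ → All (Target i) τ → ∀ {j} → j ∈ conditions σ τ →
                  count (rejects? i j) (W i) * Λ ≤ length (W i)
    rejects-few {i} {σ} {τ} fresh targets {j} j∈ with ∈-++⁻ (map inj₁ σ) j∈
    ... | inj₁ j∈ with (p , w) , pw∈ , refl ← ∈-map⁻ inj₁ j∈ with p≢i , w∈ ← All.lookup fresh pw∈ = smooth p≢i w∈
    ... | inj₂ j∈ with (p , Y) , pY∈ , refl ← ∈-map⁻ inj₂ j∈ with lin , i≢p , Y⊆ , Y-big ← All.lookup targets pY∈ =
      ≮⇒≥ λ lt → no-cut lin i≢p (filter-⊆ _ (W i)) Y⊆ (≤-trans (<⇒≤ lt) (≤-reflexive (*-comm _ Λ))) Y-big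
        λ u∈ y∈ → All.lookup (proj₂ (∈-filter⁻ (rejects? i (inj₂ (p , Y))) {xs = W i} u∈)) y∈

    accepted-half : ∀ {i σ τ} → All (Fresh i) σ → All (Target i) τ → 2 * (length σ + length τ) ≤ Λ →
                    length (W i) ≤ 2 * length (accepted i σ τ)
    accepted-half {i} {σ} {τ} fresh targets small = count-complement (rejected? i σ τ) (W i) (*-cancelʳ-≤ _ _ Λ (begin
      r * 2 * Λ                                            ≡⟨ shuffle r Λ ⟩
      2 * (r * Λ)                                          ≤⟨ *-monoʳ-≤ 2 (count-union (rejects? i) Λ (W i) (conditions σ τ) (rejects-few fresh targets)) ⟩
      2 * (length (conditions σ τ) * length (W i))         ≡⟨ cong (λ k → 2 * (k * length (W i))) (trans (length-++ (map inj₁ σ)) (cong₂ _+_ (length-map inj₁ σ) (length-map inj₂ τ))) ⟩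
      2 * ((length σ + length τ) * length (W i))           ≡⟨ *-assoc 2 (length σ + length τ) (length (W i)) ⟨
      2 * (length σ + length τ) * length (W i)             ≤⟨ *-monoˡ-≤ (length (W i)) small ⟩
      Λ * length (W i)                                     ≡⟨ *-comm Λ (length (W i)) ⟩
      length (W i) * Λ                                     ∎))
      where
      open ≤-Reasoning
      r = count (rejected? i σ τ) (W i)
      shuffle : ∀ r l → r * 2 * l ≡ 2 * (r * l)
      shuffle = solve-∀

    pick : ∀ {i σ τ} → All (Fresh i) σ → All (Target i) τ → 2 * (length σ + length τ) ≤ Λ →
           Σ V λ v → v ∈ accepted i σ τ
    pick {i} fresh targets small = nonempty (*-cancelˡ-< 2 0 _ (<-≤-trans (W-pos i) (accepted-half fresh targets small)))

    accepted-∈ : ∀ {i σ τ v} → v ∈ accepted i σ τ → v ∈ W i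
    accepted-∈ {i} {σ} {τ} v∈ = proj₁ (∈-filter⁻ (¬? ∘ rejected? i σ τ) {xs = W i} v∈)

    free : List (I × V) → I → I × List V
    free σ p = p , accepted p σ []

    free-target : ∀ {i p σ} → Lin i → i ≢ p → All (Fresh p) σ → 2 * length σ ≤ Λ → Target i (free σ p)
    free-target {i} {p} {σ} lin i≢p fresh small = lin , i≢p , filter-⊆ _ (W p) ,
      accepted-half fresh [] (subst (λ k → 2 * k ≤ Λ) (sym (+-identityʳ (length σ))) small)

    -- leaf c x: x is a leaf of the star with center c.
    module Stars (allI : List I) (∈allI : ∀ i → i ∈ allI) (leaf : I → I → Bool)
                 (leaf-lin : ∀ {c x} → leaf c x ≡ true → Lin c × c ≢ x)
                 (leaf-center : ∀ {c c′ x} → leaf c x ≡ true → leaf c′ x ≡ true → c ≡ c′)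
                 (leaf-leaf : ∀ {c x y} → leaf c x ≡ true → ¬ leaf x y ≡ true)
                 (leaf-run : ∀ {c x y u w} → leaf c x ≡ true → leaf c y ≡ true → rank x < rank y →
                             u ∈ W x → w ∈ W y → E u w ≡ true)
                 (Λ≥ : 2 * (length allI * suc (length allI) + (length allI + 4)) ≤ Λ) where

      private ∣I∣ = length allI

      Compatible : I × V → I × V → Set
      Compatible (p , v) (q , w) = p ≢ q → arcᴵ p q v w ≡ not (leaf p q ∨ leaf q p)

      Compatible-sym : ∀ {a b} → Compatible a b → Compatible b a
      Compatible-sym {p , v} {q , w} h q≢p = trans (arc-sym (q≢p ∘ rank-injective)) (trans (h (q≢p ∘ sym)) (cong not (Bool.∨-comm (leaf p q) (leaf q p))))

      Valid : List (I × V) → Set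
      Valid σ = ∀ {a b} → a ∈ σ → b ∈ σ → Compatible a b

      Valid-++ : ∀ {σ σ′} → Valid σ → Valid σ′ → (∀ {a b} → a ∈ σ → b ∈ σ′ → Compatible a b) → Valid (σ ++ σ′)
      Valid-++ {σ} v v′ x a∈ b∈ with ∈-++⁻ σ a∈ | ∈-++⁻ σ b∈
      ... | inj₁ a∈ | inj₁ b∈ = v a∈ b∈
      ... | inj₁ a∈ | inj₂ b∈ = x a∈ b∈
      ... | inj₂ a∈ | inj₁ b∈ = Compatible-sym (x b∈ a∈)
      ... | inj₂ a∈ | inj₂ b∈ = v′ a∈ b∈

      forward : ∀ {p q v w} → arcᴵ p q v w ≡ true → leaf p q ≡ false → leaf q p ≡ false → Compatible (p , v) (q , w)
      forward e f f′ _ = trans e (cong not (sym (cong₂ _∨_ f f′)))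

      backward : ∀ {p q v w} → arcᴵ p q v w ≡ false → leaf p q ≡ true → Compatible (p , v) (q , w)
      backward {q = q} e f _ = trans e (cong not (sym (cong (_∨ leaf q _) f)))

      Covers : List (I × V) → I → Set
      Covers σ p = Σ V λ v → (p , v) ∈ σ

      -- `short` and `domain` keep the induction going: the former keeps the number of conditions
      -- small against `Λ`, the latter shows that the cells of the next star are still empty.
      record Selected (cs : List I) : Set where
        field
          σ       : List (I × V)
          short   : length σ ≤ length cs * suc ∣I∣
          inside  : ∀ {p v} → (p , v) ∈ σ → v ∈ W p
          valid   : Valid σ
          centers : ∀ {c} → c ∈ cs → Covers σ c
          leaves  : ∀ {c x} → c ∈ cs → leaf c x ≡ true → Covers σ x
          domain  : ∀ {p v} → (p , v) ∈ σ → p ∈ cs ⊎ Σ I λ c → c ∈ cs × leaf c p ≡ true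

      NotLeaf : I → Set
      NotLeaf c = ∀ {c′} → ¬ leaf c′ c ≡ true

      -- The center goes first. In every leaf cell it must have a backward neighbour among the
      -- vertices that are forward to all of `σ`, so afterwards the leaves can be taken
      -- independently of each other; the edges among them are forward by `leaf-run`.
      module AddStar {c cs} (c∉ : c ∉ cs) (c-top : NotLeaf c) (tops : All NotLeaf cs) (cs< : length cs < ∣I∣) (prev : Selected cs) where

        open Selected prev

        c-fresh : ∀ {v} → (c , v) ∈ σ → ⊥
        c-fresh cv∈ with domain cv∈
        ... | inj₁ c∈          = c∉ c∈
        ... | inj₂ (_ , _ , l) = c-top l

        leaf-fresh : ∀ {x v} → leaf c x ≡ true → (x , v) ∈ σ → ⊥
        leaf-fresh l xv∈ with domain xv∈
        ... | inj₁ x∈            = All.lookup tops x∈ l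
        ... | inj₂ (c′ , c′∈ , l′) with refl ← leaf-center l l′ = c∉ c′∈

        ls : List I
        ls = filter (λ x → leaf c x Bool.≟ true) allI

        ls-leaf : ∀ {x} → x ∈ ls → leaf c x ≡ true
        ls-leaf x∈ = proj₂ (∈-filter⁻ (λ x → leaf c x Bool.≟ true) {xs = allI} x∈)

        short′ : length σ ≤ ∣I∣ * suc ∣I∣
        short′ = ≤-trans short (*-monoˡ-≤ (suc ∣I∣) (<⇒≤ cs<))

        small : 2 * length σ ≤ Λ
        small = ≤-trans (*-monoʳ-≤ 2 (≤-trans short′ (m≤m+n _ _))) Λ≥

        fresh : ∀ {p} → (∀ {v} → ¬ (p , v) ∈ σ) → All (Fresh p) σ
        fresh p∉ = All.tabulate λ qw∈ → (λ { refl → p∉ qw∈ }) , inside qw∈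

        center-vertex : Σ V λ v → v ∈ accepted c σ (map (free σ) ls)
        center-vertex = pick (fresh c-fresh)
          (Allₚ.map⁺ (All.tabulate λ x∈ → let lin , c≢x = leaf-lin (ls-leaf x∈) in
            free-target lin c≢x (fresh (leaf-fresh (ls-leaf x∈))) small))
          (≤-trans (*-monoʳ-≤ 2 (+-mono-≤ short′ (≤-trans (≤-reflexive (length-map (free σ) ls))
            (≤-trans (length-filter _ allI) (m≤m+n ∣I∣ 4))))) Λ≥)

        module WithCenter (v : V) (v∈ : v ∈ accepted c σ (map (free σ) ls)) where

          record Leaves (xs : List I) : Set where
            field
              ρ       : List (I × V)
              len     : length ρ ≡ length xs
              source  : ∀ {p w} → (p , w) ∈ ρ → p ∈ xs × w ∈ accepted p σ [] × arcᴵ c p v w ≡ false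
              covered : ∀ {p} → p ∈ xs → Covers ρ p

          choose : ∀ xs → (∀ {x} → x ∈ xs → Any (λ y → arcᴵ c x v y ≡ false) (accepted x σ [])) → Leaves xs
          choose [] h = record { ρ = [] ; len = refl ; source = λ () ; covered = λ () }
          choose (x ∷ xs) h with find (h (here refl)) | choose xs (h ∘ there)
          ... | y , y∈ , e | record { ρ = ρ ; len = len ; source = source ; covered = covered } = record
            { ρ = (x , y) ∷ ρ ; len = cong suc len
            ; source = λ { (here refl) → here refl , y∈ , e ; (there i) → let p∈ , r = source i in there p∈ , r }
            ; covered = λ { (here refl) → y , here refl ; (there i) → let w , j = covered i in w , there j } }

          chosen : Leaves ls
          chosen = choose ls λ x∈ → accepted-nonarc {c} {σ} {map (free σ) ls} v∈ (∈-map⁺ (free σ) x∈)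

          module WithLeaves (chosen : Leaves ls) where

            open Leaves chosen

            ρ-leaf : ∀ {p w} → (p , w) ∈ ρ → leaf c p ≡ true
            ρ-leaf pw∈ = ls-leaf (proj₁ (source pw∈))

            ρ-∈ : ∀ {p w} → (p , w) ∈ ρ → w ∈ W p
            ρ-∈ {p} pw∈ = accepted-∈ {p} {σ} {[]} (proj₁ (proj₂ (source pw∈)))

            center : I × V
            center = c , v

            ρ-valid : Valid ρ
            ρ-valid {p , w} {q , w′} a∈ b∈ p≢q = forward (arc-true (<-cmp (rank p) (rank q)))
                (Bool.¬-not (leaf-leaf (ρ-leaf a∈))) (Bool.¬-not (leaf-leaf (ρ-leaf b∈))) p≢q
              where
              arc-true : Tri (rank p < rank q) (rank p ≡ rank q) (rank q < rank p) → arcᴵ p q w w′ ≡ true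
              arc-true (tri< lt _ _) = trans (arc-< lt) (leaf-run (ρ-leaf a∈) (ρ-leaf b∈) lt (ρ-∈ a∈) (ρ-∈ b∈))
              arc-true (tri≈ _ eq _) = contradiction (rank-injective eq) p≢q
              arc-true (tri> _ _ gt) = trans (arc-> gt) (leaf-run (ρ-leaf b∈) (ρ-leaf a∈) gt (ρ-∈ b∈) (ρ-∈ a∈))

            star : List (I × V)
            star = center ∷ ρ

            star-valid : Valid star
            star-valid = Valid-++ {center ∷ []} {ρ} (λ { (here refl) (here refl) p≢p → contradiction refl p≢p }) ρ-valid
              λ { (here refl) b∈ → backward (proj₂ (proj₂ (source b∈))) (ρ-leaf b∈) }

            star-σ : ∀ {a b} → a ∈ star → b ∈ σ → Compatible a b
            star-σ {b = q , w} (here refl) b∈ = Compatible-sym {q , w} {c , v} (forward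
              (accepted-arc {c} {σ} {map (free σ) ls} v∈ b∈)
              (Bool.¬-not c-top) (Bool.¬-not λ l → leaf-fresh l b∈))
            star-σ {p , w′} {q , w} (there a∈) b∈ = Compatible-sym {q , w} {p , w′} (forward
              (accepted-arc {p} {σ} {[]} (proj₁ (proj₂ (source a∈))) b∈)
              (Bool.¬-not λ l → case-eq (leaf-center (ρ-leaf a∈) l)) (Bool.¬-not (leaf-leaf (ρ-leaf a∈))))
              where
              case-eq : c ≡ q → ⊥
              case-eq refl = c-fresh b∈

            domain′ : ∀ {p w} → (p , w) ∈ star ++ σ → p ∈ c ∷ cs ⊎ Σ I λ c′ → c′ ∈ c ∷ cs × leaf c′ p ≡ true
            domain′ a∈ with ∈-++⁻ star a∈
            ... | inj₁ (here refl) = inj₁ (here refl)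
            ... | inj₁ (there a∈)  = inj₂ (c , here refl , ρ-leaf a∈)
            ... | inj₂ a∈ with domain a∈
            ...   | inj₁ p∈            = inj₁ (there p∈)
            ...   | inj₂ (c′ , c′∈ , l) = inj₂ (c′ , there c′∈ , l)

            inside′ : ∀ {p w} → (p , w) ∈ star ++ σ → w ∈ W p
            inside′ a∈ with ∈-++⁻ star a∈
            ... | inj₁ (here refl) = accepted-∈ {c} {σ} {map (free σ) ls} v∈
            ... | inj₁ (there a∈)  = ρ-∈ a∈
            ... | inj₂ a∈          = inside a∈

            extended : Selected (c ∷ cs)
            extended = record
              { σ       = star ++ σ
              ; short   = ≤-trans (≤-reflexive (length-++ star)) (+-mono-≤ (s≤s (≤-trans (≤-reflexive len) (length-filter _ allI))) short)
              ; inside  = inside′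
              ; valid   = Valid-++ {star} star-valid valid star-σ
              ; centers = λ { (here refl) → v , here refl ; (there c∈) → let w , i = centers c∈ in w , ∈-++⁺ʳ star i }
              ; leaves  = λ { (here refl) l → let w , i = covered (∈-filter⁺ (λ x → leaf c x Bool.≟ true) (∈allI _) l) in w , there (∈-++⁺ˡ i)
                            ; (there c∈) l → let w , i = leaves c∈ l in w , ∈-++⁺ʳ star i }
              ; domain  = domain′
              }

        extension : Selected (c ∷ cs)
        extension = let v , v∈ = center-vertex in
          WithCenter.WithLeaves.extended v v∈ (WithCenter.chosen v v∈)

      select : ∀ cs → Unique cs → All NotLeaf cs → length cs ≤ ∣I∣ → Selected cs
      select [] u tops len = record
        { σ = [] ; short = z≤n ; inside = λ () ; valid = λ () ; centers = λ () ; leaves = λ () ; domain = λ () }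
      select (c ∷ cs) (c∉ ∷ u) (c-top ∷ tops) len =
        AddStar.extension (λ c∈ → All.lookup c∉ c∈ refl) (λ {c′} → c-top {c′}) tops len (select cs u tops (<⇒≤ len))

    -- Nothing is recorded about the pairs `x₁`, `z` and `x₃`, `y`, which stay open, nor about `x₁`,
    -- `x₂`, `x₃` among themselves, whose order comes from the chain that holds their cells.
    record Gadget (σ : List (I × V)) (s₁ s₂ s₃ p q : I) : Set where
      field
        {x₁ x₂ x₃ y z} : V
        x₁∈ : x₁ ∈ W s₁
        x₂∈ : x₂ ∈ W s₂
        x₃∈ : x₃ ∈ W s₃
        y∈  : y ∈ W p
        z∈  : z ∈ W q
        x₁-free : ∀ {i u} → (i , u) ∈ σ → arcᴵ i s₁ u x₁ ≡ true
        x₂-free : ∀ {i u} → (i , u) ∈ σ → arcᴵ i s₂ u x₂ ≡ true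
        x₃-free : ∀ {i u} → (i , u) ∈ σ → arcᴵ i s₃ u x₃ ≡ true
        y-free  : ∀ {i u} → (i , u) ∈ σ → arcᴵ i p u y ≡ true
        z-free  : ∀ {i u} → (i , u) ∈ σ → arcᴵ i q u z ≡ true
        y-x₁    : arcᴵ p s₁ y x₁ ≡ false
        z-x₃    : arcᴵ q s₃ z x₃ ≡ false
        z-y     : arcᴵ q p z y ≡ false
        y-x₂    : arcᴵ p s₂ y x₂ ≡ true
        z-x₂    : arcᴵ q s₂ z x₂ ≡ true

    -- The backward path x₁ – y – z – x₃.
    gadget : ∀ {σ s₁ s₂ s₃ p q} → Lin p → Lin q → p ≢ s₁ → q ≢ s₃ → q ≢ p → p ≢ s₂ → q ≢ s₂ →
             All (Fresh s₁) σ → All (Fresh s₂) σ → All (Fresh s₃) σ → All (Fresh p) σ → All (Fresh q) σ →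
             2 * (length σ + 2) ≤ Λ → Gadget σ s₁ s₂ s₃ p q
    gadget {σ} {s₁} {s₂} {s₃} {p} {q} lin-p lin-q p≢s₁ q≢s₃ q≢p p≢s₂ q≢s₂ f₁ f₂ f₃ fp fq small =
      let τ-y = free σ s₁ ∷ []
          -- All candidates for `y` already have a backward neighbour in the free part of `s₁`, so
          -- picking `z` against them secures the far end of the path before `y` is known.
          τ-z = (p , accepted p σ τ-y) ∷ free σ s₃ ∷ []
          z , z∈ = pick {q} {σ} {τ-z} fq
            ((lin-q , q≢p , filter-⊆ _ (W p) , accepted-half fp (free-target lin-p p≢s₁ f₁ small₀ ∷ []) small₁)
             ∷ free-target lin-q q≢s₃ f₃ small₀ ∷ []) small
          y , y∈ , zy = find (accepted-nonarc {q} {σ} {τ-z} z∈ (here refl))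
          x₃ , x₃∈ , zx₃ = find (accepted-nonarc {q} {σ} {τ-z} z∈ (there (here refl)))
          x₁ , x₁∈ , yx₁ = find (accepted-nonarc {p} {σ} {τ-y} y∈ (here refl))
          σ⁺ = (p , y) ∷ (q , z) ∷ σ
          -- `x₂` comes last because it must also be forward to `y` and `z`; the `+ 2` in `small`
          -- covers these two conditions, just as it covers the two targets of `z`.
          x₂ , x₂∈ = pick {s₂} {σ⁺} {[]}
            ((p≢s₂ , accepted-∈ {p} {σ} {τ-y} y∈) ∷ (q≢s₂ , accepted-∈ {q} {σ} {τ-z} z∈) ∷ f₂) []
            (subst (λ k → 2 * k ≤ Λ) (trans (+-comm (length σ) 2) (sym (+-identityʳ (suc (suc (length σ)))))) small)
      in record
      { x₁∈ = accepted-∈ {s₁} {σ} {[]} x₁∈ ; x₂∈ = accepted-∈ {s₂} {σ⁺} {[]} x₂∈ ; x₃∈ = accepted-∈ {s₃} {σ} {[]} x₃∈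
      ; y∈ = accepted-∈ {p} {σ} {τ-y} y∈ ; z∈ = accepted-∈ {q} {σ} {τ-z} z∈
      ; x₁-free = accepted-arc {s₁} {σ} {[]} x₁∈ ; x₂-free = λ u∈ → accepted-arc {s₂} {σ⁺} {[]} x₂∈ (there (there u∈))
      ; x₃-free = accepted-arc {s₃} {σ} {[]} x₃∈ ; y-free = accepted-arc {p} {σ} {τ-y} y∈ ; z-free = accepted-arc {q} {σ} {τ-z} z∈
      ; y-x₁ = yx₁ ; z-x₃ = zx₃ ; z-y = zy
      ; y-x₂ = accepted-arc {s₂} {σ⁺} {[]} x₂∈ (here refl) ; z-x₂ = accepted-arc {s₂} {σ⁺} {[]} x₂∈ (there (here refl)) }
      where
      small₀ : 2 * length σ ≤ Λ
      small₀ = ≤-trans (*-monoʳ-≤ 2 (m≤m+n (length σ) 2)) small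
      small₁ : 2 * (length σ + 1) ≤ Λ
      small₁ = ≤-trans (*-monoʳ-≤ 2 (+-monoʳ-≤ (length σ) (s≤s z≤n))) small

-- Backward graphs and galaxies

<ᵇ-true : ∀ {m n} → m < n → (m <ᵇ n) ≡ true
<ᵇ-true {m} {n} = dec-true (m <? n)

<ᵇ-false : ∀ {m n} → ¬ m < n → (m <ᵇ n) ≡ false
<ᵇ-false {m} {n} = dec-false (m <? n)

backwardPair-< : ∀ {A : Set} (f : A → ℕ) (R : Rel A) {x y} → f x < f y → backwardPair f R x y ≡ R y x
backwardPair-< f R lt rewrite <ᵇ-true lt | <ᵇ-false (<-asym lt) = refl

backwardPair-sym : ∀ {A : Set} (f : A → ℕ) (R : Rel A) x y → backwardPair f R x y ≡ backwardPair f R y x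
backwardPair-sym f R x y = Bool.∨-comm ((f y <ᵇ f x) ∧ R x y) _

-- Both vertices of a star K₁,₁ may be designated as centers; the smaller one is kept.
module Galaxy {r : ℕ} (G : Rel (Fin r)) (gal : IsGalaxyOrdering G) where

  open IsGalaxyOrdering gal

  private
    Adj = adjB G
    _⇝_ = Reach G

  adj? : ∀ x y → Dec (Adj x y)
  adj? x y = backwardPair toℕ G x y Bool.≟ true

  adj-sym : ∀ x y → Adj x y → Adj y x
  adj-sym x y = trans (backwardPair-sym toℕ G y x)

  adj-irrefl : ∀ x → ¬ Adj x x
  adj-irrefl x a rewrite <ᵇ-false (<-irrefl {toℕ x} refl) with () ← a

  ⇝-trans : ∀ {x y z} → x ⇝ y → y ⇝ z → x ⇝ z
  ⇝-trans xy here = xy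
  ⇝-trans xy (step yz a) = step (⇝-trans xy yz) a

  ⇝-sym : ∀ {x y} → x ⇝ y → y ⇝ x
  ⇝-sym here = here
  ⇝-sym (step {y} {z} xy a) = ⇝-trans (step here (adj-sym y z a)) (⇝-sym xy)

  adj⇒⇝ : ∀ {x y} → Adj x y → x ⇝ y
  adj⇒⇝ = step here

  SmallerCenter : Fin r → Fin r → Set
  SmallerCenter c x = toℕ x < toℕ c × center x ≡ true × Adj c x

  smaller? : ∀ c → Dec (∃ (SmallerCenter c))
  smaller? c = Fin.any? λ x → (toℕ x <? toℕ c) ×-dec ((center x Bool.≟ true) ×-dec adj? c x)

  Canonical : Fin r → Set
  Canonical c = center c ≡ true × ¬ ∃ (SmallerCenter c)

  canonical? : ∀ c → Dec (Canonical c)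
  canonical? c = (center c Bool.≟ true) ×-dec ¬? (smaller? c)

  star : ∀ {c} → Canonical c → StarCenter G c
  star (e , _) = center-star _ e

  neighbour : ∀ {c u} → Canonical c → c ⇝ u → u ≡ c ⊎ Adj c u
  neighbour can = proj₁ (proj₂ (star can)) _

  leaves-independent : ∀ {c x y} → Canonical c → Adj c x → Adj c y → ¬ Adj x y
  leaves-independent can = proj₁ (proj₂ (proj₂ (star can))) _ _

  canonical-unique : ∀ {c c′} → Canonical c → Canonical c′ → c ⇝ c′ → c ≡ c′
  canonical-unique {c} {c′} can@(e , ¬s) can′@(e′ , ¬s′) reach with neighbour can reach
  ... | inj₁ eq = sym eq
  ... | inj₂ a with <-cmp (toℕ c) (toℕ c′)
  ...   | tri< lt _ _ = contradiction (c , lt , e , adj-sym c c′ a) ¬s′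
  ...   | tri≈ _ eq _ = toℕ-injective eq
  ...   | tri> _ _ gt = contradiction (c′ , gt , e′ , a) ¬s

  -- One step down suffices: a still smaller center next to `x` would lie in the component of `c`,
  -- hence be `c` or a neighbour of `c`. The first contradicts the order, the second the
  -- independence of the leaves.
  canonical-center : ∀ {c} → center c ≡ true → ∃ λ c′ → Canonical c′ × c ⇝ c′
  canonical-center {c} e with smaller? c
  ... | no ¬s = c , (e , ¬s) , here
  ... | yes (x , x<c , eₓ , cx) = x , (eₓ , no-smaller) , adj⇒⇝ cx
    where
    no-smaller : ¬ ∃ (SmallerCenter x)
    no-smaller (y , y<x , _ , xy) with proj₁ (proj₂ (center-star c e)) y (step (adj⇒⇝ cx) xy)
    ... | inj₁ refl = <-asym y<x x<c
    ... | inj₂ cy   = proj₁ (proj₂ (proj₂ (center-star c e))) x y cx cy xy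

  adj-canonical : ∀ {x y} → Adj x y → Canonical x ⊎ Canonical y
  adj-canonical {x} {y} xy with components x
  ... | inj₁ alone with refl ← alone y (adj⇒⇝ xy) = contradiction xy (adj-irrefl x)
  ... | inj₂ (c₀ , e , x⇝c₀) with c , can , c₀⇝c ← canonical-center e
      with c⇝x ← ⇝-sym (⇝-trans x⇝c₀ c₀⇝c)
      with neighbour can c⇝x | neighbour can (step c⇝x xy)
  ...   | inj₁ refl | _         = inj₁ can
  ...   | inj₂ _    | inj₁ refl = inj₂ can
  ...   | inj₂ cx   | inj₂ cy   = contradiction xy (leaves-independent can cx cy)

  canonical-adj : ∀ {c c′ x} → Canonical c → Canonical c′ → Adj c x → Adj c′ x → c ≡ c′
  canonical-adj {c′ = c′} {x} can can′ cx c′x = canonical-unique can can′ (step (adj⇒⇝ cx) (adj-sym c′ x c′x))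

  leaf-not-canonical : ∀ {c x} → Canonical c → Adj c x → ¬ Canonical x
  leaf-not-canonical {c} can cx can′ with refl ← canonical-unique can can′ (adj⇒⇝ cx) = adj-irrefl c cx

  -- The galaxy condition concerns the other stars; the star's own center is first or last in its
  -- star and thus not between two leaves either.
  no-center-between : ∀ {c c′ x y} → Canonical c → Canonical c′ → Adj c x → Adj c y →
                      toℕ x < toℕ c′ → toℕ c′ < toℕ y → ⊥
  no-center-between {c} {c′} can can′ cx cy x<c′ c′<y =
    no-between c′ c (proj₁ can′) (proj₁ can) not-own _ _ cx cy (x<c′ , c′<y)
    where
    not-own : ¬ c ⇝ c′
    not-own reach with refl ← canonical-unique can can′ reach with proj₂ (proj₂ (proj₂ (star can)))
    ... | inj₁ last  = <-asym c′<y (last _ cy)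
    ... | inj₂ first = <-asym x<c′ (first _ cx)

-- Enumeration, parity and the assignment of cells to blocks

allSum : ∀ a b → List (Fin a ⊎ Fin b)
allSum a b = map inj₁ (allFin a) ++ map inj₂ (allFin b)

∈-allSum : ∀ {a b} (i : Fin a ⊎ Fin b) → i ∈ allSum a b
∈-allSum (inj₁ i) = ∈-++⁺ˡ (∈-map⁺ inj₁ (∈-allFin i))
∈-allSum {a} (inj₂ i) = ∈-++⁺ʳ (map inj₁ (allFin a)) (∈-map⁺ inj₂ (∈-allFin i))

allSum-unique : ∀ a b → Unique (allSum a b)
allSum-unique a b = AllPairsₚ.++⁺ (Uniqueₚ.map⁺ (λ { refl → refl }) (Uniqueₚ.allFin⁺ a)) (Uniqueₚ.map⁺ (λ { refl → refl }) (Uniqueₚ.allFin⁺ b))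
  (Allₚ.map⁺ (All.tabulate λ _ → Allₚ.map⁺ (All.tabulate λ _ → λ ())))

length-allSum : ∀ a b → length (allSum a b) ≡ a + b
length-allSum a b = begin
  length (allSum a b)                                          ≡⟨ length-++ (map inj₁ (allFin a)) ⟩
  length (map inj₁ (allFin a)) + length (map inj₂ (allFin b))  ≡⟨ cong₂ _+_ (length-map inj₁ (allFin a)) (length-map inj₂ (allFin b)) ⟩
  length (allFin a) + length (allFin b)                        ≡⟨ cong₂ _+_ (length-tabulate {n = a} id) (length-tabulate {n = b} id) ⟩
  a + b                                                        ∎
  where open ≡-Reasoning

double : ℕ → ℕ
double zero    = zero
double (suc n) = suc (suc (double n))

double-mono : ∀ {m n} → m ≤ n → double m ≤ double n
double-mono z≤n     = z≤n
double-mono (s≤s h) = s≤s (s≤s (double-mono h))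

even : ℕ → Bool
even 0             = true
even 1             = false
even (suc (suc n)) = even n

even-double : ∀ n → even (double n) ≡ true
even-double zero    = refl
even-double (suc n) = even-double n

odd-suc-double : ∀ n → even (suc (double n)) ≡ false
odd-suc-double zero    = refl
odd-suc-double (suc n) = odd-suc-double n

-- Consecutive cells that are not linear share a block; each linear cell has a block of its own.
-- Blocks of even index are chains.
module Blocking {I : Set} (allI : List I) (∈allI : ∀ i → i ∈ allI) (rank : I → ℕ) (lin : I → Bool) where

  LinearBelow : ℕ → I → Set
  LinearBelow k z = lin z ≡ true × rank z < k

  linearBelow? : ∀ k → Decidable (LinearBelow k)
  linearBelow? k z = (lin z Bool.≟ true) ×-dec (rank z <? k)

  #below : ℕ → ℕ
  #below k = count (linearBelow? k) allI

  #below-mono : ∀ {k l} → (∀ {z} → lin z ≡ true → rank z < k → rank z < l) → #below k ≤ #below l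
  #below-mono {k} {l} h = count-mono {xs = allI} (linearBelow? k) (linearBelow? l) λ _ (e , lt) → e , h e lt

  -- Counting the linear cells in front makes the block index monotone in the rank and changes the
  -- chain block exactly at linear cells.
  blockOf : Bool → ℕ → ℕ
  blockOf true  k = suc (double k)
  blockOf false k = double k

  blk : I → ℕ
  blk i = blockOf (lin i) (#below (rank i))

  blockCount : ℕ
  blockCount = suc (suc (double (length allI)))

  blk< : ∀ i → blk i < blockCount
  blk< i with lin i
  ... | true  = s≤s (s≤s (double-mono (length-filter (linearBelow? (rank i)) allI)))
  ... | false = s≤s (m≤n⇒m≤1+n (double-mono (length-filter (linearBelow? (rank i)) allI)))

  double≤blk : ∀ j → double (#below (rank j)) ≤ blk j
  double≤blk j with lin j
  ... | true  = n≤1+n _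
  ... | false = ≤-refl

  linear-blk-< : ∀ {i j} → lin i ≡ true → rank i < rank j → suc (double (#below (rank i))) < blk j
  linear-blk-< {i} {j} e lt = ≤-trans
    (double-mono (count-mono-< (linearBelow? (rank i)) (linearBelow? (rank j)) (λ (e , l) → e , <-trans l lt)
                   (∈allI i) (e , lt) (λ (_ , l) → <-irrefl refl l)))
    (double≤blk j)

  blk-mono : ∀ {i j} → rank i < rank j → blk i ≤ blk j
  blk-mono {i} {j} lt with lin i in e
  ... | true  = <⇒≤ (linear-blk-< e lt)
  ... | false = ≤-trans (double-mono (#below-mono λ _ l → <-trans l lt)) (double≤blk j)

  blk-equal : ∀ {i j} → rank i < rank j → blk i ≡ blk j → even (blk i) ≡ true
  blk-equal {i} {j} lt eq with lin i in e
  ... | true  = contradiction eq (<⇒≢ (linear-blk-< e lt))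
  ... | false = even-double (#below (rank i))

  linear-blk : ∀ {i} → lin i ≡ true → even (blk i) ≡ false
  linear-blk {i} e rewrite e = odd-suc-double (#below (rank i))

  same-blk : ∀ {x y} → lin x ≡ false → lin y ≡ false → rank x < rank y →
             (∀ {z} → lin z ≡ true → rank x ≤ rank z → ¬ rank z < rank y) → blk x ≡ blk y
  same-blk {x} {y} ex ey lt none rewrite ex | ey = cong double (≤-antisym
    (#below-mono λ _ l → <-trans l lt)
    (#below-mono λ {z} e l → ≰⇒> λ x≤z → none e x≤z l))

-- The cells of an α-galaxy

does-true : ∀ {P : Set} (P? : Dec P) → does P? ≡ true → P
does-true (yes p) _ = p

<ᵇ-anti : ∀ {m n} → m ≢ n → (m <ᵇ n) ≡ not (n <ᵇ m)
<ᵇ-anti {m} {n} m≢n with <-cmp m n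
... | tri< lt _ _ rewrite <ᵇ-true lt | <ᵇ-false (<-asym lt) = refl
... | tri≈ _ eq _ = contradiction eq m≢n
... | tri> _ _ gt rewrite <ᵇ-true gt | <ᵇ-false (<-asym gt) = refl

fromBackward-irrefl : ∀ {A : Set} (f : A → ℕ) (B : Rel A) x → fromBackward f B x x ≡ false
fromBackward-irrefl f B x with B x x
... | true  = <ᵇ-false {f x} (<-irrefl refl)
... | false = <ᵇ-false {f x} (<-irrefl refl)

fromBackward-anti : ∀ {A : Set} (f : A → ℕ) (B : Rel A) {x y} → f x ≢ f y → B x y ≡ B y x →
                    fromBackward f B x y ≡ not (fromBackward f B y x)
fromBackward-anti f B {x} {y} ne eq rewrite eq with B y x
... | true  = <ᵇ-anti (ne ∘ sym)
... | false = <ᵇ-anti ne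

-- The pair 0, 4 is the extra star, with `h₂` as center and `h₁` as leaf; the pair 6, 8 is the star
-- `h₅h₇` with center `h₅`.
leaf₉? : (i j : Fin 9) → Dec ((i ≡ 0F × j ≡ 4F) ⊎ (i ≡ 6F × j ≡ 8F))
leaf₉? i j = ((i Fin.≟ 0F) ×-dec (j Fin.≟ 4F)) ⊎-dec ((i Fin.≟ 6F) ×-dec (j Fin.≟ 8F))

-- Cells for an α-galaxy.  Cells 6, 7, 8 of Fin 9 receive h₅, h₆, h₇ and cell inj₂ i receives gᵢ.
-- Cells 0 – 5 come before all of these: 1, 2, 3 are parts of one chain, the others are linear.
module Layout (r₁ r₂ r₃ : ℕ) (G : Rel (Fin (r₁ + r₂ + r₃))) (gal : IsGalaxyOrdering G) (nosplit : NoStarSplitAt G r₁) where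

  open Galaxy G gal

  r = r₁ + r₂ + r₃

  Cell : Set
  Cell = Fin 9 ⊎ Fin r

  allCells : List Cell
  allCells = allSum 9 r

  -- On the cells 2 - 8 this is one more than `ρ₁` on `h₁`, ..., `h₇`. The shift makes room for the
  -- cells 0 and 1 in front, and `rank` shifts `ρ₂` as well.
  rank₉ : ℕ → ℕ
  rank₉ 7 = 7 + r₁
  rank₉ 8 = 8 + (r₁ + r₂)
  rank₉ k = k

  rank : Cell → ℕ
  rank (inj₁ i) = rank₉ (toℕ i)
  rank (inj₂ g) = suc (ρ₂ r₁ r₂ g)

  data View₉ : ℕ → Set where
    small : ∀ {k} → k < 7 → rank₉ k ≡ k → View₉ k
    seven : View₉ 7
    eight : View₉ 8

  view₉ : ∀ {k} → k < 9 → View₉ k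
  view₉ {0} _ = small (s≤s z≤n) refl
  view₉ {1} _ = small (s≤s (s≤s z≤n)) refl
  view₉ {2} _ = small (s≤s (s≤s (s≤s z≤n))) refl
  view₉ {3} _ = small (s≤s (s≤s (s≤s (s≤s z≤n)))) refl
  view₉ {4} _ = small (s≤s (s≤s (s≤s (s≤s (s≤s z≤n))))) refl
  view₉ {5} _ = small (s≤s (s≤s (s≤s (s≤s (s≤s (s≤s z≤n)))))) refl
  view₉ {6} _ = small (s≤s (s≤s (s≤s (s≤s (s≤s (s≤s (s≤s z≤n))))))) refl
  view₉ {7} _ = seven
  view₉ {8} _ = eight
  view₉ {suc (suc (suc (suc (suc (suc (suc (suc (suc _))))))))} (s≤s (s≤s (s≤s (s≤s (s≤s (s≤s (s≤s (s≤s (s≤s ())))))))))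

  data RankView (g : Fin r) : Set where
    first  : toℕ g < r₁ → rank (inj₂ g) ≡ 7 + toℕ g → RankView g
    second : r₁ ≤ toℕ g → toℕ g < r₁ + r₂ → rank (inj₂ g) ≡ 8 + toℕ g → RankView g
    third  : r₁ + r₂ ≤ toℕ g → rank (inj₂ g) ≡ 9 + toℕ g → RankView g

  rank-view : ∀ g → RankView g
  rank-view g with toℕ g <? r₁
  ... | yes lt = first lt eq
    where
    eq : suc (ρ₂ r₁ r₂ g) ≡ 7 + toℕ g
    eq rewrite <ᵇ-true lt = refl
  ... | no ¬lt with toℕ g <? r₁ + r₂
  ...   | yes lt = second (≮⇒≥ ¬lt) lt eq
    where
    eq : suc (ρ₂ r₁ r₂ g) ≡ 8 + toℕ g
    eq rewrite <ᵇ-false ¬lt | <ᵇ-true lt = refl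
  ...   | no ¬lt′ = third (≮⇒≥ ¬lt′) eq
    where
    eq : suc (ρ₂ r₁ r₂ g) ≡ 9 + toℕ g
    eq rewrite <ᵇ-false ¬lt | <ᵇ-false ¬lt′ = refl

  r₁≤ : ∀ {k} → r₁ + r₂ ≤ k → r₁ ≤ k
  r₁≤ = ≤-trans (m≤m+n r₁ r₂)

  small-before : ∀ g {k} → k < 7 → k < rank (inj₂ g)
  small-before g lt with rank-view g
  ... | first  _ e   rewrite e = ≤-trans lt (m≤m+n 7 _)
  ... | second _ _ e rewrite e = ≤-trans lt (m≤m+n 7 _)
  ... | third  _ e   rewrite e = ≤-trans lt (m≤m+n 7 _)

  before-seven : ∀ {g} → toℕ g < r₁ → rank (inj₂ g) < rank (inj₁ 7F)
  before-seven {g} lt with rank-view g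
  ... | first  _ e   rewrite e = +-monoʳ-< 7 lt
  ... | second ge _ _ = contradiction lt (≤⇒≯ ge)
  ... | third  ge _   = contradiction lt (≤⇒≯ (r₁≤ ge))

  after-seven : ∀ {g} → r₁ ≤ toℕ g → rank (inj₁ 7F) < rank (inj₂ g)
  after-seven {g} ge with rank-view g
  ... | first  lt _  = contradiction lt (≤⇒≯ ge)
  ... | second _ _ e rewrite e = s≤s (+-monoʳ-≤ 7 ge)
  ... | third  _ e   rewrite e = s≤s (m≤n⇒m≤1+n (+-monoʳ-≤ 7 ge))

  before-eight : ∀ {g} → toℕ g < r₁ + r₂ → rank (inj₂ g) < rank (inj₁ 8F)
  before-eight {g} lt with rank-view g
  ... | first  _ e   rewrite e = m≤n⇒m≤1+n (+-monoʳ-< 7 lt)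
  ... | second _ _ e rewrite e = +-monoʳ-< 8 lt
  ... | third  ge _  = contradiction lt (≤⇒≯ ge)

  after-eight : ∀ {g} → r₁ + r₂ ≤ toℕ g → rank (inj₁ 8F) < rank (inj₂ g)
  after-eight {g} ge with rank-view g
  ... | first  lt _   = contradiction lt (≤⇒≯ (r₁≤ ge))
  ... | second _ lt _ = contradiction lt (≤⇒≯ ge)
  ... | third  _ e    rewrite e = s≤s (+-monoʳ-≤ 8 ge)

  rank-mono₂ : ∀ {g g′} → toℕ g < toℕ g′ → rank (inj₂ g) < rank (inj₂ g′)
  rank-mono₂ {g} {g′} lt with rank-view g | rank-view g′
  ... | first _ e    | first _ e′    rewrite e | e′ = +-monoʳ-< 7 lt
  ... | first _ e    | second _ _ e′ rewrite e | e′ = m≤n⇒m≤1+n (+-monoʳ-< 7 lt)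
  ... | first _ e    | third _ e′    rewrite e | e′ = m≤n⇒m≤1+n (m≤n⇒m≤1+n (+-monoʳ-< 7 lt))
  ... | second ge _ _ | first lt′ _  = contradiction (<-trans lt lt′) (≤⇒≯ ge)
  ... | second _ _ e | second _ _ e′ rewrite e | e′ = +-monoʳ-< 8 lt
  ... | second _ _ e | third _ e′    rewrite e | e′ = m≤n⇒m≤1+n (+-monoʳ-< 8 lt)
  ... | third ge _   | first lt′ _    = contradiction (<-trans lt lt′) (≤⇒≯ (r₁≤ ge))
  ... | third ge _   | second _ lt′ _ = contradiction (<-trans lt lt′) (≤⇒≯ ge)
  ... | third _ e    | third _ e′    rewrite e | e′ = +-monoʳ-< 9 lt

  rank-mono₁ : ∀ {i j : Fin 9} → toℕ i < toℕ j → rank (inj₁ i) < rank (inj₁ j)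
  rank-mono₁ {i} {j} lt = go (view₉ (toℕ<n i)) (view₉ (toℕ<n j)) lt
    where
    go : ∀ {k l} → View₉ k → View₉ l → k < l → rank₉ k < rank₉ l
    go (small _ e) (small _ e′) lt rewrite e | e′ = lt
    go (small k<7 e) seven _ rewrite e = ≤-trans k<7 (m≤m+n 7 r₁)
    go (small k<7 e) eight _ rewrite e = m≤n⇒m≤1+n (≤-trans k<7 (m≤m+n 7 (r₁ + r₂)))
    go seven (small l<7 _) lt = contradiction (<-trans lt l<7) (<-irrefl refl)
    go seven seven lt = contradiction lt (<-irrefl refl)
    go seven eight _ = s≤s (+-monoʳ-≤ 7 (m≤m+n r₁ r₂))
    go eight (small l<7 _) lt = contradiction (<-trans lt l<7) (<-asym (n<1+n 7))
    go eight seven lt = contradiction lt (<-asym (n<1+n 7))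
    go eight eight lt = contradiction lt (<-irrefl refl)

  rank-mixed : ∀ (i : Fin 9) g → rank (inj₁ i) ≢ rank (inj₂ g)
  rank-mixed i g = go (view₉ (toℕ<n i))
    where
    go : ∀ {k} → View₉ k → rank₉ k ≢ rank (inj₂ g)
    go (small lt e) rewrite e = <⇒≢ (small-before g lt)
    go seven with toℕ g <? r₁
    ... | yes lt = <⇒≢ (before-seven lt) ∘ sym
    ... | no ge  = <⇒≢ (after-seven (≮⇒≥ ge))
    go eight with toℕ g <? r₁ + r₂
    ... | yes lt = <⇒≢ (before-eight lt) ∘ sym
    ... | no ge  = <⇒≢ (after-eight (≮⇒≥ ge))

  rank-injective : ∀ {x y} → rank x ≡ rank y → x ≡ y
  rank-injective {inj₁ i} {inj₁ j} eq with <-cmp (toℕ i) (toℕ j)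
  ... | tri< lt _ _ = contradiction eq (<⇒≢ (rank-mono₁ lt))
  ... | tri≈ _ e _  = cong inj₁ (toℕ-injective e)
  ... | tri> _ _ gt = contradiction (sym eq) (<⇒≢ (rank-mono₁ gt))
  rank-injective {inj₁ i} {inj₂ g} eq = contradiction eq (rank-mixed i g)
  rank-injective {inj₂ g} {inj₁ i} eq = contradiction (sym eq) (rank-mixed i g)
  rank-injective {inj₂ g} {inj₂ g′} eq with <-cmp (toℕ g) (toℕ g′)
  ... | tri< lt _ _ = contradiction eq (<⇒≢ (rank-mono₂ lt))
  ... | tri≈ _ e _  = cong inj₂ (toℕ-injective e)
  ... | tri> _ _ gt = contradiction (sym eq) (<⇒≢ (rank-mono₂ gt))

  rank-mono₂⁻ : ∀ {g g′} → rank (inj₂ g) < rank (inj₂ g′) → toℕ g < toℕ g′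
  rank-mono₂⁻ {g} {g′} lt with <-cmp (toℕ g) (toℕ g′)
  ... | tri< l _ _  = l
  ... | tri≈ _ e _  = contradiction lt (<-irrefl (cong (rank ∘ inj₂) (toℕ-injective e)))
  ... | tri> _ _ gt = contradiction lt (<-asym (rank-mono₂ gt))

  rank< : ∀ x → rank x < 9 + r
  rank< (inj₁ i) = go (view₉ (toℕ<n i))
    where
    go : ∀ {k} → View₉ k → rank₉ k < 9 + r
    go (small lt e) rewrite e = ≤-trans lt (m≤m+n 7 (2 + r))
    go seven = m≤n⇒m≤1+n (s≤s (+-monoʳ-≤ 7 (≤-trans (m≤m+n r₁ r₂) (m≤m+n (r₁ + r₂) r₃))))
    go eight = s≤s (+-monoʳ-≤ 8 (m≤m+n (r₁ + r₂) r₃))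
  rank< (inj₂ g) with rank-view g
  ... | first  _ e   rewrite e = m≤n⇒m≤1+n (m≤n⇒m≤1+n (+-monoʳ-< 7 (toℕ<n g)))
  ... | second _ _ e rewrite e = m≤n⇒m≤1+n (+-monoʳ-< 8 (toℕ<n g))
  ... | third  _ e   rewrite e = +-monoʳ-< 9 (toℕ<n g)

  -- Cells 0, 5, 6, 7 and those of the centers of `G` must be linear, since their vertices get
  -- backward neighbours through `no-cut`. Cell 8, for `h₇`, must not be: it may lie between two
  -- leaves of a star of `G`, which have to share a chain block.
  lin : Cell → Bool
  lin (inj₁ 1F) = false
  lin (inj₁ 2F) = false
  lin (inj₁ 3F) = false
  lin (inj₁ 8F) = false
  lin (inj₁ _)  = true
  lin (inj₂ g)  = does (canonical? g)

  Leaf : Cell → Cell → Set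
  Leaf (inj₁ i) (inj₁ j) = (i ≡ 0F × j ≡ 4F) ⊎ (i ≡ 6F × j ≡ 8F)
  Leaf (inj₁ _) (inj₂ _) = ⊥
  Leaf (inj₂ _) (inj₁ _) = ⊥
  Leaf (inj₂ c) (inj₂ x) = Canonical c × adjB G c x

  leaf? : ∀ c x → Dec (Leaf c x)
  leaf? (inj₁ i) (inj₁ j) = leaf₉? i j
  leaf? (inj₁ _) (inj₂ _) = no λ ()
  leaf? (inj₂ _) (inj₁ _) = no λ ()
  leaf? (inj₂ c) (inj₂ x) = canonical? c ×-dec adj? c x

  leaf : Cell → Cell → Bool
  leaf c x = does (leaf? c x)

  leaf⇒ : ∀ {c x} → leaf c x ≡ true → Leaf c x
  leaf⇒ {c} {x} = does-true (leaf? c x)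

  open Blocking allCells ∈-allSum rank lin public

  Leaf-lin : ∀ {c x} → Leaf c x → lin c ≡ true × c ≢ x
  Leaf-lin {inj₁ _} {inj₁ _} (inj₁ (refl , refl)) = refl , λ ()
  Leaf-lin {inj₁ _} {inj₁ _} (inj₂ (refl , refl)) = refl , λ ()
  Leaf-lin {inj₂ c} {inj₂ x} (can , cx) = dec-true (canonical? c) can , λ { refl → adj-irrefl c cx }

  Leaf-center : ∀ {c c′ x} → Leaf c x → Leaf c′ x → c ≡ c′
  Leaf-center {inj₁ _} {inj₁ _} {inj₁ _} (inj₁ (refl , refl)) (inj₁ (refl , _)) = refl
  Leaf-center {inj₁ _} {inj₁ _} {inj₁ _} (inj₂ (refl , refl)) (inj₂ (refl , _)) = refl
  Leaf-center {inj₁ _} {inj₁ _} {inj₁ _} (inj₁ (_ , refl)) (inj₂ (_ , ()))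
  Leaf-center {inj₁ _} {inj₁ _} {inj₁ _} (inj₂ (_ , refl)) (inj₁ (_ , ()))
  Leaf-center {inj₂ _} {inj₂ _} {inj₂ _} (can , cx) (can′ , c′x) = cong inj₂ (canonical-adj can can′ cx c′x)

  Leaf-Leaf : ∀ {c x y} → Leaf c x → ¬ Leaf x y
  Leaf-Leaf {inj₁ _} {inj₁ _} {inj₁ _} (inj₁ (_ , refl)) (inj₁ (() , _))
  Leaf-Leaf {inj₁ _} {inj₁ _} {inj₁ _} (inj₁ (_ , refl)) (inj₂ (() , _))
  Leaf-Leaf {inj₁ _} {inj₁ _} {inj₁ _} (inj₂ (_ , refl)) (inj₁ (() , _))
  Leaf-Leaf {inj₁ _} {inj₁ _} {inj₁ _} (inj₂ (_ , refl)) (inj₂ (() , _))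
  Leaf-Leaf {inj₂ _} {inj₂ _} {inj₂ _} (can , cx) (can′ , _) = leaf-not-canonical can cx can′

  -- For a star of `G`, every linear cell between two leaves is excluded for its own reason: cells
  -- up to 6 precede `G`, cell 7 would split the star at `r₁`, cell 8 is not linear, and the centers
  -- of `G` are kept out by `no-center-between`.
  Leaf-blk : ∀ {c x y} → Leaf c x → Leaf c y → rank x < rank y → blk x ≡ blk y
  Leaf-blk {inj₁ _} {inj₁ _} {inj₁ _} (inj₁ (refl , refl)) (inj₁ (_ , refl)) lt = contradiction lt (<-irrefl refl)
  Leaf-blk {inj₁ _} {inj₁ _} {inj₁ _} (inj₂ (refl , refl)) (inj₂ (_ , refl)) lt = contradiction lt (<-irrefl refl)
  Leaf-blk {inj₁ _} {inj₁ _} {inj₁ _} (inj₁ (refl , _)) (inj₂ (() , _)) _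
  Leaf-blk {inj₁ _} {inj₁ _} {inj₁ _} (inj₂ (refl , _)) (inj₁ (() , _)) _
  Leaf-blk {inj₂ c} {inj₂ x} {inj₂ y} (can , cx) (_ , cy) lt = same-blk {inj₂ x} {inj₂ y} x-leaf y-leaf lt λ {z} → none z
    where
    x-leaf : does (canonical? x) ≡ false
    x-leaf = dec-false (canonical? x) (leaf-not-canonical can cx)
    y-leaf : does (canonical? y) ≡ false
    y-leaf = dec-false (canonical? y) (leaf-not-canonical can cy)
    none₉ : ∀ (i : Fin 9) {k} → View₉ k → toℕ i ≡ k → lin (inj₁ i) ≡ true →
            rank (inj₂ x) ≤ rank (inj₁ i) → ¬ rank (inj₁ i) < rank (inj₂ y)
    none₉ i (small i<7 eq) refl _ x≤ _ = <⇒≱ (small-before x i<7) (subst (rank (inj₂ x) ≤_) eq x≤)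
    none₉ i seven eq e x≤ <y with refl ← toℕ-injective {i = i} {7F} eq with toℕ x <? r₁ | toℕ y <? r₁
    ... | yes x< | no y≥ = nosplit c (star can) x y cx cy (x< , ≮⇒≥ y≥)
    ... | yes _  | yes y< = <-asym <y (before-seven y<)
    ... | no x≥  | _      = <⇒≱ (after-seven (≮⇒≥ x≥)) x≤
    none₉ i eight eq e _ _ with refl ← toℕ-injective {i = i} {8F} eq with () ← e
    none : ∀ z → lin z ≡ true → rank (inj₂ x) ≤ rank z → ¬ rank z < rank (inj₂ y)
    none (inj₁ i) = none₉ i (view₉ (toℕ<n i)) refl
    none (inj₂ c′) e x≤ <y = no-center-between can (does-true (canonical? c′) e) cx cy
      (rank-mono₂⁻ (≤∧≢⇒< x≤ λ eq → x≢c′ (rank-injective eq))) (rank-mono₂⁻ <y)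
      where
      x≢c′ : inj₂ x ≢ inj₂ c′
      x≢c′ refl with () ← trans (sym e) x-leaf

  chain-blk : ∀ {i j : Fin 9} → lin (inj₁ i) ≡ false → lin (inj₁ j) ≡ false →
              1 ≤ rank (inj₁ i) → rank (inj₁ i) < rank (inj₁ j) → rank (inj₁ j) ≤ 3 → blk (inj₁ i) ≡ blk (inj₁ j)
  chain-blk {i} {j} ei ej 1≤i lt j≤3 = same-blk {inj₁ i} {inj₁ j} ei ej lt λ {z} → none z
    where
    above : ∀ {k} → 3 ≤ k → ¬ k < rank (inj₁ j)
    above 3≤k k<j = <⇒≱ (≤-trans (s≤s 3≤k) k<j) j≤3
    none : ∀ z → lin z ≡ true → rank (inj₁ i) ≤ rank z → ¬ rank z < rank (inj₁ j)
    none (inj₁ 0F) e i≤z z<j = contradiction (≤-trans 1≤i i≤z) λ ()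
    none (inj₁ (fsuc (fsuc (fsuc k)))) e i≤z z<j = above (3≤rank₉ (toℕ k)) z<j
      where
      3≤rank₉ : ∀ k → 3 ≤ rank₉ (3 + k)
      3≤rank₉ 4 = m≤m+n 3 _
      3≤rank₉ 5 = m≤m+n 3 _
      3≤rank₉ 0 = m≤m+n 3 _
      3≤rank₉ 1 = m≤m+n 3 _
      3≤rank₉ 2 = m≤m+n 3 _
      3≤rank₉ 3 = m≤m+n 3 _
      3≤rank₉ (suc (suc (suc (suc (suc (suc k)))))) = m≤m+n 3 _
    none (inj₂ g) e i≤z z<j = above (<⇒≤ (small-before g (s≤s (s≤s (s≤s (s≤s z≤n)))))) z<j

  rank-ρ₁ : ∀ i → suc (ρ₁ r₁ r₂ i) ≡ rank (inj₁ (fsuc (fsuc i)))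
  rank-ρ₁ 0F = refl
  rank-ρ₁ 1F = refl
  rank-ρ₁ 2F = refl
  rank-ρ₁ 3F = refl
  rank-ρ₁ 4F = refl
  rank-ρ₁ 5F = refl
  rank-ρ₁ 6F = refl

  ρ₁-injective : ∀ {i j} → i ≢ j → ρ₁ r₁ r₂ i ≢ ρ₁ r₁ r₂ j
  ρ₁-injective {i} {j} ne eq = ne (drop₂ (rank-injective {inj₁ (fsuc (fsuc i))} {inj₁ (fsuc (fsuc j))}
                                     (trans (sym (rank-ρ₁ i)) (trans (cong suc eq) (rank-ρ₁ j)))))
    where
    drop₂ : ∀ {i j} → _≡_ {A = Cell} (inj₁ (fsuc (fsuc i))) (inj₁ (fsuc (fsuc j))) → i ≡ j
    drop₂ refl = refl

  ρ₂-injective : ∀ {g g′} → g ≢ g′ → ρ₂ r₁ r₂ g ≢ ρ₂ r₁ r₂ g′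
  ρ₂-injective {g} {g′} ne eq with refl ← rank-injective {inj₂ g} {inj₂ g′} (cong suc eq) = ne refl

  ρ-mixed : ∀ i g → ρ₁ r₁ r₂ i ≢ ρ₂ r₁ r₂ g
  ρ-mixed i g eq = rank-mixed (fsuc (fsuc i)) g (trans (sym (rank-ρ₁ i)) (cong suc eq))

  H : Rel (Fin 7 ⊎ Fin r)
  H = alphaGalaxy r₁ r₂ r₃ G

  H-irrefl : ∀ u → H u u ≡ false
  H-irrefl (inj₁ i) = fromBackward-irrefl (ρ₁ r₁ r₂) (backwardPair (ρ₁ r₁ r₂) Hs) i
  H-irrefl (inj₂ g) = fromBackward-irrefl (ρ₂ r₁ r₂) (backwardPair (ρ₂ r₁ r₂) G) g

  H-anti : ∀ {u v} → u ≢ v → H u v ≡ not (H v u)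
  H-anti {inj₁ i} {inj₁ j} ne = fromBackward-anti (ρ₁ r₁ r₂) (backwardPair (ρ₁ r₁ r₂) Hs) {i} {j}
    (ρ₁-injective {i} {j} λ { refl → ne refl }) (backwardPair-sym (ρ₁ r₁ r₂) Hs i j)
  H-anti {inj₁ i} {inj₂ g} _ = <ᵇ-anti (ρ-mixed i g)
  H-anti {inj₂ g} {inj₁ i} _ = <ᵇ-anti (ρ-mixed i g ∘ sym)
  H-anti {inj₂ g} {inj₂ g′} ne = fromBackward-anti (ρ₂ r₁ r₂) (backwardPair (ρ₂ r₁ r₂) G) {g} {g′}
    (ρ₂-injective {g} {g′} λ { refl → ne refl }) (backwardPair-sym (ρ₂ r₁ r₂) G g g′)

-- Nine cells that contain `H_s` in every case

-- Inside the product the backward pairs of a factor give the factor back, so a copy can be compared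
-- with `Hs` and `G` directly.
fromBackward-backwardPair : ∀ {A : Set} (f : A → ℕ) (R : Rel A) {x y} → f x ≢ f y → R x y ≡ not (R y x) →
                            fromBackward f (backwardPair f R) x y ≡ R x y
fromBackward-backwardPair f R {x} {y} fx≢fy anti with <-cmp (f x) (f y)
... | tri< lt _ _ rewrite backwardPair-< f R lt | <ᵇ-true lt | <ᵇ-false (<-asym lt) | anti with R y x
...   | true  = refl
...   | false = refl
fromBackward-backwardPair f R fx≢fy anti | tri≈ _ eq _ = contradiction eq fx≢fy
fromBackward-backwardPair f R {x} {y} fx≢fy anti | tri> _ _ gt
  rewrite trans (backwardPair-sym f R x y) (backwardPair-< f R gt) | <ᵇ-true gt | <ᵇ-false (<-asym gt) with R x y
... | true  = refl
... | false = refl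

Hs-anti : ∀ i j → i ≡ j ⊎ Hs i j ≡ not (Hs j i)
Hs-anti = from-yes (Fin.all? λ i → Fin.all? λ j → (i Fin.≟ j) ⊎-dec (Hs i j Bool.≟ not (Hs j i)))

isStar : Fin 9 → Bool
isStar 0F = true
isStar 4F = true
isStar 6F = true
isStar 8F = true
isStar _  = false

-- Backward edges between the cells 1, 2, 3, 5, 7; a and b are those of the pairs (1, 7) and (3, 5).
gadgetEdge : Bool → Bool → ℕ → ℕ → Bool
gadgetEdge a b 1 5 = true
gadgetEdge a b 3 7 = true
gadgetEdge a b 5 7 = true
gadgetEdge a b 1 7 = a
gadgetEdge a b 3 5 = b
gadgetEdge a b _ _ = false

back₉ : Bool → Bool → Rel (Fin 9)
back₉ a b i j = (does (leaf₉? i j) ∨ does (leaf₉? j i)) ∨ (gadgetEdge a b (toℕ i) (toℕ j) ∨ gadgetEdge a b (toℕ j) (toℕ i))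

back₉-sym : ∀ a b i j → back₉ a b i j ≡ back₉ a b j i
back₉-sym a b i j = cong₂ _∨_ (Bool.∨-comm (does (leaf₉? i j)) _) (Bool.∨-comm (gadgetEdge a b (toℕ i) (toℕ j)) _)

back₉-star : ∀ a b i j → isStar i ≡ true → isStar j ≡ true → back₉ a b i j ≡ does (leaf₉? i j) ∨ does (leaf₉? j i)
back₉-star a b i j ei ej = trans (cong ((does (leaf₉? i j) ∨ does (leaf₉? j i)) ∨_) (none a b))
                                 (Bool.∨-identityʳ _)
  where
  -- The hypotheses enter as conjuncts, which turns the claim into a Boolean equation that
  -- evaluation decides over all pairs.
  Claim : Bool → Bool → Set
  Claim a b = ∀ i j → (isStar i ∧ isStar j) ∧ (gadgetEdge a b (toℕ i) (toℕ j) ∨ gadgetEdge a b (toℕ j) (toℕ i)) ≡ false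
  claim? : ∀ a b → Dec (Claim a b)
  claim? a b = Fin.all? λ i → Fin.all? λ j → _ Bool.≟ _
  claim : ∀ a b → Claim a b
  claim true  true  = from-yes (claim? true true)
  claim true  false = from-yes (claim? true false)
  claim false true  = from-yes (claim? false true)
  claim false false = from-yes (claim? false false)
  none : ∀ a b → gadgetEdge a b (toℕ i) (toℕ j) ∨ gadgetEdge a b (toℕ j) (toℕ i) ≡ false
  none a b = trans (sym (cong (_∧ (gadgetEdge a b (toℕ i) (toℕ j) ∨ gadgetEdge a b (toℕ j) (toℕ i))) (cong₂ _∧_ ei ej))) (claim a b i j)

back₉-mixed : ∀ a b i j → isStar i ≡ true → isStar j ≡ false → back₉ a b i j ≡ false
back₉-mixed a b i j ei ej = trans (sym (cong (_∧ back₉ a b i j) (cong₂ _∧_ ei (cong not ej)))) (claim a b i j)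
  where
  Claim : Bool → Bool → Set
  Claim a b = ∀ i j → (isStar i ∧ not (isStar j)) ∧ back₉ a b i j ≡ false
  claim? : ∀ a b → Dec (Claim a b)
  claim? a b = Fin.all? λ i → Fin.all? λ j → _ Bool.≟ _
  claim : ∀ a b → Claim a b
  claim true  true  = from-yes (claim? true true)
  claim true  false = from-yes (claim? true false)
  claim false true  = from-yes (claim? false true)
  claim false false = from-yes (claim? false false)

tournament₉ : Bool → Bool → Rel (Fin 9)
tournament₉ a b i j = if toℕ i <ᵇ toℕ j then not (back₉ a b i j) else back₉ a b i j

-- κ-rank: only h₁, …, h₄ may leave their place in the order, and they stay in front of G.
record HsCopy (a b : Bool) : Set where
  field
    κ      : Fin 7 → Fin 9
    κ-hom  : ∀ i j → i ≡ j ⊎ κ i ≢ κ j × tournament₉ a b (κ i) (κ j) ≡ Hs i j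
    κ-rank : ∀ i → κ i ≡ fsuc (fsuc i) ⊎ toℕ (κ i) < 7 × toℕ (fsuc (fsuc i)) < 7

hom? : ∀ a b (κ : Fin 7 → Fin 9) → Dec (∀ i j → i ≡ j ⊎ κ i ≢ κ j × tournament₉ a b (κ i) (κ j) ≡ Hs i j)
hom? a b κ = Fin.all? λ i → Fin.all? λ j → (i Fin.≟ j) ⊎-dec (¬? (κ i Fin.≟ κ j) ×-dec (tournament₉ a b (κ i) (κ j) Bool.≟ Hs i j))

rank? : ∀ (κ : Fin 7 → Fin 9) → Dec (∀ i → κ i ≡ fsuc (fsuc i) ⊎ toℕ (κ i) < 7 × toℕ (fsuc (fsuc i)) < 7)
rank? κ = Fin.all? λ i → (κ i Fin.≟ fsuc (fsuc i)) ⊎-dec ((toℕ (κ i) <? 7) ×-dec (toℕ (fsuc (fsuc i)) <? 7))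

-- `h₂` is isolated in the backward graph of `H_s`; it is `x₂`, which the chain supplies between
-- `x₁` and `x₃`.
path : Fin 7 → Fin 9
path 0F = 1F
path 1F = 2F
path 2F = 3F
path 3F = 5F
path i  = fsuc (fsuc i)

-- The ordering h₂, h₄, h₁, h₃, h₅, h₆, h₇, whose backward edges are
-- the disjoint edges h₁h₂ and h₅h₇ and the triangle h₃h₄h₆; h₄ is put into the given cell.
triangle : Fin 9 → Fin 7 → Fin 9
triangle c 0F = 4F
triangle c 1F = 0F
triangle c 2F = 5F
triangle c 3F = c
triangle c i  = fsuc (fsuc i)

-- `a` makes the cells 1, 5, 7 a backward triangle, and `b` the cells 3, 5, 7; this decides the cell
-- of `h₄`. The rest is evaluation.
hsCopy : ∀ a b → HsCopy a b
hsCopy false false = record { κ = path ; κ-hom = from-yes (hom? false false path) ; κ-rank = from-yes (rank? path) }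
hsCopy true  false = record { κ = triangle 1F ; κ-hom = from-yes (hom? true false (triangle 1F)) ; κ-rank = from-yes (rank? (triangle 1F)) }
hsCopy true  true  = record { κ = triangle 1F ; κ-hom = from-yes (hom? true true (triangle 1F)) ; κ-rank = from-yes (rank? (triangle 1F)) }
hsCopy false true  = record { κ = triangle 3F ; κ-hom = from-yes (hom? false true (triangle 3F)) ; κ-rank = from-yes (rank? (triangle 3F)) }

-- Assembling the copy of the α-galaxy

module FindCopy (r₁ r₂ r₃ : ℕ) (G : Rel (Fin (r₁ + r₂ + r₃))) (G-tournament : IsTournament G)
                (gal : IsGalaxyOrdering G) (nosplit : NoStarSplitAt G r₁)
                {V : Set} (E : Rel V) (isT : IsTournament E) where

  open Layout r₁ r₂ r₃ G gal nosplit
  open Galaxy G gal using (adj?; adj-sym; adj-canonical)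
  open Tournament E isT
  open Arcs E

  module _ (W : Cell → List V) (W-pos : ∀ i → 0 < length (W i)) (Λ : ℕ) .{{_ : NonZero Λ}}
           (smooth : ∀ {i j v} → i ≢ j → v ∈ W i → count (nonarc? (rank i) (rank j) v) (W j) * Λ ≤ length (W j))
           (run : ∀ {i j x y} → rank i < rank j → blk i ≡ blk j → x ∈ W i → y ∈ W j → x ⟶ y)
           (disjoint : ∀ {i j x y} → i ≢ j → x ∈ W i → y ∈ W j → x ≢ y)
           (no-cut : ∀ {i p U Y} → even (blk i) ≡ false → i ≢ p → U ⊆ W i → Y ⊆ W p →
                     length (W i) ≤ Λ * length U → length (W p) ≤ 2 * length Y →
                     ¬ (∀ {u y} → u ∈ U → y ∈ Y → arc (rank i) (rank p) u y ≡ true))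
           (Λ≥ : 2 * (length allCells * suc (length allCells) + (length allCells + 4)) ≤ Λ) where

    open Selection E rank rank-injective W W-pos Λ (λ i → even (blk i) ≡ false)

    leaf-lin : ∀ {c x} → leaf c x ≡ true → even (blk c) ≡ false × c ≢ x
    leaf-lin {c} {x} l = let e , c≢x = Leaf-lin {c} {x} (leaf⇒ {c} {x} l) in linear-blk {c} e , c≢x

    leaf-center : ∀ {c c′ x} → leaf c x ≡ true → leaf c′ x ≡ true → c ≡ c′
    leaf-center {c} {c′} {x} l l′ = Leaf-center {c} {c′} {x} (leaf⇒ {c} {x} l) (leaf⇒ {c′} {x} l′)

    leaf-leaf : ∀ {c x y} → leaf c x ≡ true → ¬ leaf x y ≡ true
    leaf-leaf {c} {x} {y} l l′ = Leaf-Leaf {c} {x} {y} (leaf⇒ {c} {x} l) (leaf⇒ {x} {y} l′)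

    leaf-run : ∀ {c x y u w} → leaf c x ≡ true → leaf c y ≡ true → rank x < rank y → u ∈ W x → w ∈ W y → u ⟶ w
    leaf-run {c} {x} {y} l l′ lt = run {x} {y} lt (Leaf-blk {c} {x} {y} (leaf⇒ {c} {x} l) (leaf⇒ {c} {y} l′) lt)

    module St = Stars smooth no-cut allCells ∈-allSum leaf (λ {c} {x} → leaf-lin {c} {x})
      (λ {c} {c′} {x} → leaf-center {c} {c′} {x}) (λ {c} {x} {y} → leaf-leaf {c} {x} {y})
      (λ {c} {x} {y} → leaf-run {c} {x} {y}) Λ≥

    starCells : List Cell
    starCells = inj₁ 0F ∷ inj₁ 6F ∷ map inj₂ (allFin r)

    notLeaf? : ∀ x → Dec (All (λ c → ¬ leaf c x ≡ true) allCells)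
    notLeaf? x = all? (λ c → ¬? (leaf c x Bool.≟ true)) allCells

    -- Every cell of `G` that is not a leaf counts as a center, so isolated vertices of the backward
    -- graph become stars without leaves.
    tops : List Cell
    tops = filter notLeaf? starCells

    tops-notLeaf : All St.NotLeaf tops
    tops-notLeaf = All.tabulate λ x∈ {c} → All.lookup (proj₂ (∈-filter⁻ notLeaf? {xs = starCells} x∈)) (∈-allSum c)

    tops-unique : Unique tops
    tops-unique = AllPairsₚ.filter⁺ notLeaf? starCells-unique
      where
      starCells-unique : Unique starCells
      starCells-unique = ((λ ()) ∷ Allₚ.map⁺ (All.tabulate λ _ ())) ∷ Allₚ.map⁺ (All.tabulate λ _ ())
                       ∷ Uniqueₚ.map⁺ (λ { refl → refl }) (Uniqueₚ.allFin⁺ r)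

    tops≤ : length tops ≤ length allCells
    tops≤ = ≤-trans (length-filter notLeaf? starCells) (s≤s (s≤s (m≤n+m _ 7)))

    selected : St.Selected tops
    selected = St.select tops tops-unique tops-notLeaf tops≤

    module WithSelection (sel : St.Selected tops) where

      open St.Selected sel

      star-cell : ∀ {i v} → (inj₁ i , v) ∈ σ → isStar i ≡ true
      star-cell iv∈ with domain iv∈
      ... | inj₁ i∈ = in-starCells (proj₁ (∈-filter⁻ notLeaf? {xs = starCells} i∈))
        where
        in-starCells : ∀ {i} → inj₁ i ∈ starCells → isStar i ≡ true
        in-starCells (here refl) = refl
        in-starCells (there (here refl)) = refl
        in-starCells (there (there i∈)) with _ , _ , () ← ∈-map⁻ inj₂ i∈
      ... | inj₂ (c , _ , l) = leaf-star c (leaf⇒ {c} l)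
        where
        leaf-star : ∀ {i} c → Leaf c (inj₁ i) → isStar i ≡ true
        leaf-star (inj₁ _) (inj₁ (_ , refl)) = refl
        leaf-star (inj₁ _) (inj₂ (_ , refl)) = refl

      fresh : ∀ i → isStar i ≡ false → All (Fresh (inj₁ i)) σ
      fresh i e = All.tabulate λ pv∈ → (λ { refl → contradiction (trans (sym e) (star-cell pv∈)) λ () }) , inside pv∈

      top : ∀ {x} → x ∈ starCells → St.NotLeaf x → St.Covers σ x
      top {x} x∈ nl = centers (∈-filter⁺ notLeaf? x∈ (All.tabulate λ {c} _ → nl {c}))

      root-notLeaf : ∀ {c x} → leaf c x ≡ true → St.NotLeaf c
      root-notLeaf {c} {x} l {c′} l′ = Leaf-Leaf {c′} {c} {x} (leaf⇒ {c′} {c} l′) (leaf⇒ {c} {x} l)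

      covers-leaf : ∀ {c x} → c ∈ starCells → leaf c x ≡ true → St.Covers σ x
      covers-leaf {c} {x} c∈ l = leaves (∈-filter⁺ notLeaf? c∈ (All.tabulate λ {c′} _ → root-notLeaf {c} {x} l {c′})) l

      inj₂∈ : ∀ g → inj₂ g ∈ starCells
      inj₂∈ g = there (there (∈-map⁺ inj₂ (∈-allFin g)))

      covers-g : ∀ g → St.Covers σ (inj₂ g)
      covers-g g with Fin.any? (λ c → leaf? (inj₂ c) (inj₂ g))
      ... | yes (c , l) = covers-leaf (inj₂∈ c) (dec-true (leaf? (inj₂ c) (inj₂ g)) l)
      ... | no ¬l = top (inj₂∈ g) λ {c} → not-leaf c
        where
        not-leaf : ∀ c → ¬ leaf c (inj₂ g) ≡ true
        not-leaf (inj₂ c) l = ¬l (c , leaf⇒ {inj₂ c} l)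

      covers₀ : St.Covers σ (inj₁ 0F)
      covers₀ = top (here refl) λ {c} → root-notLeaf {inj₁ 0F} {inj₁ 4F} refl {c}

      covers₄ : St.Covers σ (inj₁ 4F)
      covers₄ = covers-leaf {inj₁ 0F} (here refl) refl

      covers₆ : St.Covers σ (inj₁ 6F)
      covers₆ = top (there (here refl)) λ {c} → root-notLeaf {inj₁ 6F} {inj₁ 8F} refl {c}

      covers₈ : St.Covers σ (inj₁ 8F)
      covers₈ = covers-leaf {inj₁ 6F} (there (here refl)) refl

      short-enough : 2 * (length σ + 2) ≤ Λ
      short-enough = ≤-trans (*-monoʳ-≤ 2 (+-mono-≤ (≤-trans short (*-monoˡ-≤ _ tops≤)) (s≤s (s≤s z≤n)))) Λ≥

      the-gadget : Gadget smooth no-cut σ (inj₁ 1F) (inj₁ 2F) (inj₁ 3F) (inj₁ 5F) (inj₁ 7F)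
      the-gadget = gadget smooth no-cut (linear-blk {inj₁ 5F} refl) (linear-blk {inj₁ 7F} refl)
        (λ ()) (λ ()) (λ ()) (λ ()) (λ ())
        (fresh 1F refl) (fresh 2F refl) (fresh 3F refl) (fresh 5F refl) (fresh 7F refl) short-enough

      module WithGadget (gd : Gadget smooth no-cut σ (inj₁ 1F) (inj₁ 2F) (inj₁ 3F) (inj₁ 5F) (inj₁ 7F)) where

        open Gadget gd

        x : Fin 9 → V
        x 0F = proj₁ covers₀
        x 1F = x₁
        x 2F = x₂
        x 3F = x₃
        x 4F = proj₁ covers₄
        x 5F = y
        x 6F = proj₁ covers₆
        x 7F = z
        x 8F = proj₁ covers₈

        star-∈ : ∀ i → isStar i ≡ true → (inj₁ i , x i) ∈ σ
        star-∈ 0F _ = proj₂ covers₀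
        star-∈ 4F _ = proj₂ covers₄
        star-∈ 6F _ = proj₂ covers₆
        star-∈ 8F _ = proj₂ covers₈

        gadget-free : ∀ i → isStar i ≡ false → ∀ {p u} → (p , u) ∈ σ → arcᴵ p (inj₁ i) u (x i) ≡ true
        gadget-free 1F _ = x₁-free
        gadget-free 2F _ = x₂-free
        gadget-free 3F _ = x₃-free
        gadget-free 5F _ = y-free
        gadget-free 7F _ = z-free
        gadget-free 8F ()

        x∈ : ∀ i → x i ∈ W (inj₁ i)
        x∈ 0F = inside (star-∈ 0F refl)
        x∈ 1F = x₁∈
        x∈ 2F = x₂∈
        x∈ 3F = x₃∈
        x∈ 4F = inside (star-∈ 4F refl)
        x∈ 5F = y∈
        x∈ 6F = inside (star-∈ 6F refl)
        x∈ 7F = z∈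
        x∈ 8F = inside (star-∈ 8F refl)

        arc₉ : Fin 9 → Fin 9 → Bool
        arc₉ i j = arcᴵ (inj₁ i) (inj₁ j) (x i) (x j)

        a b : Bool
        a = not (arc₉ 1F 7F)
        b = not (arc₉ 3F 5F)

        rank≢ : ∀ {i j : Fin 9} → i ≢ j → rank (inj₁ i) ≢ rank (inj₁ j)
        rank≢ {i} {j} i≢j eq with refl ← rank-injective {inj₁ i} {inj₁ j} eq = i≢j refl

        arc₉-sym : ∀ {i j} → i ≢ j → arc₉ i j ≡ arc₉ j i
        arc₉-sym {i} {j} i≢j = arc-sym (rank≢ i≢j)

        chain-arc : ∀ {i j} → rank (inj₁ i) < rank (inj₁ j) → blk (inj₁ i) ≡ blk (inj₁ j) → arc₉ i j ≡ true
        chain-arc {i} {j} lt eq = trans (arc-< lt) (run lt eq (x∈ i) (x∈ j))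

        gadget-arcs : ∀ i j → isStar i ≡ false → isStar j ≡ false → (toℕ i <ᵇ toℕ j) ≡ true → arc₉ i j ≡ not (back₉ a b i j)
        gadget-arcs 1F 2F _ _ _ = chain-arc {1F} {2F} (s≤s (s≤s z≤n)) (chain-blk {1F} {2F} refl refl (s≤s z≤n) (s≤s (s≤s z≤n)) (s≤s (s≤s z≤n)))
        gadget-arcs 1F 3F _ _ _ = chain-arc {1F} {3F} (s≤s (s≤s z≤n)) (chain-blk {1F} {3F} refl refl (s≤s z≤n) (s≤s (s≤s z≤n)) ≤-refl)
        gadget-arcs 2F 3F _ _ _ = chain-arc {2F} {3F} (s≤s (s≤s (s≤s z≤n))) (chain-blk {2F} {3F} refl refl (s≤s z≤n) (s≤s (s≤s (s≤s z≤n))) ≤-refl)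
        gadget-arcs 1F 5F _ _ _ = trans (arc₉-sym {1F} {5F} λ ()) y-x₁
        gadget-arcs 1F 7F _ _ _ = sym (trans (cong not (Bool.∨-identityʳ a)) (Bool.not-involutive _))
        gadget-arcs 2F 5F _ _ _ = trans (arc₉-sym {2F} {5F} λ ()) y-x₂
        gadget-arcs 2F 7F _ _ _ = trans (arc₉-sym {2F} {7F} λ ()) z-x₂
        gadget-arcs 3F 5F _ _ _ = sym (trans (cong not (Bool.∨-identityʳ b)) (Bool.not-involutive _))
        gadget-arcs 3F 7F _ _ _ = trans (arc₉-sym {3F} {7F} λ ()) z-x₃
        gadget-arcs _ 8F _ () _
        gadget-arcs 4F 5F () _ _
        gadget-arcs 5F 5F _ _ ()
        gadget-arcs 6F 5F () _ _
        gadget-arcs 7F 5F _ _ ()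
        gadget-arcs 8F 5F () _ _
        gadget-arcs 6F 7F () _ _
        gadget-arcs 7F 7F _ _ ()
        gadget-arcs 8F 7F () _ _
        gadget-arcs 5F 7F _ _ _ = trans (arc₉-sym {5F} {7F} λ ()) z-y

        arcs : ∀ i j → i ≢ j → arc₉ i j ≡ not (back₉ a b i j)
        arcs i j i≢j = by-kind (isStar i) (isStar j) refl refl
          where
          by-kind : ∀ k l → isStar i ≡ k → isStar j ≡ l → arc₉ i j ≡ not (back₉ a b i j)
          by-kind true true ei ej = trans (valid (star-∈ i ei) (star-∈ j ej) λ { refl → i≢j refl })
                                          (cong not (sym (back₉-star a b i j ei ej)))
          by-kind true false ei ej = trans (gadget-free j ej (star-∈ i ei)) (cong not (sym (back₉-mixed a b i j ei ej)))
          by-kind false true ei ej = trans (arc₉-sym i≢j) (trans (gadget-free i ei (star-∈ j ej))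
            (cong not (sym (trans (back₉-sym a b i j) (back₉-mixed a b j i ej ei)))))
          by-kind false false ei ej with <-cmp (toℕ i) (toℕ j)
          ... | tri< lt _ _ = gadget-arcs i j ei ej (<ᵇ-true lt)
          ... | tri≈ _ eq _ = contradiction (toℕ-injective eq) i≢j
          ... | tri> _ _ gt = trans (arc₉-sym i≢j) (trans (gadget-arcs j i ej ei (<ᵇ-true gt)) (cong not (back₉-sym a b j i)))

        reverse : ∀ {u v} → u ≢ v → E u v ≡ not (E v u)
        reverse = IsTournament.tourn isT _ _

        edges₉ : ∀ i j → i ≢ j → E (x i) (x j) ≡ tournament₉ a b i j
        edges₉ i j i≢j with <-cmp (toℕ i) (toℕ j)
        ... | tri< lt _ _ rewrite <ᵇ-true lt = trans (sym (arc-< (rank-mono₁ lt))) (arcs i j i≢j)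
        ... | tri≈ _ eq _ = contradiction (toℕ-injective eq) i≢j
        ... | tri> _ _ gt rewrite <ᵇ-false (<-asym gt) = begin
          E (x i) (x j)                  ≡⟨ reverse (disjoint {inj₁ i} {inj₁ j} (λ { refl → i≢j refl }) (x∈ i) (x∈ j)) ⟩
          not (E (x j) (x i))            ≡⟨ cong not (trans (sym (arc-> (rank-mono₁ gt))) (arcs i j i≢j)) ⟩
          not (not (back₉ a b i j))      ≡⟨ Bool.not-involutive _ ⟩
          back₉ a b i j                  ∎
          where open ≡-Reasoning

        open HsCopy (hsCopy a b)

        g-vertex : Fin r → V
        g-vertex g = proj₁ (covers-g g)

        g-∈ : ∀ g → (inj₂ g , g-vertex g) ∈ σ
        g-∈ g = proj₂ (covers-g g)

        f : Fin 7 ⊎ Fin r → V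
        f (inj₁ i) = x (κ i)
        f (inj₂ g) = g-vertex g

        κ-injective : ∀ {i j} → i ≢ j → κ i ≢ κ j
        κ-injective {i} {j} i≢j with κ-hom i j
        ... | inj₁ eq       = contradiction eq i≢j
        ... | inj₂ (ne , _) = ne

        distinct : ∀ {u v} → u ≢ v → f u ≢ f v
        distinct {inj₁ i} {inj₁ j} ne = disjoint {inj₁ (κ i)} {inj₁ (κ j)} (λ { eq → κ-injective {i} {j} (λ { refl → ne refl }) (inj₁-inj eq) }) (x∈ (κ i)) (x∈ (κ j))
          where
          inj₁-inj : ∀ {i j : Fin 9} → _≡_ {A = Cell} (inj₁ i) (inj₁ j) → i ≡ j
          inj₁-inj refl = refl
        distinct {inj₁ i} {inj₂ g} _ = disjoint {inj₁ (κ i)} {inj₂ g} (λ ()) (x∈ (κ i)) (inside (g-∈ g))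
        distinct {inj₂ g} {inj₁ i} _ = disjoint {inj₂ g} {inj₁ (κ i)} (λ ()) (inside (g-∈ g)) (x∈ (κ i))
        distinct {inj₂ g} {inj₂ g′} ne = disjoint {inj₂ g} {inj₂ g′} (λ { refl → ne refl }) (inside (g-∈ g)) (inside (g-∈ g′))

        hom-h : ∀ i j → i ≢ j → E (x (κ i)) (x (κ j)) ≡ H (inj₁ i) (inj₁ j)
        hom-h i j i≢j with κ-hom i j | Hs-anti i j
        ... | inj₁ eq | _ = contradiction eq i≢j
        ... | _ | inj₁ eq = contradiction eq i≢j
        ... | inj₂ (κ≢ , e) | inj₂ anti = trans (edges₉ (κ i) (κ j) κ≢) (trans e
              (sym (fromBackward-backwardPair (ρ₁ r₁ r₂) Hs {i} {j} (ρ₁-injective i≢j) anti)))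

        back-g : ∀ g g′ → backwardPair toℕ G g g′ ≡ leaf (inj₂ g) (inj₂ g′) ∨ leaf (inj₂ g′) (inj₂ g)
        back-g g g′ = by-cases (adj? g g′)
          where
          l l′ : Bool
          l  = leaf (inj₂ g) (inj₂ g′)
          l′ = leaf (inj₂ g′) (inj₂ g)
          by-cases : Dec (adjB G g g′) → backwardPair toℕ G g g′ ≡ l ∨ l′
          by-cases (no ¬adj) = trans (Bool.¬-not ¬adj) (sym (cong₂ _∨_ (dec-false (leaf? (inj₂ g) (inj₂ g′)) (¬adj ∘ proj₂))
                                 (dec-false (leaf? (inj₂ g′) (inj₂ g)) λ l → ¬adj (adj-sym g′ g (proj₂ l)))))
          by-cases (yes adj) with adj-canonical adj
          ... | inj₁ can = trans adj (sym (cong (_∨ l′) (dec-true (leaf? (inj₂ g) (inj₂ g′)) (can , adj))))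
          ... | inj₂ can = trans adj (sym (trans (cong (l ∨_) (dec-true (leaf? (inj₂ g′) (inj₂ g)) (can , adj-sym g g′ adj)))
                                                 (Bool.∨-zeroʳ l)))

        hom-g< : ∀ {g g′} → toℕ g < toℕ g′ → E (g-vertex g) (g-vertex g′) ≡ G g g′
        hom-g< {g} {g′} lt = begin
          E (g-vertex g) (g-vertex g′)
            ≡⟨ arc-< (rank-mono₂ lt) ⟨
          arcᴵ (inj₂ g) (inj₂ g′) (g-vertex g) (g-vertex g′)
            ≡⟨ valid (g-∈ g) (g-∈ g′) (λ { refl → <-irrefl refl lt }) ⟩
          not (leaf (inj₂ g) (inj₂ g′) ∨ leaf (inj₂ g′) (inj₂ g))
            ≡⟨ cong not (back-g g g′) ⟨
          not (backwardPair toℕ G g g′)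
            ≡⟨ cong not (backwardPair-< toℕ G lt) ⟩
          not (G g′ g)
            ≡⟨ IsTournament.tourn G-tournament g g′ (λ { refl → <-irrefl refl lt }) ⟨
          G g g′ ∎
          where open ≡-Reasoning

        hom-g : ∀ g g′ → g ≢ g′ → E (g-vertex g) (g-vertex g′) ≡ H (inj₂ g) (inj₂ g′)
        hom-g g g′ g≢g′ = trans same (sym (fromBackward-backwardPair (ρ₂ r₁ r₂) G {g} {g′} (ρ₂-injective g≢g′) (anti g≢g′)))
          where
          anti : ∀ {g g′} → g ≢ g′ → G g g′ ≡ not (G g′ g)
          anti = IsTournament.tourn G-tournament _ _
          same : E (g-vertex g) (g-vertex g′) ≡ G g g′
          same with <-cmp (toℕ g) (toℕ g′)
          ... | tri< lt _ _ = hom-g< lt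
          ... | tri≈ _ eq _ = contradiction (toℕ-injective eq) g≢g′
          ... | tri> _ _ gt = trans (reverse (distinct {inj₂ g} {inj₂ g′} λ { refl → g≢g′ refl }))
                                    (trans (cong not (hom-g< gt)) (sym (anti g≢g′)))

        mixed-arc : ∀ i g → arcᴵ (inj₁ i) (inj₂ g) (x i) (g-vertex g) ≡ true
        mixed-arc i g = by-kind (isStar i) refl
          where
          by-kind : ∀ k → isStar i ≡ k → arcᴵ (inj₁ i) (inj₂ g) (x i) (g-vertex g) ≡ true
          by-kind true  e = valid (star-∈ i e) (g-∈ g) λ ()
          by-kind false e = trans (arc-sym (rank-mixed i g)) (gadget-free i e (g-∈ g))

        -- A vertex `hᵢ` that is moved to another cell stays in front of `G`, where its proper place
        -- is as well; the others keep their rank. So no position relative to `G` changes.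
        hom-mixed : ∀ i g → E (x (κ i)) (g-vertex g) ≡ H (inj₁ i) (inj₂ g)
        hom-mixed i g with κ-rank i
        ... | inj₂ (κ< , i<) = trans (trans (sym (arc-< κ<g)) (mixed-arc (κ i) g)) (sym (<ᵇ-true (s≤s⁻¹ i<g)))
          where
          before : ∀ {j : Fin 9} → toℕ j < 7 → rank (inj₁ j) < rank (inj₂ g)
          before {j} lt = go (view₉ (toℕ<n j)) lt
            where
            go : ∀ {k} → View₉ k → k < 7 → rank₉ k < rank (inj₂ g)
            go (small _ e) lt rewrite e = small-before g lt
            go seven lt = contradiction lt (<-irrefl refl)
            go eight lt = contradiction lt (<-asym (n<1+n 7))
          κ<g : rank (inj₁ (κ i)) < rank (inj₂ g)
          κ<g = before κ<
          i<g : suc (ρ₁ r₁ r₂ i) < rank (inj₂ g)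
          i<g = subst (_< rank (inj₂ g)) (sym (rank-ρ₁ i)) (before i<)
        ... | inj₁ eq = by-order (<-cmp (ρ₁ r₁ r₂ i) (ρ₂ r₁ r₂ g))
          where
          κ-ρ₁ : rank (inj₁ (κ i)) ≡ suc (ρ₁ r₁ r₂ i)
          κ-ρ₁ = trans (cong (rank ∘ inj₁) eq) (sym (rank-ρ₁ i))
          by-order : Tri (ρ₁ r₁ r₂ i < ρ₂ r₁ r₂ g) (ρ₁ r₁ r₂ i ≡ ρ₂ r₁ r₂ g) (ρ₂ r₁ r₂ g < ρ₁ r₁ r₂ i) →
                     E (x (κ i)) (g-vertex g) ≡ H (inj₁ i) (inj₂ g)
          by-order (tri< lt _ _) = trans (trans (sym (arc-< (subst (_< rank (inj₂ g)) (sym κ-ρ₁) (s≤s lt)))) (mixed-arc (κ i) g)) (sym (<ᵇ-true lt))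
          by-order (tri≈ _ e _)  = contradiction (trans κ-ρ₁ (cong suc e)) (rank-mixed (κ i) g)
          by-order (tri> _ _ gt) = trans (reverse (distinct {inj₁ i} {inj₂ g} λ ()))
            (trans (cong not (trans (sym (arc-> (subst (rank (inj₂ g) <_) (sym κ-ρ₁) (s≤s gt)))) (mixed-arc (κ i) g))) (sym (<ᵇ-false (<-asym gt))))

        hom-mixed′ : ∀ g i → E (g-vertex g) (x (κ i)) ≡ H (inj₂ g) (inj₁ i)
        hom-mixed′ g i = trans (reverse (distinct {inj₂ g} {inj₁ i} λ ()))
          (trans (cong not (hom-mixed i g)) (sym (<ᵇ-anti (ρ-mixed i g ∘ sym))))

        hom : ∀ u v → u ≢ v → E (f u) (f v) ≡ H u v
        hom (inj₁ i) (inj₁ j)  ne = hom-h i j λ { refl → ne refl }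
        hom (inj₁ i) (inj₂ g)  _  = hom-mixed i g
        hom (inj₂ g) (inj₁ i)  _  = hom-mixed′ g i
        hom (inj₂ g) (inj₂ g′) ne = hom-g g g′ λ { refl → ne refl }

    α-galaxy-copy : Σ (Fin 7 ⊎ Fin r → V) λ f → ∀ u v → u ≢ v → E (f u) (f v) ≡ alphaGalaxy r₁ r₂ r₃ G u v
    α-galaxy-copy = WithSelection.WithGadget.f selected gd , WithSelection.WithGadget.hom selected gd
      where gd = WithSelection.the-gadget selected

-- Constants and the critical case

n<2^n : ∀ n → n < 2 ^ n
n<2^n zero    = s≤s z≤n
n<2^n (suc n) = begin
  suc (suc n)           ≤⟨ s≤s (n<2^n n) ⟩
  1 + 2 ^ n             ≤⟨ +-monoˡ-≤ (2 ^ n) (m^n>0 2 n) ⟩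
  2 ^ n + 2 ^ n         ≡⟨ cong (2 ^ n +_) (+-identityʳ (2 ^ n)) ⟨
  2 ^ suc n             ∎
  where open ≤-Reasoning

at : ∀ {A : Set} → List (List A) → ℕ → List A
at []       _       = []
at (Z ∷ Zs) zero    = Z
at (Z ∷ Zs) (suc i) = at Zs i

at-All : ∀ {A : Set} {P : List A → Set} {Zs i} → All P Zs → i < length Zs → P (at Zs i)
at-All {i = zero}  (p ∷ ps) _        = p
at-All {i = suc i} (p ∷ ps) (s≤s i<) = at-All ps i<

at-AllPairs : ∀ {A : Set} {R : List A → List A → Set} {Zs i j} → AllPairs R Zs → i < j → j < length Zs → R (at Zs i) (at Zs j)
at-AllPairs {i = zero}  {suc j} (r ∷ rs) _         (s≤s j<) = at-All r j<
at-AllPairs {i = suc i} {suc j} (r ∷ rs) (s≤s i<j) (s≤s j<) = at-AllPairs rs i<j j<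

-- `b` doubles `b₀` to turn `length X` into `suc (length X)`. `c` counts the fraction `1/Λ` of a
-- cell as linear, a cell being at least `1/(4M)` of its block. `d` is what `rich` asks for. The
-- summand `d * c` of `K` gives `(1 + 1/d)^K ≥ c`, and `e` makes every list longer than `K` fill its
-- blocks with `M` vertices and every `t > K` at least `2 * M`.
module Exponent (k M Λ N g : ℕ) .{{_ : NonZero k}} .{{_ : NonZero M}} .{{_ : NonZero g}} (2≤Λ : 2 ≤ Λ) where

  b₀ b c d e K : ℕ
  b₀ = spreadBound k N g
  b  = 2 * b₀
  c  = b * (4 * M * Λ)
  d  = 16 * M
  e  = 2 * M + b * M
  K  = d * c + e

  instance
    d≢0 : NonZero d
    d≢0 = m*n≢0 16 M
    b₀≢0 : NonZero b₀
    b₀≢0 = spreadBound≢0 k N g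
    b≢0 : NonZero b
    b≢0 = m*n≢0 2 b₀

  e≤K : e ≤ K
  e≤K = m≤n+m e (d * c)

  bM≤K : b * M ≤ K
  bM≤K = ≤-trans (m≤n+m (b * M) (2 * M)) e≤K

  b≤K : b ≤ K
  b≤K = ≤-trans (m≤m*n b M) bM≤K

  2M≤K : 2 * M ≤ K
  2M≤K = ≤-trans (m≤m+n (2 * M) (b * M)) e≤K

  b*2≤c : b * 2 ≤ c
  b*2≤c = *-monoʳ-≤ b (≤-trans 2≤Λ (m≤n*m Λ (4 * M) {{m*n≢0 4 M}}))

  K>0 : 0 < K
  K>0 = ≤-trans (>-nonZero⁻¹ b) b≤K

module LargeChains (r₁ r₂ r₃ : ℕ) (G : Rel (Fin (r₁ + r₂ + r₃))) (G-tournament : IsTournament G)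
                   (gal : IsGalaxyOrdering G) (nosplit : NoStarSplitAt G r₁)
                   {V : Set} (E : Rel V) (isT : IsTournament E)
                   (M Λ N g : ℕ) .{{_ : NonZero M}} .{{_ : NonZero Λ}} .{{_ : NonZero N}} .{{_ : NonZero g}} (2≤Λ : 2 ≤ Λ)
                   (M≥ : 9 + (r₁ + r₂ + r₃) ≤ M)
                   (Λ≥ : 2 * (length (allSum 9 (r₁ + r₂ + r₃)) * suc (length (allSum 9 (r₁ + r₂ + r₃))) + (length (allSum 9 (r₁ + r₂ + r₃)) + 4)) ≤ Λ)
                   (N≥ : suc (suc (double (length (allSum 9 (r₁ + r₂ + r₃))))) ≤ N)
                   (g≥ : cellBound (length (allSum 9 (r₁ + r₂ + r₃))) Λ M * (2 * N) ^ N ≤ g)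
                   (no-copy : ∀ (f : Fin 7 ⊎ Fin (r₁ + r₂ + r₃) → V) → ¬ (∀ u v → u ≢ v → E (f u) (f v) ≡ alphaGalaxy r₁ r₂ r₃ G u v)) where

  open Exponent (length (allSum 7 (r₁ + r₂ + r₃))) M Λ N g 2≤Λ
  open Layout r₁ r₂ r₃ G gal nosplit
  open Tournament E isT
  open Arcs E
  open Spread E isT using (_↛?_; Disjoint; CopyOf) renaming (spread to spread′)

  hs : List (Fin 7 ⊎ Fin r)
  hs = allSum 7 r

  no-CopyOf : ∀ f → ¬ CopyOf (Sum.≡-dec Fin._≟_ Fin._≟_) H hs f
  no-CopyOf f copy = no-copy f λ u v u≢v → [ proj₂ , reversed u≢v ]′ (pairs copy (∈-allSum u) (∈-allSum v) u≢v)
    where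
    reversed : ∀ {u v} → u ≢ v → f v ≢ f u × E (f v) (f u) ≡ H v u → E (f u) (f v) ≡ H u v
    reversed {u} {v} u≢v (ne , eq) = trans (IsTournament.tourn isT (f u) (f v) (ne ∘ sym)) (trans (cong not eq) (sym (H-anti {u} {v} u≢v)))
    pairs : ∀ {A : Set} {R : A → A → Set} {xs x y} → AllPairs R xs → x ∈ xs → y ∈ xs → x ≢ y → R x y ⊎ R y x
    pairs (r ∷ _)  (here refl) (here refl) ne = contradiction refl ne
    pairs (r ∷ _)  (here refl) (there y∈)  ne = inj₁ (All.lookup r y∈)
    pairs (r ∷ _)  (there x∈)  (here refl) ne = inj₂ (All.lookup r x∈)
    pairs (_ ∷ rs) (there x∈)  (there y∈)  ne = pairs rs x∈ y∈ ne

  index : Fin 7 ⊎ Fin r → ℕ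
  index = [ toℕ , (λ g → 7 + toℕ g) ]′

  index< : ∀ {h} → h ∈ hs → index h < length hs
  index< {inj₁ i} _ = ≤-trans (≤-trans (toℕ<n i) (m≤m+n 7 r)) (≤-reflexive (sym (length-allSum 7 r)))
  index< {inj₂ g} _ = ≤-trans (+-monoʳ-< 7 (toℕ<n g)) (≤-reflexive (sym (length-allSum 7 r)))

  index-injective : ∀ {h h′} → index h ≡ index h′ → h ≡ h′
  index-injective {inj₁ i} {inj₁ j} eq = cong inj₁ (toℕ-injective eq)
  index-injective {inj₁ i} {inj₂ g} eq = contradiction eq (<⇒≢ (≤-trans (toℕ<n i) (m≤m+n 7 (toℕ g))))
  index-injective {inj₂ g} {inj₁ i} eq = contradiction (sym eq) (<⇒≢ (≤-trans (toℕ<n i) (m≤m+n 7 (toℕ g))))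
  index-injective {inj₂ g} {inj₂ g′} eq = cong inj₂ (toℕ-injective (+-cancelˡ-≡ 7 _ _ eq))

  spread : ∀ X → Unique X → b₀ ≤ length X → Σ (List (List V)) λ Zs → length Zs ≡ 2 ^ N ×
           All (λ Z → Z ⊆ X × length X ≤ b₀ * length Z) Zs ×
           AllPairs (λ Z Z′ → tot _↛?_ Z Z′ * g ≤ length Z * length Z′ × Disjoint Z Z′) Zs
  spread = spread′ (Sum.≡-dec Fin._≟_ Fin._≟_) H hs (allSum-unique 7 r) index index< index-injective no-CopyOf N g

  -- The critical list is `X` with one vertex in front, so its size is `suc (length X)`. Working
  -- inside `X` puts every linear set, `X` included, under the induction hypothesis.
  module Critical (X : List V) (X-unique : Unique X)
                  (IH : ∀ {Y} → Y ⊆ X → Σ ℕ λ m → Chain m Y × length Y ≤ m ^ K)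
                  (t : ℕ) (t>0 : 0 < t) (2M≤t : 2 * M ≤ t) (max : ∀ {m} → Chain m X → m ≤ t)
                  (t^K< : t ^ K < suc (length X)) (2^K≤ : 2 ^ K ≤ length X) where

    n : ℕ
    n = suc (length X)

    linear-chain : ∀ {Y} → Y ⊆ X → n ≤ c * length Y → Σ ℕ λ m → Chain m Y × d * t ≤ suc d * m
    linear-chain {Y} Y⊆ le = let m , ch , Y≤ = IH Y⊆ in
      m , ch , long-chain d c K (exponent-beats d c e) t^K< le Y≤

    open Host E isT X n t c d t>0 max linear-chain

    K<X : K < length X
    K<X = ≤-trans (n<2^n K) 2^K≤

    module WithBlocks (Zs : List (List V)) (len : length Zs ≡ 2 ^ N)
                      (Zs-big : All (λ Z → Z ⊆ X × length X ≤ b₀ * length Z) Zs)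
                      (Zs-sparse : AllPairs (λ Z Z′ → tot _↛?_ Z Z′ * g ≤ length Z * length Z′ × Disjoint Z Z′) Zs) where

      Z₀ : ℕ → List V
      Z₀ = at Zs

      -- Depth `N` in `spread` gives `2 ^ N` sets, which is more than `N`; this avoids a logarithm.
      bound : ∀ {i} → i < N → i < length Zs
      bound i< = <-trans i< (subst (N <_) (sym len) (n<2^n N))

      Z₀-linear : ∀ {i} → i < N → LinearBlock b (Z₀ i)
      Z₀-linear {i} i< = record { ⊆X = proj₁ Z∈ ; large = begin
          suc (length X)                 ≤⟨ +-monoˡ-≤ (length X) (≤-trans (s≤s z≤n) K<X) ⟩
          length X + length X            ≤⟨ +-mono-≤ (proj₂ Z∈) (proj₂ Z∈) ⟩
          b₀ * l + b₀ * l                ≡⟨ shuffle b₀ l ⟩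
          b * l                          ∎ }
        where
        open ≤-Reasoning
        l = length (Z₀ i)
        Z∈ : Z₀ i ⊆ X × length X ≤ b₀ * l
        Z∈ = at-All Zs-big (bound i<)
        shuffle : ∀ b l → b * l + b * l ≡ 2 * b * l
        shuffle = solve-∀

      Z₀-big : ∀ {i} → i < N → M ≤ length (Z₀ i)
      Z₀-big {i} i< = *-cancelˡ-≤ b₀ (begin
          b₀ * M                 ≤⟨ *-monoˡ-≤ M (m≤n*m b₀ 2) ⟩
          b * M                  ≤⟨ bM≤K ⟩
          K                      ≤⟨ <⇒≤ K<X ⟩
          length X               ≤⟨ proj₂ (at-All Zs-big (bound i<)) ⟩
          b₀ * length (Z₀ i)     ∎)
        where open ≤-Reasoning

      Z₀-disjoint : ∀ {i j x y} → i < N → j < N → i ≢ j → x ∈ Z₀ i → y ∈ Z₀ j → x ≢ y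
      Z₀-disjoint {i} {j} i< j< i≢j x∈ y∈ with <-cmp i j
      ... | tri< lt _ _ = proj₂ (at-AllPairs Zs-sparse lt (bound j<)) x∈ y∈
      ... | tri≈ _ eq _ = contradiction eq i≢j
      ... | tri> _ _ gt = proj₂ (at-AllPairs Zs-sparse gt (bound i<)) y∈ x∈ ∘ sym

      Z₀-sparse : SparseFamily N g Z₀
      Z₀-sparse {i} {j} i< j< i≢j with <-cmp i j
      ... | tri< lt _ _ = ≤-trans (*-monoˡ-≤ g (tot-mono (nonarc? i j) _↛?_ (trans (sym (arc-< lt))) (Z₀ i) (Z₀ j)))
                                  (proj₁ (at-AllPairs Zs-sparse lt (bound j<)))
      ... | tri≈ _ eq _ = contradiction eq i≢j
      ... | tri> _ _ gt = begin
        tot (nonarc? i j) (Z₀ i) (Z₀ j) * g          ≡⟨ cong (_* g) (tot-flip (nonarc? i j) (Z₀ i) (Z₀ j)) ⟩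
        tot (flip (nonarc? i j)) (Z₀ j) (Z₀ i) * g   ≤⟨ *-monoˡ-≤ g (tot-mono (flip (nonarc? i j)) _↛?_ (trans (sym (arc-> gt))) (Z₀ j) (Z₀ i)) ⟩
        tot _↛?_ (Z₀ j) (Z₀ i) * g                   ≤⟨ proj₁ (at-AllPairs Zs-sparse gt (bound i<)) ⟩
        length (Z₀ j) * length (Z₀ i)                ≡⟨ *-comm (length (Z₀ j)) (length (Z₀ i)) ⟩
        length (Z₀ i) * length (Z₀ j)                ∎
        where open ≤-Reasoning

      all-blocks : Blocks N M b b*2≤c 2M≤t even Z₀ Z₀-linear Z₀-big N (cellBound (length allCells) Λ M)
      all-blocks = blocks N M b b*2≤c 2M≤t even Z₀ Z₀-linear Z₀-big N (cellBound (length allCells) Λ M) ≤-refl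
        λ {i} {j} i< j< i≢j → ≤-trans (*-monoʳ-≤ (tot (nonarc? i j) (Z₀ i) (Z₀ j)) g≥) (Z₀-sparse i< j< i≢j)

      module WithCells (cs : Cells (Sum.≡-dec Fin._≟_ Fin._≟_) allCells ∈-allSum rank blk rank-injective even N M b Λ 2≤Λ (λ i → ≤-trans (rank< i) M≥) (λ i → ≤-trans (blk< i) N≥)
                               (λ {i} {j} → blk-mono {i} {j}) (λ {i} {j} → blk-equal {i} {j}) ≤-refl ≤-refl (λ i → even (blk i) ≡ false)) where

        open Cells cs
        open FindCopy r₁ r₂ r₃ G G-tournament gal nosplit E isT using (α-galaxy-copy)

        absurd : ⊥
        absurd = let f , hom = α-galaxy-copy W W-pos Λ smooth (λ {i} {j} → run {i} {j}) (λ {i} {j} → disjoint {i} {j}) no-cut Λ≥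
                 in no-copy f hom

      absurd : ⊥
      absurd = WithCells.absurd (Host.cells E isT X n t c d t>0 max linear-chain
          (Sum.≡-dec Fin._≟_ Fin._≟_) allCells ∈-allSum rank blk rank-injective even N M b Λ 2≤Λ (λ i → ≤-trans (rank< i) M≥) (λ i → ≤-trans (blk< i) N≥)
          (λ {i} {j} → blk-mono {i} {j}) (λ {i} {j} → blk-equal {i} {j}) ≤-refl ≤-refl
          Z (λ i< → chains i<) (λ i< kind → lines i< (inj₂ kind)) big
          (λ i< j< i≢j x∈ y∈ → Z₀-disjoint i< j< i≢j (inside i< x∈) (inside j< y∈)) sparse)
        where open Blocks all-blocks

    contradictory : ⊥
    contradictory = let Zs , len , Zs-big , Zs-sparse = spread X X-unique (≤-trans (m≤n*m b₀ 2) (≤-trans b≤K (<⇒≤ K<X)))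
      in WithBlocks.absurd Zs len Zs-big Zs-sparse

  -- The recursion runs on the bound `n` for the length, since the hypothesis is applied to
  -- arbitrary sublists and not just to the tail.
  large-chain : ∀ n X → length X ≤ n → Unique X → Σ ℕ λ m → Chain m X × length X ≤ m ^ K
  large-chain n       []       _        _        = 0 , ([] , refl , [] , []) , z≤n
  large-chain (suc n) (x ∷ X) (s≤s le) (x≢ ∷ u) = from-max (max-chain (x ∷ X) (suc (length X)))
    where
    from-max : (Σ ℕ λ t → Chain t (x ∷ X) × ¬ Chain (suc t) (x ∷ X)) ⊎ Chain (suc (length X)) (x ∷ X) →
               Σ ℕ λ m → Chain m (x ∷ X) × suc (length X) ≤ m ^ K
    from-max (inj₂ ch) = suc (length X) , ch ,
      ≤-trans (≤-reflexive (sym (^-identityʳ (suc (length X))))) (^-monoʳ-≤ (suc (length X)) K>0)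
    from-max (inj₁ (t , ch , ¬ch)) with suc (length X) ≤? t ^ K
    ... | yes big = t , ch , big
    ... | no ¬big = ⊥-elim (impossible (suc (length X) ≤? 2 ^ K))
      where
      max : ∀ {m} → Chain m (x ∷ X) → m ≤ t
      max ch′ = ≮⇒≥ λ lt → ¬ch (Chain-≤ lt ch′)
      t>0 : 0 < t
      t>0 = max (log-chain 0 (x ∷ X) (x≢ ∷ u) (s≤s z≤n))
      impossible : Dec (suc (length X) ≤ 2 ^ K) → ⊥
      impossible (yes X≤2^K) with 2 ≤? suc (length X)
      ... | no ¬2≤ = ¬big (≤-trans (s≤s⁻¹ (≰⇒> ¬2≤)) (m^n>0 t {{>-nonZero t>0}} K))
      -- Up to `2 ^ K` vertices, a chain of two vertices is enough.
      ... | yes 2≤ = ¬big (≤-trans X≤2^K (^-monoˡ-≤ K (max (log-chain 1 (x ∷ X) (x≢ ∷ u) 2≤))))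
      -- Now the logarithmic bound gives `t > K ≥ 2 * M`.
      impossible (no X≰2^K) = Critical.contradictory X u
        (λ {Y} Y⊆ → large-chain n Y (≤-trans (length-mono-≤ Y⊆) le) (AllPairs-⊆ Y⊆ u))
        t t>0 (≤-trans 2M≤K (<⇒≤ (max′ (log-chain K X u 2^K≤)))) max′ (≰⇒> ¬big) 2^K≤
        where
        max′ : ∀ {m} → Chain m X → m ≤ t
        max′ = max ∘ Chain-resp there
        2^K≤ : 2 ^ K ≤ length X
        2^K≤ = s≤s⁻¹ (≰⇒> X≰2^K)

-- From chains to transitive subtournaments

increasing-≤ : ∀ {k} (f : Fin (suc k) → ℕ) → (∀ (i : Fin k) → f (inject₁ i) < f (fsuc i)) → f fzero ≤ f (fromℕ k)
increasing-≤ {zero}  f up = ≤-refl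
increasing-≤ {suc k} f up = ≤-trans (<⇒≤ (up fzero)) (increasing-≤ (f ∘ fsuc) (up ∘ fsuc))

chain-lookup : ∀ {A : Set} {R : A → A → Set} {xs} → AllPairs R xs → ∀ {i j} → toℕ i < toℕ j → R (lookup xs i) (lookup xs j)
chain-lookup (r ∷ rs) {fzero}  {fsuc j} _        = All.lookup r (∈-lookup j)
chain-lookup (r ∷ rs) {fsuc i} {fsuc j} (s≤s lt) = chain-lookup rs lt

transitive-sub : ∀ {n} (T : Rel (Fin n)) (isT : IsTournament T) {m xs} → Tournament.Chain T isT m xs → HasTransitiveSub T m
transitive-sub T isT (c , refl , ch , _) = lookup c , (λ {i} {j} → injective i j) , acyclic
  where
  open Tournament T isT
  injective : ∀ i j → lookup c i ≡ lookup c j → i ≡ j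
  injective i j eq with <-cmp (toℕ i) (toℕ j)
  ... | tri< lt _ _ = contradiction eq (⟶⇒≢ (chain-lookup ch lt))
  ... | tri≈ _ e _  = toℕ-injective e
  ... | tri> _ _ gt = contradiction (sym eq) (⟶⇒≢ (chain-lookup ch gt))
  increasing : ∀ {i j} → lookup c i ⟶ lookup c j → toℕ i < toℕ j
  increasing {i} {j} e with <-cmp (toℕ i) (toℕ j)
  ... | tri< lt _ _ = lt
  ... | tri≈ _ eq _ = contradiction (cong (lookup c) (toℕ-injective eq)) (⟶⇒≢ e)
  ... | tri> _ _ gt with () ← trans (sym (chain-lookup ch gt)) (⟶-asym e)
  acyclic : Transitive (λ i j → T (lookup c i) (lookup c j))
  acyclic (k , f , _ , up , back) = <⇒≱ (increasing back) (increasing-≤ (toℕ ∘ f) (increasing ∘ up))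

record AtLeast (k : ℕ) : Set where
  field
    value   : ℕ
    value≢0 : NonZero value
    bound   : k ≤ value

-- Keeps the large constants opaque.
next : ∀ k → AtLeast k
next k = record { value = suc k ; value≢0 = _ ; bound = n≤1+n k }

module Conclusion (r₁ r₂ r₃ : ℕ) (G : Rel (Fin (r₁ + r₂ + r₃))) (G-tournament : IsTournament G)
                  (gal : IsGalaxyOrdering G) (nosplit : NoStarSplitAt G r₁) where

  open Layout r₁ r₂ r₃ G gal nosplit using (r; H; H-irrefl; H-anti)
  open AtLeast

  -- Injectivity follows from the edges: if two distinct vertices had the same image, both edges
  -- between them in `H` would be `false`.
  no-copy : ∀ {n} (T : Rel (Fin n)) → IsTournament T → ¬ Contains H T → ∀ f → ¬ (∀ u v → u ≢ v → T (f u) (f v) ≡ H u v)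
  no-copy T isT free f hom = free (f , (λ {u} {v} → injective u v) , edges)
    where
    open IsTournament isT
    _≟ᵁ_ : DecidableEquality (Fin 7 ⊎ Fin r)
    _≟ᵁ_ = Sum.≡-dec Fin._≟_ Fin._≟_
    no-edge : ∀ u v → u ≢ v → f u ≡ f v → H u v ≡ false
    no-edge u v u≢v eq = trans (sym (hom u v u≢v)) (trans (cong (T (f u)) (sym eq)) (irrefl (f u)))
    injective : ∀ u v → f u ≡ f v → u ≡ v
    injective u v eq with u ≟ᵁ v
    ... | yes u≡v = u≡v
    ... | no u≢v with () ← trans (sym (no-edge u v u≢v eq)) (trans (H-anti {u} {v} u≢v) (cong not (no-edge v u (u≢v ∘ sym) (sym eq))))
    edges : ∀ u v → H u v ≡ T (f u) (f v)
    edges u v with u ≟ᵁ v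
    ... | yes refl = trans (H-irrefl u) (sym (irrefl (f u)))
    ... | no u≢v   = sym (hom u v u≢v)

  #cells : ℕ
  #cells = length (allSum 9 r)

  polynomial-chains : (M : AtLeast (9 + r)) (Λ : AtLeast (2 * (#cells * suc #cells + (#cells + 4))))
                      (N : AtLeast (suc (suc (double #cells))))
                      (g : AtLeast (cellBound #cells (value Λ) (value M) * (2 * value N) ^ value N)) →
    Σ ℕ λ q → 0 < q × ((n : ℕ) (T : Rel (Fin n)) → IsTournament T → ¬ Contains H T →
    Σ ℕ λ m → HasTransitiveSub T m × n ^ 1 ≤ m ^ q)
  polynomial-chains M Λ N g = K , K>0 , λ n T isT free →
    let m , ch , le = LargeChains.large-chain r₁ r₂ r₃ G G-tournament gal nosplit T isT
                        (value M) (value Λ) (value N) (value g) 2≤Λ (bound M) (bound Λ) (bound N) (bound g)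
                        (no-copy T isT free) n (allFin n) (≤-reflexive (length-tabulate id)) (Uniqueₚ.allFin⁺ n)
    in m , transitive-sub T isT ch
         , subst (_≤ m ^ K) (trans (length-tabulate {n = n} id) (sym (^-identityʳ n))) le
    where
    instance
      M≢0 : NonZero (value M)
      M≢0 = value≢0 M
      Λ≢0 : NonZero (value Λ)
      Λ≢0 = value≢0 Λ
      N≢0 : NonZero (value N)
      N≢0 = value≢0 N
      g≢0 : NonZero (value g)
      g≢0 = value≢0 g
    2≤double : ∀ a b → 2 ≤ 2 * (a + (b + 4))
    2≤double a b = *-monoʳ-≤ 2 (≤-trans (s≤s z≤n) (≤-trans (m≤n+m 4 b) (m≤n+m (b + 4) a)))
    2≤Λ : 2 ≤ value Λ
    2≤Λ = ≤-trans (2≤double (#cells * suc #cells) #cells) (bound Λ)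
    open Exponent (length (allSum 7 r)) (value M) (value Λ) (value N) (value g) 2≤Λ using (K; K>0)

theorem20 : (r₁ r₂ r₃ : ℕ) (G : Rel (Fin (r₁ + r₂ + r₃))) →
    IsTournament G → IsGalaxyOrdering G → NoStarSplitAt G r₁ →
    Σ ℕ λ p → Σ ℕ λ q → 0 < p × 0 < q ×
    ((n : ℕ) (T : Rel (Fin n)) → IsTournament T →
    ¬ Contains (alphaGalaxy r₁ r₂ r₃ G) T →
    Σ ℕ λ m → HasTransitiveSub T m × n ^ p ≤ m ^ q)
theorem20 r₁ r₂ r₃ G G-tournament gal nosplit =
  let q , q>0 , chains = Conclusion.polynomial-chains r₁ r₂ r₃ G G-tournament gal nosplit (next _) (next _) (next _) (next _)
  in 1 , q , s≤s z≤n , q>0 , chains
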